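{- Let $l \in \{1,2,3\}$, $k \in \mathbb{N}_0$ and $\epsilon > 0$. Then there exist a natural number $q$ and a set $A \subset \mathbb{Z}_q$ such that \[A - A = \mathbb{Z}_q \quad\text{but}\quad |lA^2 + kA| < \epsilon q.\] Moreover, $q$ can be taken to be a product of distinct primes, and the smallest prime dividing $q$ can be taken to be arbitrarily large (i.e. for every $M$ one may choose $q$ so that all its prime factors exceed $M$).
   Context: $\mathbb{Z}_q$ denotes the integers modulo $q$. For $A \subset \mathbb{Z}_q$, $A - A = \{a - b : a,b \in A\}$ and \[lA^2 + kA = \{a_1a_2 + a_3a_4 + \dots + a_{2l-1}a_{2l} + a'_1 + \dots + a'_k : a_1,\dots,a_{2l},a'_1,\dots,a'_k \in A\}.\] -}

module Defs where

open import Data.Nat using (ℕ; zero; suc; _+_; _*_; _∸_; _<_; NonZero)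
open import Data.Nat.DivMod using (_%_)
open import Data.Nat.Primality using (Prime)
open import Data.Fin using (Fin; toℕ)
open import Data.Fin.Subset using (Subset; _∈_; ∣_∣)
open import Data.Fin.Subset.Properties using (_∈?_)
open import Data.Fin.Properties using (any?)
open import Data.Vec using (tabulate)
open import Data.List using (List)
open import Data.Nat.ListAction using (product)
open import Data.List.Relation.Unary.All using (All)
open import Data.List.Relation.Unary.Unique.Propositional using (Unique)
open import Data.Product using (Σ; ∃; _×_; _,_)
open import Relation.Nullary.Decidable using (⌊_⌋; _×-dec_)
open import Relation.Binary.PropositionalEquality using (_≡_)
import Data.Nat.Properties as ℕP

-- ℤ_q is represented by Fin q (residues 0,…,q-1); arithmetic is mod q.
-- Subsets of ℤ_q are  Subset q  (Data.Fin.Subset).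

module _ {q : ℕ} .{{_ : NonZero q}} where

  prodSet : Subset q → Subset q
  prodSet A = tabulate λ x → ⌊ any? (λ a → any? (λ b →
     (a ∈? A) ×-dec ((b ∈? A) ×-dec ((toℕ a * toℕ b) % q ℕP.≟ toℕ x)))) ⌋

  sumSet : Subset q → Subset q → Subset q
  sumSet B C = tabulate λ x → ⌊ any? (λ b → any? (λ c →
     (b ∈? B) ×-dec ((c ∈? C) ×-dec ((toℕ b + toℕ c) % q ℕP.≟ toℕ x)))) ⌋

  addCopies : ℕ → Subset q → Subset q → Subset q
  addCopies zero    A S = S
  addCopies (suc k) A S = addCopies k A (sumSet S A)

  sucCopiesA² : ℕ → Subset q → Subset q
  sucCopiesA² zero    A = prodSet A
  sucCopiesA² (suc m) A = sumSet (sucCopiesA² m A) (prodSet A)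

  lA²+kA : (l k : ℕ) → Subset q → Subset q
  lA²+kA zero    k A = addCopies k A (prodSet A)  -- junk value; l = 0 never used (theorem assumes l ≥ 1)
  lA²+kA (suc m) k A = addCopies k A (sucCopiesA² m A)

  DiffSetIsAll : Subset q → Set
  DiffSetIsAll A = (x : Fin q) → Σ (Fin q) λ a → Σ (Fin q) λ b →
     a ∈ A × b ∈ A × toℕ a ≡ (toℕ b + toℕ x) % q

ProductOfDistinctPrimesAbove : ℕ → ℕ → Set
ProductOfDistinctPrimesAbove M q = Σ (List ℕ) λ ps →
  All Prime ps × Unique ps × All (M <_) ps × product ps ≡ q

{-# OPTIONS --safe #-}
-- Take A to be a set of pairs f x, f x + x, so that A - A is everything.  For prescribed differences the elements of
-- lA² + kA are then values of forms F(a , x) with three quadratic terms: the variables a v are vertices and the terms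
-- are the edges of a multigraph.  For every such F there are a product r of large primes and strategies a v = σ v (x v)
-- for which F takes few values modulo r.  Usually some edge ends are fixed so that modulo its own prime each vertex
-- is free and F depends on it linearly (or quadratically, if it has a loop); the free vertex is used to make F congruent
-- to one integer N, modulo all the primes, which collects the values forced at the other primes and therefore
-- is small compared to r.  A few small graphs need special strategies.
--
-- The function f is built in stages by the Chinese remainder theorem.  When the modulus is q, a stage adds one such r
-- for each choice of residues modulo q of the 6 + k differences, equal residues being treated as one variable.  A tuple
-- of differences is caught unless some coincidence modulo q is destroyed by the stage; as coincidences are never
-- created, this happens only a bounded number of times, and every tuple is caught at some stage.
module Submission where

open import Data.Bool.Base using (Bool; true; false; if_then_else_; not; _xor_)
open import Data.Bool.Properties as Bool using (not-involutive)
open import Data.Empty using (⊥)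
open import Data.Fin.Base as Fin using (Fin; zero; suc; toℕ; fromℕ<; combine; _↑ʳ_; finToFun; funToFin)
open import Data.Fin.Patterns using (0F; 1F; 2F; 3F; 4F; 5F)
import Data.Fin.Properties as Fin
open import Data.Integer.Base as ℤ using (ℤ; +_; _⊖_; 0ℤ; 1ℤ; _%ℕ_; _/ℕ_; -[1+_])
open import Data.Integer.DivMod using (a≡a%ℕn+[a/ℕn]*n; n%ℕd<d)
import Data.Integer.Properties as ℤ
open import Data.Integer.Tactic.RingSolver using (solve-∀)
open import Data.List.Base using (List; []; _∷_; _++_)
open import Data.List.Relation.Unary.All as All using (All; []; _∷_)
import Data.List.Relation.Unary.All.Properties as All
open import Data.List.Relation.Unary.AllPairs using ([]; _∷_; AllPairs)
open import Data.List.Relation.Unary.Unique.Propositional using (Unique)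
import Data.List.Relation.Unary.Unique.Propositional.Properties as Unique
open import Data.Maybe.Base using (Maybe; just; nothing)
open import Data.Nat.Base as ℕ using (ℕ; zero; suc; NonZero; s≤s; z≤n)
open import Data.Nat.Coprimality as Coprime using (Coprime)
open import Data.Nat.DivMod as ℕ using (_%_)
import Data.Nat.Divisibility as ℕ∣
open import Data.Nat.GCD using (module Bézout)
open import Data.Nat.ListAction using (product)
open import Data.Nat.ListAction.Properties using (product-++; product≢0; ∈⇒≤product)
open import Data.Nat.Primality using (Prime; prime⇒nonZero; prime⇒nonTrivial)
open import Data.Nat.Primality.Factorisation using (factorise; module PrimeFactorisation)
import Data.Nat.Properties as ℕ
open import Data.Product.Base using (Σ; ∃; _×_; _,_; proj₁; proj₂; swap)
open import Data.Sum.Base using (inj₁; inj₂; _⊎_)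
open import Data.Unit.Base using (⊤; tt)
open import Function.Base using (_∘_; id)
open import Relation.Binary using (tri<; tri≈; tri>)
open import Relation.Binary.PropositionalEquality using (_≡_; _≢_; refl; sym; trans; cong; cong₂; subst; module ≡-Reasoning; subst₂; ≢-sym)
open import Relation.Nullary using (¬_; contradiction; Dec; yes; no; ⌊_⌋)
open import Relation.Nullary.Decidable using (_×-dec_; _⊎-dec_; map′; _→-dec_; dec-true; isYes≗does)
open import Relation.Unary using (Decidable)
open import Data.Nat.Tactic.RingSolver using () renaming (solve-∀ to ℕ-solve-∀)

-- An element `a v` may depend on the difference `x v` only, so no vertex can compensate for what
-- another one contributes. But the values of `F` need only be few. So each vertex `v` settles on a
-- natural number N(v) of its own, a function of `x v`: congruent to the contribution of `v` at the
-- primes where `v` is fixed, hence below their product, and copied by `v` at the one prime where it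
-- is free. Modulo every prime `F` then is the sum of the N(v), up to a small error caused by loops,
-- and this sum is at most a bounded multiple of the modulus divided by its smallest prime.
--
-- This needs a fixed end, with value 1, on every edge, whichever vertex is to be free; and a vertex
-- cannot have both its elements fixed. It fails for an edge between two looped vertices (both would
-- be free at the smallest prime), for two parallel edges with opposite ends, and for a triangle
-- unless at two of its vertices both edges use the same element. With three quadratic terms these
-- are the only exceptions, and they are the small graphs with special strategies.

-- Congruences and the Chinese remainder theorem

module Congruence where

  open import Data.Integer.Base using (-_; _+_; _*_; _-_; ∣_∣)
  open import Data.List.Base using (tabulate)

  record Cong (m : ℕ) (a b : ℤ) : Set where
    constructor cg
    field
      k  : ℤ
      eq : a ≡ b + k * + m

  ≡⇒Cong : ∀ {m a b} → a ≡ b → Cong m a b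
  ≡⇒Cong {m} {a} refl = cg 0ℤ (lem a (+ m))
    where lem : ∀ a m → a ≡ a + 0ℤ * m
          lem = solve-∀

  Cong-refl : ∀ {m a} → Cong m a a
  Cong-refl = ≡⇒Cong refl

  Cong-sym : ∀ {m a b} → Cong m a b → Cong m b a
  Cong-sym {m} {b = b} (cg k refl) = cg (- k) (lem b k (+ m))
    where lem : ∀ b k m → b ≡ b + k * m + - k * m
          lem = solve-∀

  Cong-trans : ∀ {m a b c} → Cong m a b → Cong m b c → Cong m a c
  Cong-trans {m} {c = c} (cg k refl) (cg j refl) = cg (j + k) (lem c j k (+ m))
    where lem : ∀ c j k m → c + j * m + k * m ≡ c + (j + k) * m
          lem = solve-∀

  infixr 5 _∙_
  _∙_ : ∀ {m a b c} → Cong m a b → Cong m b c → Cong m a c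
  _∙_ = Cong-trans

  Cong-+ : ∀ {m a b c d} → Cong m a b → Cong m c d → Cong m (a + c) (b + d)
  Cong-+ {m} {b = b} {d = d} (cg k refl) (cg j refl) = cg (k + j) (lem b d k j (+ m))
    where lem : ∀ b d k j m → b + k * m + (d + j * m) ≡ b + d + (k + j) * m
          lem = solve-∀

  Cong-* : ∀ {m a b c d} → Cong m a b → Cong m c d → Cong m (a * c) (b * d)
  Cong-* {m} {b = b} {d = d} (cg k refl) (cg j refl) = cg (k * d + j * b + k * j * + m) (lem b d k j (+ m))
    where lem : ∀ b d k j m → (b + k * m) * (d + j * m) ≡ b * d + (k * d + j * b + k * j * m) * m
          lem = solve-∀

  Cong-neg : ∀ {m a b} → Cong m a b → Cong m (- a) (- b)
  Cong-neg {m} {b = b} (cg k refl) = cg (- k) (lem b k (+ m))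
    where lem : ∀ b k m → - (b + k * m) ≡ - b + - k * m
          lem = solve-∀

  Cong-- : ∀ {m a b c d} → Cong m a b → Cong m c d → Cong m (a - c) (b - d)
  Cong-- p q = Cong-+ p (Cong-neg q)

  Cong-+ˡ : ∀ {m} a {b c} → Cong m b c → Cong m (a + b) (a + c)
  Cong-+ˡ a = Cong-+ (Cong-refl {a = a})

  Cong-*ˡ : ∀ {m} a {b c} → Cong m b c → Cong m (a * b) (a * c)
  Cong-*ˡ a = Cong-* (Cong-refl {a = a})

  Cong-divˡ : ∀ {m n a b} → Cong (m ℕ.* n) a b → Cong m a b
  Cong-divˡ {m} {n} {b = b} (cg k refl) = cg (k * + n) (trans (cong (λ z → b + k * z) (ℤ.pos-* m n)) (lem b k (+ m) (+ n)))
    where lem : ∀ b k m n → b + k * (m * n) ≡ b + k * n * m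
          lem = solve-∀

  Cong-divʳ : ∀ {m n a b} → Cong (m ℕ.* n) a b → Cong n a b
  Cong-divʳ {m} {n} {a} {b} = Cong-divˡ {n} {m} ∘ subst (λ t → Cong t a b) (ℕ.*-comm m n)

  Cong-% : ∀ a m .{{_ : NonZero m}} → Cong m a (+ (a %ℕ m))
  Cong-% a m = cg (a /ℕ m) (a≡a%ℕn+[a/ℕn]*n a m)

  Cong-1 : ∀ {a b} → Cong 1 a b
  Cong-1 {a} {b} = cg (a - b) (lem a b)
    where lem : ∀ a b → a ≡ b + (a - b) * 1ℤ
          lem = solve-∀

  private
    ∣-∣-small : ∀ {m x y} → x ℕ.≤ y → y ℕ.< m → Cong m (+ y) (+ x) → x ≡ y
    ∣-∣-small {m} {x} {y} x≤y y<m (cg k eq) = ℕ.≤-antisym x≤y (ℕ.m∸n≡0⇒m≤n (small {∣ k ∣} diff))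
      where
      cancel : ∀ x k m → x + k * m - x ≡ k * m
      cancel = solve-∀
      diff : y ℕ.∸ x ≡ ∣ k ∣ ℕ.* m
      diff = begin
        y ℕ.∸ x                 ≡⟨ cong ∣_∣ (sym (ℤ.⊖-≥ x≤y)) ⟩
        ∣ y ⊖ x ∣               ≡⟨ cong ∣_∣ (sym (ℤ.m-n≡m⊖n y x)) ⟩
        ∣ + y - + x ∣           ≡⟨ cong (λ z → ∣ z - + x ∣) eq ⟩
        ∣ + x + k * + m - + x ∣ ≡⟨ cong ∣_∣ (cancel (+ x) k (+ m)) ⟩
        ∣ k * + m ∣             ≡⟨ ℤ.abs-* k (+ m) ⟩
        ∣ k ∣ ℕ.* m             ∎
        where open ≡-Reasoning
      small : ∀ {d} → y ℕ.∸ x ≡ d ℕ.* m → y ℕ.∸ x ≡ 0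
      small {zero}  e = e
      small {suc d} e = contradiction
        (ℕ.≤-<-trans (ℕ.≤-trans (ℕ.m≤m+n m (d ℕ.* m)) (ℕ.≤-trans (ℕ.≤-reflexive (sym e)) (ℕ.m∸n≤m y x))) y<m)
        (ℕ.<-irrefl refl)

  Cong⇒≡ : ∀ {m x y} → x ℕ.< m → y ℕ.< m → Cong m (+ x) (+ y) → x ≡ y
  Cong⇒≡ {x = x} {y} x<m y<m c with ℕ.≤-total x y
  ... | inj₁ x≤y = ∣-∣-small x≤y y<m (Cong-sym c)
  ... | inj₂ y≤x = sym (∣-∣-small y≤x x<m c)

  Cong-%⇒≡ : ∀ {a b} m .{{_ : NonZero m}} → Cong m a b → a %ℕ m ≡ b %ℕ m
  Cong-%⇒≡ {a} {b} m c = Cong⇒≡ (n%ℕd<d a m) (n%ℕd<d b m) (Cong-sym (Cong-% a m) ∙ c ∙ Cong-% b m)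

  %-≡⇒Cong : ∀ {a b} m .{{_ : NonZero m}} → a %ℕ m ≡ b %ℕ m → Cong m a b
  %-≡⇒Cong {a} {b} m e = Cong-% a m ∙ ≡⇒Cong (cong +_ e) ∙ Cong-sym (Cong-% b m)

  coprime-* : ∀ {a m n} → Coprime a m → Coprime a n → Coprime a (m ℕ.* n)
  coprime-* am an {d} (d∣a , d∣mn) = an (d∣a , Coprime.coprime-divisor (λ (e∣d , e∣m) → am (ℕ∣.∣-trans e∣d d∣a , e∣m)) d∣mn)

  private
    inverse′ : ∀ {c m} → Coprime c m → Σ ℤ λ i → Cong m (+ c * i) 1ℤ
    inverse′ {c} {m} cop with Coprime.coprime-Bézout cop
    ... | Bézout.+- x y eq = + x , cg (+ y) (begin
      + c * + x                  ≡⟨ ℤ.*-comm (+ c) (+ x) ⟩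
      + x * + c                  ≡⟨ sym (ℤ.pos-* x c) ⟩
      + (x ℕ.* c)                ≡⟨ cong +_ (sym eq) ⟩
      + (1 ℕ.+ y ℕ.* m)          ≡⟨ ℤ.pos-+ 1 (y ℕ.* m) ⟩
      1ℤ + + (y ℕ.* m)           ≡⟨ cong (λ z → 1ℤ + z) (ℤ.pos-* y m) ⟩
      1ℤ + + y * + m             ∎)
      where open ≡-Reasoning
    ... | Bézout.-+ x y eq = - + x , cg (- + y) (begin
      + c * - + x                        ≡⟨ lem (+ c) (+ x) ⟩
      1ℤ - (1ℤ + + x * + c)              ≡⟨ cong (λ z → 1ℤ - (1ℤ + z)) (sym (ℤ.pos-* x c)) ⟩
      1ℤ - (1ℤ + + (x ℕ.* c))            ≡⟨ cong (λ z → 1ℤ - z) (sym (ℤ.pos-+ 1 (x ℕ.* c))) ⟩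
      1ℤ - + (1 ℕ.+ x ℕ.* c)             ≡⟨ cong (λ z → 1ℤ - + z) eq ⟩
      1ℤ - + (y ℕ.* m)                   ≡⟨ cong (λ z → 1ℤ - z) (ℤ.pos-* y m) ⟩
      1ℤ - + y * + m                     ≡⟨ lem′ (+ y) (+ m) ⟩
      1ℤ + - + y * + m                   ∎)
      where
      open ≡-Reasoning
      lem : ∀ c x → c * - x ≡ 1ℤ - (1ℤ + x * c)
      lem = solve-∀
      lem′ : ∀ y m → 1ℤ - y * m ≡ 1ℤ + - y * m
      lem′ = solve-∀

  abstract
    inverse : ∀ {c m} → Coprime c m → Σ ℤ λ i → Cong m (+ c * i) 1ℤ
    inverse = inverse′

  -- Write a = b + k m. The second congruence makes k m divisible by n, and multiplying by the
  -- inverse of m shows that n divides k.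
  Cong-pair : ∀ {m n a b} → Coprime m n → Cong m a b → Cong n a b → Cong (m ℕ.* n) a b
  Cong-pair {m} {n} {b = b} cop (cg k refl) q with inverse cop
  ... | i , mi≡1 with (Cong-sym (Cong-* mi≡1 (Cong-refl {a = k}) ∙ ≡⇒Cong (ℤ.*-identityˡ k)) ∙ ≡⇒Cong (lem (+ m) i k b) ∙ Cong-*ˡ i (Cong-- q (Cong-refl {a = b})) ∙ ≡⇒Cong (lem′ i b))
    where
    lem : ∀ m i k b → m * i * k ≡ i * (b + k * m - b)
    lem = solve-∀
    lem′ : ∀ i b → i * (b - b) ≡ 0ℤ
    lem′ = solve-∀
  ... | cg j k≡ = cg j (trans (cong (λ k → b + k * + m) k≡) (trans (lem b j (+ n) (+ m)) (cong (λ z → b + j * z) (sym (ℤ.pos-* m n)))))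
    where
    lem : ∀ b j n m → b + (0ℤ + j * n) * m ≡ b + j * (m * n)
    lem = solve-∀

  private
    crt₂′ : ∀ {m n} → Coprime m n → (s t : ℤ) → Σ ℤ λ z → Cong m z s × Cong n z t
    crt₂′ {m} {n} cop s t with inverse cop
    ... | i , mi≡1 = s + + m * i * (t - s)
      , cg (i * (t - s)) (lem s (+ m) i t)
      , Cong-+ˡ s (Cong-* mi≡1 (Cong-refl {a = t - s})) ∙ ≡⇒Cong (lem′ s t)
      where
      lem : ∀ s m i t → s + m * i * (t - s) ≡ s + i * (t - s) * m
      lem = solve-∀
      lem′ : ∀ s t → s + 1ℤ * (t - s) ≡ t
      lem′ = solve-∀

  abstract
    crt₂ : ∀ {m n} → Coprime m n → (s t : ℤ) → Σ ℤ λ z → Cong m z s × Cong n z t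
    crt₂ = crt₂′

  private
    residue′ : ∀ m .{{_ : NonZero m}} z → Σ ℕ λ u → u ℕ.< m × Cong m z (+ u)
    residue′ m z = z %ℕ m , n%ℕd<d z m , Cong-% z m

    residue₂′ : ∀ {m n} .{{_ : NonZero m}} .{{_ : NonZero n}} → Coprime m n → (s t : ℤ) →
      Σ ℕ λ u → u ℕ.< m ℕ.* n × Cong m (+ u) s × Cong n (+ u) t
    residue₂′ {m} {n} cop s t = u , u< , Cong-sym (Cong-divˡ z≡u) ∙ z≡s , Cong-sym (Cong-divʳ {m} z≡u) ∙ z≡t
      where
      z = crt₂ cop s t
      z≡s = proj₁ (proj₂ z)
      z≡t = proj₂ (proj₂ z)
      r = residue′ (m ℕ.* n) {{ℕ.m*n≢0 m n}} (proj₁ z)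
      u = proj₁ r
      u< = proj₁ (proj₂ r)
      z≡u = proj₂ (proj₂ r)

  abstract
    residue : ∀ m .{{_ : NonZero m}} z → Σ ℕ λ u → u ℕ.< m × Cong m z (+ u)
    residue = residue′

    residue₂ : ∀ {m n} .{{_ : NonZero m}} .{{_ : NonZero n}} → Coprime m n → (s t : ℤ) →
      Σ ℕ λ u → u ℕ.< m ℕ.* n × Cong m (+ u) s × Cong n (+ u) t
    residue₂ = residue₂′

  ∏ : ∀ {k} → (Fin k → ℕ) → ℕ
  ∏ p = product (tabulate p)

  PairwiseCoprime : ∀ {k} → (Fin k → ℕ) → Set
  PairwiseCoprime p = ∀ i j → i ≢ j → Coprime (p i) (p j)

  coprime-∏ : ∀ {a k} (p : Fin k → ℕ) → (∀ i → Coprime a (p i)) → Coprime a (∏ p)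
  coprime-∏ {k = zero}  p c = Coprime.sym (Coprime.1-coprimeTo _)
  coprime-∏ {k = suc k} p c = coprime-* (c zero) (coprime-∏ (p ∘ suc) (c ∘ suc))

  private
    head-coprime : ∀ {k} {p : Fin (suc k) → ℕ} → PairwiseCoprime p → Coprime (p zero) (∏ (p ∘ suc))
    head-coprime {p = p} c = coprime-∏ (p ∘ suc) (λ i → c zero (suc i) (λ ()))

    tail-coprime : ∀ {k} {p : Fin (suc k) → ℕ} → PairwiseCoprime p → PairwiseCoprime (p ∘ suc)
    tail-coprime c i j i≢j = c (suc i) (suc j) (λ { refl → i≢j refl })

  Cong-∏⇒ : ∀ {k a b} (p : Fin k → ℕ) → Cong (∏ p) a b → ∀ i → Cong (p i) a b
  Cong-∏⇒ p h zero    = Cong-divˡ h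
  Cong-∏⇒ p h (suc i) = Cong-∏⇒ (p ∘ suc) (Cong-divʳ {p zero} h) i

  private
    crt′ : ∀ {k} (p : Fin k → ℕ) → PairwiseCoprime p → (t : Fin k → ℤ) → Σ ℤ λ z → ∀ i → Cong (p i) z (t i)
    crt′ {zero}  p c t = 0ℤ , λ ()
    crt′ {suc k} p c t = proj₁ z , sol
      where
      y = crt′ (p ∘ suc) (tail-coprime {p = p} c) (t ∘ suc)
      z = crt₂ (head-coprime {p = p} c) (t zero) (proj₁ y)
      sol : ∀ i → Cong (p i) (proj₁ z) (t i)
      sol zero    = proj₁ (proj₂ z)
      sol (suc i) = Cong-trans (Cong-∏⇒ (p ∘ suc) (proj₂ (proj₂ z)) i) (proj₂ y i)

  abstract
    crt : ∀ {k} (p : Fin k → ℕ) → PairwiseCoprime p → (t : Fin k → ℤ) → Σ ℤ λ z → ∀ i → Cong (p i) z (t i)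
    crt = crt′

  Cong-∏ : ∀ {k} (p : Fin k → ℕ) → PairwiseCoprime p → ∀ {a b} → (∀ i → Cong (p i) a b) → Cong (∏ p) a b
  Cong-∏ {zero}  p c h = Cong-1
  Cong-∏ {suc k} p c h = Cong-pair (head-coprime {p = p} c) (h zero) (Cong-∏ (p ∘ suc) (tail-coprime {p = p} c) (h ∘ suc))

-- Prime lists, forms, strategies and covers

module Block where

  open Congruence
  open import Data.Nat.Base using (_!)
  open import Data.Integer.Base using (_+_; _*_)
  open import Data.List.Base using (tabulate)
  open import Data.List.Membership.Propositional using (_∈_)

  private
    -- Euclid: a prime factor of M! + 1 cannot be at most M, since it would divide M! as well.
    primeAbove′ : ∀ M → Σ ℕ λ p → Prime p × M ℕ.< p
    primeAbove′ M = first (PrimeFactorisation.factors f) (PrimeFactorisation.isFactorisation f) (PrimeFactorisation.factorsPrime f)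
      where
      f = factorise (suc (M !))
      first : ∀ ps → suc (M !) ≡ product ps → All Prime ps → Σ ℕ λ p → Prime p × M ℕ.< p
      first [] e _ = contradiction (ℕ.suc-injective e) (ℕ.≢-nonZero⁻¹ (M !) {{ℕ._!≢0 M}})
      first (p ∷ ps) e (pp ∷ _) = p , pp , ℕ.≰⇒> λ p≤M →
        ℕ.nonTrivial⇒≢1 {{prime⇒nonTrivial pp}} (ℕ∣.∣1⇒≡1 (ℕ∣.∣m+n∣m⇒∣n
          (subst (p ℕ∣.∣_) (trans (sym e) (ℕ.+-comm 1 (M !))) (ℕ∣.m∣m*n (product ps)))
          (ℕ∣.∣-trans (p∣p! {{prime⇒nonZero pp}}) (ℕ∣.m≤n⇒m!∣n! p≤M))))
        where
        p∣p! : ∀ {p} .{{_ : NonZero p}} → p ℕ∣.∣ p !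
        p∣p! {suc p} = ℕ∣.m∣m*n (p !)

  abstract
    primeAbove : ∀ M → Σ ℕ λ p → Prime p × M ℕ.< p
    primeAbove = primeAbove′

  coprime-prime : ∀ {c p} .{{_ : NonZero c}} → Prime p → c ℕ.< p → Coprime c p
  coprime-prime pp c<p = Coprime.sym (Coprime.prime⇒coprime pp c<p)

  primes-coprime : ∀ {p q} → Prime p → Prime q → p ≢ q → Coprime p q
  primes-coprime {p} {q} pp pq p≢q with ℕ.<-cmp p q
  ... | tri< p<q _ _ = coprime-prime {{prime⇒nonZero pp}} pq p<q
  ... | tri≈ _ p≡q _ = contradiction p≡q p≢q
  ... | tri> _ _ q<p = Coprime.sym (coprime-prime {{prime⇒nonZero pq}} pp q<p)

  record PrimeList (M : ℕ) : Set where
    field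
      list   : List ℕ
      primes : All Prime list
      unique : Unique list
      above  : All (M ℕ.<_) list

    modulus : ℕ
    modulus = product list

    modulus≢0 : NonZero modulus
    modulus≢0 = product≢0 (All.map prime⇒nonZero primes)

    coprime-modulus : ∀ {c} .{{_ : NonZero c}} → c ℕ.≤ M → Coprime c modulus
    coprime-modulus {c} c≤M = go list primes above
      where
      go : ∀ ps → All Prime ps → All (M ℕ.<_) ps → Coprime c (product ps)
      go []       _          _          = Coprime.sym (Coprime.1-coprimeTo _)
      go (p ∷ ps) (pp ∷ pps) (M<p ∷ as) = coprime-* (coprime-prime pp (ℕ.≤-<-trans c≤M M<p)) (go ps pps as)

  open PrimeList public using (modulus)

  weaken : ∀ {M M′} → M ℕ.≤ M′ → PrimeList M′ → PrimeList M
  weaken M≤M′ P = record { PrimeList P ; above = All.map (ℕ.≤-<-trans M≤M′) (PrimeList.above P) }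

  infixr 5 _⊹_
  -- The primes of the second list exceed the whole modulus of the first; this makes the lists
  -- disjoint and the two moduli coprime.
  _⊹_ : ∀ {M} (P : PrimeList M) → PrimeList (M ℕ.⊔ modulus P) → PrimeList M
  _⊹_ {M} P Q = record
    { list   = P.list ++ Q.list
    ; primes = All.++⁺ P.primes Q.primes
    ; unique = Unique.++⁺ P.unique Q.unique λ { {v} (v∈P , v∈Q) → ℕ.<-irrefl refl (ℕ.<-≤-trans
        (ℕ.≤-<-trans (ℕ.m≤n⊔m M _) (All.lookup Q.above v∈Q))
        (∈⇒≤product (All.map prime⇒nonZero P.primes) v∈P)) }
    ; above  = All.++⁺ P.above (PrimeList.above (weaken (ℕ.m≤m⊔n M _) Q))
    }
    where module P = PrimeList P
          module Q = PrimeList Q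

  modulus-⊹ : ∀ {M} (P : PrimeList M) (Q : PrimeList (M ℕ.⊔ modulus P)) → modulus (P ⊹ Q) ≡ modulus P ℕ.* modulus Q
  modulus-⊹ P Q = product-++ (PrimeList.list P) (PrimeList.list Q)

  coprime-⊹ : ∀ {M} (P : PrimeList M) (Q : PrimeList (M ℕ.⊔ modulus P)) → Coprime (modulus P) (modulus Q)
  coprime-⊹ {M} P Q = PrimeList.coprime-modulus Q {{PrimeList.modulus≢0 P}} (ℕ.m≤n⊔m M _)

  record PrimeFamily (M k : ℕ) : Set where
    field
      p      : Fin k → ℕ
      prime  : ∀ i → Prime (p i)
      p-inj  : ∀ {i j} → p i ≡ p j → i ≡ j
      above  : ∀ i → M ℕ.< p i

    coprime : PairwiseCoprime p
    coprime i j i≢j = primes-coprime (prime i) (prime j) (i≢j ∘ p-inj)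

    primeList : PrimeList M
    primeList = record
      { list = tabulate p ; primes = All.tabulate⁺ prime ; unique = Unique.tabulate⁺ p-inj ; above = All.tabulate⁺ above }

  private
    primeFamily′ : ∀ M k → Σ (PrimeFamily M k) λ P → ∀ {i j : Fin k} → i Fin.< j → PrimeFamily.p P i ℕ.< PrimeFamily.p P j
    primeFamily′ M zero = record { p = λ () ; prime = λ () ; p-inj = λ { {()} } ; above = λ () } , λ { {()} }
    primeFamily′ M (suc k) = record { p = p ; prime = prime ; p-inj = p-inj ; above = above } , (λ {i} {j} → mono i j)
      where
      q = primeAbove M
      R = primeFamily′ (proj₁ q) k
      module R = PrimeFamily (proj₁ R)
      p : Fin (suc k) → ℕ
      p zero    = proj₁ q
      p (suc i) = R.p i
      prime : ∀ i → Prime (p i)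
      prime zero    = proj₁ (proj₂ q)
      prime (suc i) = R.prime i
      above : ∀ i → M ℕ.< p i
      above zero    = proj₂ (proj₂ q)
      above (suc i) = ℕ.<-trans (proj₂ (proj₂ q)) (R.above i)
      mono : ∀ i j → i Fin.< j → p i ℕ.< p j
      mono zero    (suc j) _         = R.above j
      mono (suc i) (suc j) (s≤s i<j) = proj₂ R i<j
      p-inj : ∀ {i j} → p i ≡ p j → i ≡ j
      p-inj {i} {j} e with Fin.<-cmp i j
      ... | tri< i<j _ _ = contradiction (mono i j i<j) (ℕ.<-irrefl e)
      ... | tri≈ _ i≡j _ = i≡j
      ... | tri> _ _ j<i = contradiction (mono j i j<i) (ℕ.<-irrefl (sym e))

  abstract
    primeFamily : ∀ M k → Σ (PrimeFamily M k) λ P → ∀ {i j : Fin k} → i Fin.< j → PrimeFamily.p P i ℕ.< PrimeFamily.p P j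
    primeFamily = primeFamily′

  -- The codes may depend on the proof of S z, so S need not be decidable.
  record Size (m : ℕ) (S : ℤ → Set) (B : ℕ) : Set where
    field
      code   : ∀ {z} → S z → ℕ
      code<  : ∀ {z} (s : S z) → code s ℕ.< B
      inj    : ∀ {z z′} (s : S z) (s′ : S z′) → code s ≡ code s′ → Cong m z z′

  pair-code : ∀ {B R N N′ ρ ρ′} (N< : N ℕ.< B) (ρ< : ρ ℕ.< R) (N<′ : N′ ℕ.< B) (ρ<′ : ρ′ ℕ.< R) →
    toℕ (combine (fromℕ< N<) (fromℕ< ρ<)) ≡ toℕ (combine (fromℕ< N<′) (fromℕ< ρ<′)) → N ≡ N′ × ρ ≡ ρ′
  pair-code N< ρ< N<′ ρ<′ e = Fin.fromℕ<-injective _ _ N< N<′ (proj₁ both) , Fin.fromℕ<-injective _ _ ρ< ρ<′ (proj₂ both)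
    where both = Fin.combine-injective _ _ _ _ (Fin.toℕ-injective e)

  Size-× : ∀ {m n S T B C} → Coprime m n → Size m S B → Size n T C → Size (m ℕ.* n) (λ z → S z × T z) (B ℕ.* C)
  Size-× cop σ τ = record
    { code  = λ (s , t) → toℕ (combine (fromℕ< (σ.code< s)) (fromℕ< (τ.code< t)))
    ; code< = λ _ → Fin.toℕ<n _
    ; inj   = λ (s , t) (s′ , t′) e → let (e₁ , e₂) = pair-code (σ.code< s) (τ.code< t) (σ.code< s′) (τ.code< t′) e in
              Cong-pair cop (σ.inj s s′ e₁) (τ.inj t t′ e₂)
    }
    where module σ = Size σ
          module τ = Size τ

  Size-⊎ : ∀ {m S T B C} → Size m S B → Size m T C → Size m (λ z → S z ⊎ T z) (B ℕ.+ C)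
  Size-⊎ {m} {S} {T} {B} {C} σ τ = record { code = code ; code< = code< ; inj = inj }
    where
    module σ = Size σ
    module τ = Size τ
    code : ∀ {z} → S z ⊎ T z → ℕ
    code (inj₁ s) = σ.code s
    code (inj₂ t) = B ℕ.+ τ.code t
    code< : ∀ {z} (s : S z ⊎ T z) → code s ℕ.< B ℕ.+ C
    code< (inj₁ s) = ℕ.<-≤-trans (σ.code< s) (ℕ.m≤m+n B C)
    code< (inj₂ t) = ℕ.+-monoʳ-< B (τ.code< t)
    inj : ∀ {z z′} (s : S z ⊎ T z) (s′ : S z′ ⊎ T z′) → code s ≡ code s′ → Cong m z z′
    inj (inj₁ s) (inj₁ s′) e = σ.inj s s′ e
    inj (inj₁ s) (inj₂ t′) e = contradiction (ℕ.<-≤-trans (σ.code< s) (ℕ.m≤m+n B _)) (ℕ.<-irrefl e)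
    inj (inj₂ t) (inj₁ s′) e = contradiction (ℕ.<-≤-trans (σ.code< s′) (ℕ.m≤m+n B _)) (ℕ.<-irrefl (sym e))
    inj (inj₂ t) (inj₂ t′) e = τ.inj t t′ (ℕ.+-cancelˡ-≡ B _ _ e)

  Size-all : ∀ m .{{_ : NonZero m}} {S} → Size m S m
  Size-all m {S} = record { code = λ {z} _ → z %ℕ m ; code< = λ {z} _ → n%ℕd<d z m ; inj = λ _ _ → %-≡⇒Cong m }

  Size-map : ∀ {m S T B} → (∀ {z} → T z → S z) → Size m S B → Size m T B
  Size-map f σ = record { code = Size.code σ ∘ f ; code< = Size.code< σ ∘ f ; inj = λ s t → Size.inj σ (f s) (f t) }

  ∑ : ∀ {k} → (Fin k → ℤ) → ℤ
  ∑ {zero}  f = 0ℤ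
  ∑ {suc k} f = f zero + ∑ (f ∘ suc)

  Cong-∑ : ∀ {m k} {f g : Fin k → ℤ} → (∀ i → Cong m (f i) (g i)) → Cong m (∑ f) (∑ g)
  Cong-∑ {k = zero}  h = Cong-refl
  Cong-∑ {k = suc k} h = Cong-+ (h zero) (Cong-∑ (h ∘ suc))

  ∑-cong : ∀ {k} {f g : Fin k → ℤ} → (∀ i → f i ≡ g i) → ∑ f ≡ ∑ g
  ∑-cong {zero}  h = refl
  ∑-cong {suc k} h = cong₂ _+_ (h zero) (∑-cong (h ∘ suc))

  ∑-0 : ∀ {k} {f : Fin k → ℤ} → (∀ i → f i ≡ 0ℤ) → ∑ f ≡ 0ℤ
  ∑-0 {zero}  h = refl
  ∑-0 {suc k} h = cong₂ _+_ (h zero) (∑-0 (h ∘ suc))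

  infixl 6 _⊕_
  infixl 7 _⊗_
  -- Polynomials in the unknown elements a v ∈ A and in the differences x v; the other element of the pair of v is a v + x v.
  data Form (n : ℕ) : Set where
    el df   : Fin n → Form n
    con     : ℤ → Form n
    _⊕_ _⊗_ : Form n → Form n → Form n
    sm      : ∀ {k} → (Fin k → Form n) → Form n

  ⟦_⟧ : ∀ {n} → Form n → (Fin n → ℤ) → (Fin n → ℤ) → ℤ
  ⟦ el v ⟧  a x = a v
  ⟦ df v ⟧  a x = x v
  ⟦ con c ⟧ a x = c
  ⟦ F ⊕ G ⟧ a x = ⟦ F ⟧ a x + ⟦ G ⟧ a x
  ⟦ F ⊗ G ⟧ a x = ⟦ F ⟧ a x * ⟦ G ⟧ a x
  ⟦ sm F ⟧  a x = ∑ (λ i → ⟦ F i ⟧ a x)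

  Cong-⟦⟧ : ∀ {n m} (F : Form n) {a a′ x x′} → (∀ v → Cong m (a v) (a′ v)) → (∀ v → Cong m (x v) (x′ v)) →
    Cong m (⟦ F ⟧ a x) (⟦ F ⟧ a′ x′)
  Cong-⟦⟧ (el v)  ha hx = ha v
  Cong-⟦⟧ (df v)  ha hx = hx v
  Cong-⟦⟧ (con c) ha hx = Cong-refl
  Cong-⟦⟧ (F ⊕ G) ha hx = Cong-+ (Cong-⟦⟧ F ha hx) (Cong-⟦⟧ G ha hx)
  Cong-⟦⟧ (F ⊗ G) ha hx = Cong-* (Cong-⟦⟧ F ha hx) (Cong-⟦⟧ G ha hx)
  Cong-⟦⟧ (sm F)  ha hx = Cong-∑ (λ i → Cong-⟦⟧ (F i) ha hx)

  -- The type carries the essential restriction: `a v` is computed from `x v` alone, because in the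
  -- end all elements of `A` come from one function of a single difference.
  Strategy : ℕ → Set
  Strategy n = Fin n → ℤ → ℤ

  infix 9 _⟨_⟩
  _⟨_⟩ : ∀ {n} → Strategy n → (Fin n → ℤ) → (Fin n → ℤ)
  (σ ⟨ x ⟩) v = σ v (x v)

  record Cover {n} (F : Form n) (M : ℕ) : Set₁ where
    field
      P     : PrimeList M
      σ     : Strategy n
      Bad   : ℤ → Set
      resp  : ∀ {z z′} → Cong (modulus P) z z′ → Bad z → Bad z′
      B     : ℕ
      size  : Size (modulus P) Bad B
      catch : ∀ x → Bad (⟦ F ⟧ (σ ⟨ x ⟩) x)

  open Cover public using (B)

  ∣_∣ₘ : ∀ {n} {F : Form n} {M} → Cover F M → ℕ
  ∣ C ∣ₘ = modulus (Cover.P C)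

  -- The factor `E` lets a later cover beat the modulus accumulated before it, and `M` keeps its
  -- primes away from those already used.
  Solvable : ∀ {n} → Form n → Set₁
  Solvable F = ∀ M E → Σ (Cover F M) λ C → B C ℕ.* E ℕ.≤ ∣ C ∣ₘ

  -- Separate strategies modulo each prime are glued by the Chinese remainder theorem; the values of F are described
  -- by N < B and ρ < R.
  abstract
    glue : ∀ {n M k} (P : PrimeFamily M k) (σ : Fin k → Strategy n) → Σ (Strategy n) λ τ →
      ∀ (F : Form n) x i → Cong (PrimeFamily.p P i) (⟦ F ⟧ (τ ⟨ x ⟩) x) (⟦ F ⟧ (σ i ⟨ x ⟩) x)
    glue P σ = (λ v x → proj₁ (crt p coprime (λ i → σ i v x)))
      , λ F x i → Cong-⟦⟧ F (λ v → proj₂ (crt p coprime (λ i → σ i v (x v))) i) (λ v → Cong-refl)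
      where open PrimeFamily P

  private
    cover′ : ∀ {n M k} (F : Form n) (P : PrimeFamily M k) (σ : Fin k → Strategy n) (B R : ℕ) (T : Fin k → ℕ → ℕ → ℤ) →
      (∀ x → Σ ℕ λ N → Σ ℕ λ ρ → N ℕ.< B × ρ ℕ.< R × (∀ i → Cong (PrimeFamily.p P i) (⟦ F ⟧ (σ i ⟨ x ⟩) x) (T i N ρ))) →
      Σ (Cover F M) λ C → Cover.B C ≡ B ℕ.* R × ∣ C ∣ₘ ≡ ∏ (PrimeFamily.p P)
    cover′ {n} {M} {k} F P σ B R T h = record
      { P = P.primeList ; σ = proj₁ (glue P σ) ; Bad = Bad
      ; resp  = λ z≡z′ (N , ρ , N< , ρ< , e) → N , ρ , N< , ρ< , λ i → Cong-sym (Cong-∏⇒ P.p z≡z′ i) ∙ e i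
      ; B     = B ℕ.* R
      ; size  = record
        { code  = λ (N , ρ , N< , ρ< , e) → toℕ (combine (fromℕ< N<) (fromℕ< ρ<))
        ; code< = λ _ → Fin.toℕ<n _
        ; inj   = inj
        }
      ; catch = λ x → let (N , ρ , N< , ρ< , e) = h x in
          N , ρ , N< , ρ< , λ i → proj₂ (glue P σ) F x i ∙ e i
      } , refl , refl
      where
      module P = PrimeFamily P
      Bad : ℤ → Set
      Bad z = Σ ℕ λ N → Σ ℕ λ ρ → N ℕ.< B × ρ ℕ.< R × (∀ i → Cong (P.p i) z (T i N ρ))
      inj : ∀ {z z′} (s : Bad z) (s′ : Bad z′) → _ → Cong (∏ P.p) z z′
      inj (N , ρ , N< , ρ< , e) (N′ , ρ′ , N<′ , ρ<′ , e′) eq with pair-code N< ρ< N<′ ρ<′ eq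
      ... | refl , refl = Cong-∏ P.p P.coprime (λ i → e i ∙ Cong-sym (e′ i))

  abstract
    cover : ∀ {n M k} (F : Form n) (P : PrimeFamily M k) (σ : Fin k → Strategy n) (B R : ℕ) (T : Fin k → ℕ → ℕ → ℤ) →
      (∀ x → Σ ℕ λ N → Σ ℕ λ ρ → N ℕ.< B × ρ ℕ.< R × (∀ i → Cong (PrimeFamily.p P i) (⟦ F ⟧ (σ i ⟨ x ⟩) x) (T i N ρ))) →
      Σ (Cover F M) λ C → Cover.B C ≡ B ℕ.* R × ∣ C ∣ₘ ≡ ∏ (PrimeFamily.p P)
    cover = cover′

  Solvable-≗ : ∀ {n} {F G : Form n} → (∀ a x → ⟦ F ⟧ a x ≡ ⟦ G ⟧ a x) → Solvable F → Solvable G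
  Solvable-≗ F≗G s M E = record
    { P = C.P ; σ = C.σ ; Bad = C.Bad ; resp = C.resp ; B = C.B ; size = C.size ; catch = λ x → subst C.Bad (F≗G _ x) (C.catch x) } , proj₂ (s M E)
    where module C = Cover (proj₁ (s M E))

-- Operations on covers

module Transform where

  open Congruence
  open Block
  open import Data.Integer.Base using (-_; _+_; _*_; _-_)

  ⟦⟧-cong : ∀ {n} (F : Form n) {a a′ x x′} → (∀ v → a v ≡ a′ v) → (∀ v → x v ≡ x′ v) → ⟦ F ⟧ a x ≡ ⟦ F ⟧ a′ x′
  ⟦⟧-cong (el v)  ha hx = ha v
  ⟦⟧-cong (df v)  ha hx = hx v
  ⟦⟧-cong (con c) ha hx = refl
  ⟦⟧-cong (F ⊕ G) ha hx = cong₂ _+_ (⟦⟧-cong F ha hx) (⟦⟧-cong G ha hx)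
  ⟦⟧-cong (F ⊗ G) ha hx = cong₂ _*_ (⟦⟧-cong F ha hx) (⟦⟧-cong G ha hx)
  ⟦⟧-cong (sm F)  ha hx = ∑-cong (λ i → ⟦⟧-cong (F i) ha hx)

  ⟦⟧-at : ∀ {n} (F : Form n) (a a′ x : Fin n → ℤ) → (∀ v → a v ≡ a′ v) → ⟦ F ⟧ a x ≡ ⟦ F ⟧ a′ x
  ⟦⟧-at F a a′ x h = ⟦⟧-cong F h (λ _ → refl)

  -- The variables in `K` are spent on making `R` constant and do not occur in `G`, so a cover of
  -- `G` serves for `F` once its bad set is translated by `κ`. As `κ` is built from inverses modulo
  -- the primes at hand, `exact` receives the prime list.
  kill : ∀ {n} {F G R : Form n} (K : Fin n → Bool) →
    (∀ a x → ⟦ F ⟧ a x ≡ ⟦ G ⟧ a x + ⟦ R ⟧ a x) →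
    (∀ {a a′} x → (∀ v → K v ≡ false → a v ≡ a′ v) → ⟦ G ⟧ a x ≡ ⟦ G ⟧ a′ x) →
    ∀ M₀ → ((P : PrimeList M₀) → Σ (Strategy n) λ τ → Σ ℤ λ κ → ∀ a x →
      (∀ v → K v ≡ true → a v ≡ τ v (x v)) → Cong (modulus P) (⟦ R ⟧ a x) κ) →
    Solvable G → Solvable F
  kill {n} {F} {G} {R} K split indep M₀ exact s M E = record
    { P     = weaken (ℕ.m≤m⊔n M M₀) C.P
    ; σ     = σ
    ; Bad   = λ z → C.Bad (z - κ)
    ; resp  = λ z≡z′ → C.resp (Cong-- z≡z′ Cong-refl)
    ; B     = C.B
    ; size  = record
      { code  = Size.code C.size
      ; code< = Size.code< C.size
      ; inj   = λ {z} {z′} b b′ e → ≡⇒Cong (back z κ) ∙ Cong-+ (Size.inj C.size b b′ e) Cong-refl ∙ ≡⇒Cong (sym (back z′ κ))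
      }
    ; catch = λ x → C.resp (good x) (C.catch x)
    } , proj₂ sol
    where
    sol = s (M ℕ.⊔ M₀) E
    module C = Cover (proj₁ sol)
    τκ = exact (weaken (ℕ.m≤n⊔m M M₀) C.P)
    τ = proj₁ τκ
    κ = proj₁ (proj₂ τκ)
    pick : Bool → (ℤ → ℤ) → (ℤ → ℤ) → ℤ → ℤ
    pick true  f g = f
    pick false f g = g
    σ : Strategy n
    σ v = pick (K v) (τ v) (C.σ v)
    pick-true : ∀ v x → K v ≡ true → σ v x ≡ τ v x
    pick-true v x e with true ← K v = refl
    pick-false : ∀ v x → K v ≡ false → C.σ v x ≡ σ v x
    pick-false v x e with false ← K v = refl
    back : ∀ z k → z ≡ z - k + k
    back = solve-∀
    good : ∀ x → Cong (modulus C.P) (⟦ G ⟧ (C.σ ⟨ x ⟩) x) (⟦ F ⟧ (σ ⟨ x ⟩) x - κ)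
    good x = ≡⇒Cong (trans (indep x (λ v → pick-false v (x v))) (lem _ κ))
      ∙ Cong-- (Cong-+ˡ (⟦ G ⟧ (σ ⟨ x ⟩) x) (Cong-sym (proj₂ (proj₂ τκ) (σ ⟨ x ⟩) x (λ v → pick-true v (x v))))) (Cong-refl {a = κ})
      ∙ ≡⇒Cong (cong (_- κ) (sym (split _ x)))
      where lem : ∀ g k → g ≡ g + k - k
            lem = solve-∀

  -- Interchanging the two elements of a pair replaces a by a + x and x by - x.
  flip-el : Bool → ℤ → ℤ → ℤ
  flip-el b a x = if b then a + x else a

  flip-df : Bool → ℤ → ℤ
  flip-df b x = if b then - x else x

  private
    module Lift {k n} (ι : Fin k → Fin n) (ι-inj : ∀ {i j} → ι i ≡ ι j → i ≡ j) (φ : Fin k → Bool) (τ : Strategy k) where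
      play : Bool → (ℤ → ℤ) → ℤ → ℤ
      -- After a flip the first element of the pair is a + x and the difference is - x, so it is a +
      -- x that has to equal f (- x).
      play b f x = if b then f (- x) - x else f x
      choose : ∀ {v} → Dec (Σ (Fin k) λ i → ι i ≡ v) → ℤ → ℤ
      choose (yes (i , _)) = play (φ i) (τ i)
      choose (no _)        = λ _ → 0ℤ
      σ : Strategy n
      σ v = choose (Fin.any? (λ i → ι i Fin.≟ v))
      play-flip : ∀ b f x → flip-el b (play b f x) x ≡ f (flip-df b x)
      play-flip true  f x = lem (f (- x)) x
        where lem : ∀ y x → y - x + x ≡ y
              lem = solve-∀
      play-flip false f x = refl
      at : ∀ i x → flip-el (φ i) (σ (ι i) x) x ≡ τ i (flip-df (φ i) x)
      at i x with Fin.any? (λ j → ι j Fin.≟ ι i)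
      ... | no ¬e = contradiction (i , refl) ¬e
      ... | yes (j , e) with refl ← ι-inj e = play-flip (φ j) (τ j) x

  lift-strategy : ∀ {k n} (ι : Fin k → Fin n) → (∀ {i j} → ι i ≡ ι j → i ≡ j) → (φ : Fin k → Bool) → (τ : Strategy k) →
    Σ (Strategy n) λ σ → ∀ i x → flip-el (φ i) (σ (ι i) x) x ≡ τ i (flip-df (φ i) x)
  lift-strategy ι ι-inj φ τ = σ , at
    where open Lift ι ι-inj φ τ

  embed : ∀ {k n} {F : Form k} {G : Form n} (ι : Fin k → Fin n) → (∀ {i j} → ι i ≡ ι j → i ≡ j) → (φ : Fin k → Bool) →
    (∀ a x → ⟦ G ⟧ a x ≡ ⟦ F ⟧ (λ i → flip-el (φ i) (a (ι i)) (x (ι i))) (λ i → flip-df (φ i) (x (ι i)))) →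
    Solvable F → Solvable G
  embed {F = F} {G} ι ι-inj φ same s M E = record
    { P = C.P ; σ = proj₁ lifted ; Bad = C.Bad ; resp = C.resp ; B = C.B ; size = C.size
    ; catch = λ x → subst C.Bad (trans (⟦⟧-cong F (λ i → sym (proj₂ lifted i (x (ι i)))) (λ i → refl)) (sym (same (proj₁ lifted ⟨ x ⟩) x)))
                          (C.catch (λ i → flip-df (φ i) (x (ι i))))
    } , proj₂ sol
    where
    sol = s M E
    module C = Cover (proj₁ sol)
    lifted = lift-strategy ι ι-inj φ C.σ

  private
    both : ∀ {n} {F : Form n} {M} (C : Cover F M) (D : Cover F (M ℕ.⊔ ∣ C ∣ₘ)) →
      Σ (Cover F M) λ C′ → Cover.B C′ ≡ Cover.B C ℕ.* Cover.B D × ∣ C′ ∣ₘ ≡ ∣ C ∣ₘ ℕ.* ∣ D ∣ₘ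
    both {n} {F} {M} C D = record
      { P = C.P ⊹ D.P ; σ = σ ; Bad = λ z → C.Bad z × D.Bad z
      ; resp  = λ z≡z′ (b , b′) → C.resp (Cong-divˡ (to z≡z′)) b , D.resp (Cong-divʳ {∣ C ∣ₘ} (to z≡z′)) b′
      ; B     = C.B ℕ.* D.B
      ; size  = subst (λ m → Size m (λ z → C.Bad z × D.Bad z) (C.B ℕ.* D.B)) (sym m≡) (Size-× cop C.size D.size)
      ; catch = λ x → C.resp (Cong-⟦⟧ F (λ v → Cong-sym (proj₁ (proj₂ (joint v (x v))))) (λ v → Cong-refl)) (C.catch x)
                    , D.resp (Cong-⟦⟧ F (λ v → Cong-sym (proj₂ (proj₂ (joint v (x v))))) (λ v → Cong-refl)) (D.catch x)
      } , refl , m≡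
      where
      module C = Cover C
      module D = Cover D
      m≡ = modulus-⊹ C.P D.P
      cop = coprime-⊹ C.P D.P
      to : ∀ {a b} → Cong (modulus (C.P ⊹ D.P)) a b → Cong (∣ C ∣ₘ ℕ.* ∣ D ∣ₘ) a b
      to = subst (λ m → Cong m _ _) m≡
      joint = λ v x → crt₂ cop (C.σ v x) (D.σ v x)
      σ : Strategy n
      σ v x = proj₁ (joint v x)

    trivial : ∀ {n} (F : Form n) M → Cover F M
    trivial F M = record
      { P = record { list = [] ; primes = [] ; unique = [] ; above = [] }
      ; σ = λ _ _ → 0ℤ ; Bad = λ _ → ⊤ ; resp = λ _ _ → _ ; B = 1 ; size = Size-all 1 ; catch = λ _ → _ }

    -- Bernoulli's inequality (1 + 1/D)^t ≥ 1 + t/D with denominators cleared.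
    bernoulli : ∀ D t → D ℕ.^ t ℕ.* (D ℕ.+ t) ℕ.≤ suc D ℕ.^ t ℕ.* D
    bernoulli D zero    = ℕ.≤-reflexive (cong (1 ℕ.*_) (ℕ.+-identityʳ D))
    bernoulli D (suc t) = begin
      D ℕ.* D ℕ.^ t ℕ.* (D ℕ.+ suc t)                   ≡⟨ lem₁ D (D ℕ.^ t) t ⟩
      D ℕ.^ t ℕ.* (D ℕ.* (D ℕ.+ t) ℕ.+ D)               ≤⟨ ℕ.*-monoʳ-≤ (D ℕ.^ t) (ℕ.+-monoʳ-≤ (D ℕ.* (D ℕ.+ t)) (ℕ.m≤m+n D t)) ⟩
      D ℕ.^ t ℕ.* (D ℕ.* (D ℕ.+ t) ℕ.+ (D ℕ.+ t))       ≡⟨ lem₂ D (D ℕ.^ t) t ⟩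
      suc D ℕ.* (D ℕ.^ t ℕ.* (D ℕ.+ t))                 ≤⟨ ℕ.*-monoʳ-≤ (suc D) (bernoulli D t) ⟩
      suc D ℕ.* (suc D ℕ.^ t ℕ.* D)                     ≡⟨ sym (ℕ.*-assoc (suc D) (suc D ℕ.^ t) D) ⟩
      suc D ℕ.* suc D ℕ.^ t ℕ.* D                       ∎
      where
      open ℕ.≤-Reasoning
      lem₁ : ∀ D p t → D ℕ.* p ℕ.* (D ℕ.+ (1 ℕ.+ t)) ≡ p ℕ.* (D ℕ.* (D ℕ.+ t) ℕ.+ D)
      lem₁ = ℕ-solve-∀
      lem₂ : ∀ D p t → p ℕ.* (D ℕ.* (D ℕ.+ t) ℕ.+ (D ℕ.+ t)) ≡ (1 ℕ.+ D) ℕ.* (p ℕ.* (D ℕ.+ t))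
      lem₂ = ℕ-solve-∀

  -- It is enough to miss a fixed proportion 1 / (D + 1) of the residues: densities multiply over coprime moduli.
  amplify : ∀ {n} {F : Form n} D .{{_ : NonZero D}} →
    (∀ M → Σ (Cover F M) λ C → B C ℕ.* suc D ℕ.≤ D ℕ.* ∣ C ∣ₘ) → Solvable F
  amplify {F = F} D half M E = proj₁ (iter t) , ℕ.*-cancelʳ-≤ _ _ (suc D ℕ.^ t) {{ℕ.m^n≢0 (suc D) t}} (begin
    b ℕ.* E ℕ.* suc D ℕ.^ t     ≡⟨ lem b E (suc D ℕ.^ t) ⟩
    b ℕ.* suc D ℕ.^ t ℕ.* E     ≤⟨ ℕ.*-monoˡ-≤ E (proj₂ (iter t)) ⟩
    D ℕ.^ t ℕ.* r ℕ.* E         ≡⟨ lem′ (D ℕ.^ t) r E ⟩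
    r ℕ.* (D ℕ.^ t ℕ.* E)       ≤⟨ ℕ.*-monoʳ-≤ r enough ⟩
    r ℕ.* suc D ℕ.^ t           ∎)
    where
    open ℕ.≤-Reasoning
    -- For this exponent Bernoulli's inequality gives (1 + 1/D)^t ≥ 1 + E.
    t = D ℕ.* E
    iter : ∀ t → Σ (Cover F M) λ C → B C ℕ.* suc D ℕ.^ t ℕ.≤ D ℕ.^ t ℕ.* ∣ C ∣ₘ
    iter zero    = trivial F M , ℕ.≤-refl
    iter (suc t) = let (C , hC) = iter t
                       (C₁ , h₁) = half (M ℕ.⊔ ∣ C ∣ₘ)
                       (C₂ , b≡ , m≡) = both C C₁ in C₂ , (begin
      B C₂ ℕ.* (suc D ℕ.* suc D ℕ.^ t)                       ≡⟨ cong (ℕ._* (suc D ℕ.* suc D ℕ.^ t)) b≡ ⟩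
      B C ℕ.* B C₁ ℕ.* (suc D ℕ.* suc D ℕ.^ t)               ≡⟨ lem₁ (B C) (B C₁) (suc D) (suc D ℕ.^ t) ⟩
      (B C ℕ.* suc D ℕ.^ t) ℕ.* (B C₁ ℕ.* suc D)             ≤⟨ ℕ.*-mono-≤ hC h₁ ⟩
      (D ℕ.^ t ℕ.* ∣ C ∣ₘ) ℕ.* (D ℕ.* ∣ C₁ ∣ₘ)               ≡⟨ lem₂ (D ℕ.^ t) ∣ C ∣ₘ D ∣ C₁ ∣ₘ ⟩
      D ℕ.* D ℕ.^ t ℕ.* (∣ C ∣ₘ ℕ.* ∣ C₁ ∣ₘ)                 ≡⟨ cong (D ℕ.* D ℕ.^ t ℕ.*_) (sym m≡) ⟩
      D ℕ.* D ℕ.^ t ℕ.* ∣ C₂ ∣ₘ                              ∎)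
      where
      lem₁ : ∀ a b c d → a ℕ.* b ℕ.* (c ℕ.* d) ≡ (a ℕ.* d) ℕ.* (b ℕ.* c)
      lem₁ = ℕ-solve-∀
      lem₂ : ∀ a b c d → (a ℕ.* b) ℕ.* (c ℕ.* d) ≡ c ℕ.* a ℕ.* (b ℕ.* d)
      lem₂ = ℕ-solve-∀
    b = B (proj₁ (iter t))
    r = ∣ proj₁ (iter t) ∣ₘ
    lem : ∀ a b c → a ℕ.* b ℕ.* c ≡ a ℕ.* c ℕ.* b
    lem = ℕ-solve-∀
    lem′ : ∀ a b c → a ℕ.* b ℕ.* c ≡ b ℕ.* (a ℕ.* c)
    lem′ = ℕ-solve-∀
    enough : D ℕ.^ t ℕ.* E ℕ.≤ suc D ℕ.^ t
    enough = ℕ.*-cancelʳ-≤ _ _ D (begin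
      D ℕ.^ t ℕ.* E ℕ.* D           ≡⟨ lem₃ (D ℕ.^ t) E D ⟩
      D ℕ.^ t ℕ.* (D ℕ.* E)         ≤⟨ ℕ.*-monoʳ-≤ (D ℕ.^ t) (ℕ.m≤n+m (D ℕ.* E) D) ⟩
      D ℕ.^ t ℕ.* (D ℕ.+ D ℕ.* E)   ≤⟨ bernoulli D t ⟩
      suc D ℕ.^ t ℕ.* D             ∎)
      where
      lem₃ : ∀ a b c → a ℕ.* b ℕ.* c ≡ a ℕ.* (c ℕ.* b)
      lem₃ = ℕ-solve-∀

-- A triangle in which exactly one vertex has both edges at the same element

module Triangle where

  open Congruence
  open Block
  open Transform
  open import Data.Integer.Base using (-_; _+_; _*_; _-_)

  linear : ∀ {n} → (Fin n → ℤ) → (Fin n → ℤ) → Fin n → Form n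
  linear c d v = con (c v) ⊗ el v ⊕ con (d v) ⊗ df v

  -- Vertex 0 cannot be freed by fixing ends: its two edges fix the first elements at 1 and 2, while
  -- the third edge would need one of the second elements there to be fixed.
  triangle : (Fin 3 → ℤ) → (Fin 3 → ℤ) → Form 3
  triangle c d = el 0F ⊗ el 1F ⊕ el 0F ⊗ el 2F ⊕ (el 1F ⊕ df 1F) ⊗ (el 2F ⊕ df 2F) ⊕ (linear c d 0F ⊕ linear c d 1F ⊕ linear c d 2F)

  private
    -- The number `N` collected below is bounded by (p₀ p₁)² + p₀ p₂ + p₁ p₂. The three inequalities
    -- make each summand, multiplied by 3 E, at most p₀ p₁ p₂.
    three-primes′ : ∀ M E → Σ (PrimeFamily M 3) λ P → let open PrimeFamily P in
      3 ℕ.* E ℕ.≤ p 0F × 3 ℕ.* E ℕ.≤ p 1F × 3 ℕ.* E ℕ.* (p 0F ℕ.* p 1F) ℕ.≤ p 2F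
    three-primes′ M E = record { p = p ; prime = prime ; p-inj = p-inj ; above = above }
      , ℕ.<⇒≤ E<0 , ℕ.<⇒≤ (ℕ.<-trans E<0 0<1) , ℕ.≤-trans (ℕ.m≤n⊔m (proj₁ q₁) _) (ℕ.<⇒≤ (proj₂ (proj₂ q₂)))
      where
      q₀ = primeAbove (M ℕ.⊔ 3 ℕ.* E)
      q₁ = primeAbove (proj₁ q₀)
      q₂ = primeAbove (proj₁ q₁ ℕ.⊔ 3 ℕ.* E ℕ.* (proj₁ q₀ ℕ.* proj₁ q₁))
      E<0 = ℕ.≤-<-trans (ℕ.m≤n⊔m M (3 ℕ.* E)) (proj₂ (proj₂ q₀))
      M<0 = ℕ.≤-<-trans (ℕ.m≤m⊔n M (3 ℕ.* E)) (proj₂ (proj₂ q₀))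
      0<1 = proj₂ (proj₂ q₁)
      1<2 = ℕ.≤-<-trans (ℕ.m≤m⊔n (proj₁ q₁) _) (proj₂ (proj₂ q₂))
      p : Fin 3 → ℕ
      p 0F = proj₁ q₀
      p 1F = proj₁ q₁
      p 2F = proj₁ q₂
      prime : ∀ i → Prime (p i)
      prime 0F = proj₁ (proj₂ q₀)
      prime 1F = proj₁ (proj₂ q₁)
      prime 2F = proj₁ (proj₂ q₂)
      above : ∀ i → M ℕ.< p i
      above 0F = M<0
      above 1F = ℕ.<-trans M<0 0<1
      above 2F = ℕ.<-trans (ℕ.<-trans M<0 0<1) 1<2
      p-inj : ∀ {i j} → p i ≡ p j → i ≡ j
      p-inj {0F} {0F} e = refl
      p-inj {0F} {1F} e = contradiction 0<1 (ℕ.<-irrefl e)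
      p-inj {0F} {2F} e = contradiction (ℕ.<-trans 0<1 1<2) (ℕ.<-irrefl e)
      p-inj {1F} {0F} e = contradiction 0<1 (ℕ.<-irrefl (sym e))
      p-inj {1F} {1F} e = refl
      p-inj {1F} {2F} e = contradiction 1<2 (ℕ.<-irrefl e)
      p-inj {2F} {0F} e = contradiction (ℕ.<-trans 0<1 1<2) (ℕ.<-irrefl (sym e))
      p-inj {2F} {1F} e = contradiction 1<2 (ℕ.<-irrefl (sym e))
      p-inj {2F} {2F} e = refl

  abstract
    three-primes : ∀ M E → Σ (PrimeFamily M 3) λ P → let open PrimeFamily P in
      3 ℕ.* E ℕ.≤ p 0F × 3 ℕ.* E ℕ.≤ p 1F × 3 ℕ.* E ℕ.* (p 0F ℕ.* p 1F) ℕ.≤ p 2F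
    three-primes = three-primes′

  triple : ℤ → ℤ → ℤ → Fin 3 → ℤ
  triple y₀ y₁ y₂ 0F = y₀
  triple y₀ y₁ y₂ 1F = y₁
  triple y₀ y₁ y₂ 2F = y₂

  private
    -- The choices a₁ = 1 - c₀ and a₂ = 0 give a₀ the coefficient 1, so vertex 0 is free. Up to a
    -- constant the rest is the product (x₁ + 1 - c₀ + d₂) (x₂ + d₁), which is not a sum of
    -- contributions of single vertices.
    small-prime : ∀ {m} c d (a x : Fin 3 → ℤ) {n u v w s k} →
      a 0F ≡ n - d 0F * x 0F → a 1F ≡ 1ℤ - c 0F → a 2F ≡ 0ℤ →
      Cong m (x 1F + 1ℤ - c 0F + d 2F) u → Cong m (x 2F + d 1F) v → Cong m 0ℤ w → u * v + w + n ≡ s →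
      c 1F * (1ℤ - c 0F) - d 1F * (1ℤ - c 0F + d 2F) ≡ k →
      Cong m (⟦ triangle c d ⟧ a x) (s + k)
    small-prime c d a x {n} e₀ e₁ e₂ hu hv hw refl refl =
      ≡⇒Cong (trans (⟦⟧-at (triangle c d) a (triple (n - d 0F * x 0F) (1ℤ - c 0F) 0ℤ) x (λ { 0F → e₀ ; 1F → e₁ ; 2F → e₂ }))
        (lem n (x 0F) (x 1F) (x 2F) (c 0F) (c 1F) (c 2F) (d 0F) (d 1F) (d 2F)))
      ∙ Cong-+ (Cong-+ (Cong-+ (Cong-* hu hv) hw) (Cong-refl {a = n})) (Cong-refl {a = c 1F * (1ℤ - c 0F) - d 1F * (1ℤ - c 0F + d 2F)})
      where
      lem : ∀ n x₀ x₁ x₂ c₀ c₁ c₂ d₀ d₁ d₂ →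
        (n - d₀ * x₀) * (1ℤ - c₀) + (n - d₀ * x₀) * 0ℤ + (1ℤ - c₀ + x₁) * (0ℤ + x₂)
          + (c₀ * (n - d₀ * x₀) + d₀ * x₀ + (c₁ * (1ℤ - c₀) + d₁ * x₁) + (c₂ * 0ℤ + d₂ * x₂))
        ≡ (x₁ + 1ℤ - c₀ + d₂) * (x₂ + d₁) + 0ℤ + n + (c₁ * (1ℤ - c₀) - d₁ * (1ℤ - c₀ + d₂))
      lem = solve-∀

    -- In the coordinates u = a₁ + x₁ + a₀ + c₂ and v = a₂ + x₂ + a₀ + c₁ the form is u v plus terms
    -- linear in the differences, and the constant k = a₀ is at disposal for cancelling x₁ or x₂
    -- among them.
    other-prime : ∀ {m} c d (a x : Fin 3 → ℤ) {k u v t n s K} →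
      a 0F ≡ k → a 1F ≡ u - k - c 2F - x 1F → a 2F ≡ v - k - c 1F - x 2F →
      Cong m (u * v + (- (k + c 1F - d 1F) * x 1F + - (k + c 2F - d 2F) * x 2F)) t → Cong m (d 0F * x 0F) n → t + n ≡ s →
      k * c 0F - (k + c 2F) * (k + c 1F) ≡ K →
      Cong m (⟦ triangle c d ⟧ a x) (s + K)
    other-prime c d a x {k} {u} {v} e₀ e₁ e₂ ht hn refl refl =
      ≡⇒Cong (trans (⟦⟧-at (triangle c d) a (triple k (u - k - c 2F - x 1F) (v - k - c 1F - x 2F)) x (λ { 0F → e₀ ; 1F → e₁ ; 2F → e₂ }))
        (lem k u v (x 0F) (x 1F) (x 2F) (c 0F) (c 1F) (c 2F) (d 0F) (d 1F) (d 2F)))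
      ∙ Cong-+ (Cong-+ ht hn) (Cong-refl {a = k * c 0F - (k + c 2F) * (k + c 1F)})
      where
      lem : ∀ k u v x₀ x₁ x₂ c₀ c₁ c₂ d₀ d₁ d₂ →
        k * (u - k - c₂ - x₁) + k * (v - k - c₁ - x₂) + (u - k - c₂ - x₁ + x₁) * (v - k - c₁ - x₂ + x₂)
          + (c₀ * k + d₀ * x₀ + (c₁ * (u - k - c₂ - x₁) + d₁ * x₁) + (c₂ * (v - k - c₁ - x₂) + d₂ * x₂))
        ≡ u * v + (- (k + c₁ - d₁) * x₁ + - (k + c₂ - d₂) * x₂) + d₀ * x₀ + (k * c₀ - (k + c₂) * (k + c₁))
      lem = solve-∀

    ones : ∀ {k c₁ c₂ d₁ d₂ μ} w x₁ x₂ → k ≡ d₂ - c₂ → μ ≡ - (k + c₁ - d₁) →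
      1ℤ * w + (- (k + c₁ - d₁) * x₁ + - (k + c₂ - d₂) * x₂) ≡ μ * x₁ * 1ℤ + w
    ones {c₁ = c₁} {c₂} {d₁} {d₂} w x₁ x₂ refl refl = lem c₁ c₂ d₁ d₂ w x₁ x₂
      where
      lem : ∀ c₁ c₂ d₁ d₂ w x₁ x₂ → 1ℤ * w + (- (d₂ - c₂ + c₁ - d₁) * x₁ + - (d₂ - c₂ + c₂ - d₂) * x₂) ≡ - (d₂ - c₂ + c₁ - d₁) * x₁ * 1ℤ + w
      lem = solve-∀

    gone : ∀ {k c₁ c₂ d₁ d₂ μ} u v x₁ x₂ → k ≡ d₁ - c₁ → μ ≡ - (k + c₂ - d₂) →
      u * v + (- (k + c₁ - d₁) * x₁ + - (k + c₂ - d₂) * x₂) ≡ u * v + μ * x₂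
    gone {c₁ = c₁} {c₂} {d₁} {d₂} u v x₁ x₂ refl refl = lem c₁ d₁ (- (d₁ - c₁ + c₂ - d₂) * x₂) u v x₁
      where
      lem : ∀ c₁ d₁ y u v x₁ → u * v + (- (d₁ - c₁ + c₁ - d₁) * x₁ + y) ≡ u * v + y
      lem = solve-∀

  -- The wild product X Y modulo the small prime p₀ is copied as an integer to the other two primes; this costs nothing
  -- because p₂ is much larger than (p₀ p₁)². Modulo p₂ (resp. p₁) the choice of a₀ makes x₁ (resp. x₂) disappear.
  triangle-solvable : ∀ c d → Solvable (triangle c d)
  triangle-solvable c d M E = proj₁ C , (begin
    B (proj₁ C) ℕ.* E                                        ≡⟨ cong (ℕ._* E) (proj₁ (proj₂ C)) ⟩
    bound ℕ.* 1 ℕ.* E                                        ≤⟨ small ⟩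
    p 0F ℕ.* (p 1F ℕ.* (p 2F ℕ.* 1))                         ≡⟨ sym (proj₂ (proj₂ C)) ⟩
    ∣ proj₁ C ∣ₘ                                             ∎)
    where
    open ℕ.≤-Reasoning
    primes = three-primes M E
    open PrimeFamily (proj₁ primes)
    q = p 0F ℕ.* p 1F
    r = p 0F ℕ.* p 2F
    t = p 1F ℕ.* p 2F
    κ  = d 1F - c 1F
    κ′ = d 2F - c 2F
    instance
      p₀≢0 : NonZero (p 0F)
      p₀≢0 = prime⇒nonZero (prime 0F)
      p₁≢0 : NonZero (p 1F)
      p₁≢0 = prime⇒nonZero (prime 1F)
      p₂≢0 : NonZero (p 2F)
      p₂≢0 = prime⇒nonZero (prime 2F)
      t≢0 : NonZero t
      t≢0 = ℕ.m*n≢0 _ _ {{prime⇒nonZero (prime 1F)}} {{prime⇒nonZero (prime 2F)}}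
    X Y : ℤ → ℤ
    X x₁ = x₁ + 1ℤ - c 0F + d 2F
    Y x₂ = x₂ + d 1F
    μ μ′ : ℤ
    μ  = - (κ + c 2F - d 2F)
    μ′ = - (κ′ + c 1F - d 1F)
    -- `U V` is prescribed to be X Y modulo p₀ and μ′ x₁ modulo p₁, and `W` to be 0 modulo p₀ and μ
    -- x₂ modulo p₂. At the remaining prime, p₂ for `U` and `V` and p₁ for `W`, the free vertices
    -- reproduce these integers; likewise vertex 0 reproduces `N₀` modulo p₀.
    Us = λ x₁ → residue₂ (coprime 0F 1F λ ()) (X x₁) (μ′ * x₁)
    Vs = λ x₂ → residue₂ (coprime 0F 1F λ ()) (Y x₂) 1ℤ
    Ws = λ x₂ → residue₂ (coprime 0F 2F λ ()) 0ℤ (μ * x₂)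
    Ns = λ x₀ → residue t (d 0F * x₀)
    U V W N₀ : ℤ → ℕ
    U x₁ = proj₁ (Us x₁)
    V x₂ = proj₁ (Vs x₂)
    W x₂ = proj₁ (Ws x₂)
    N₀ x₀ = proj₁ (Ns x₀)
    U₀ : ∀ x₁ → Cong (p 0F) (X x₁) (+ U x₁)
    U₀ x₁ = Cong-sym (proj₁ (proj₂ (proj₂ (Us x₁))))
    U₁ : ∀ x₁ → Cong (p 1F) (μ′ * x₁) (+ U x₁)
    U₁ x₁ = Cong-sym (proj₂ (proj₂ (proj₂ (Us x₁))))
    V₀ : ∀ x₂ → Cong (p 0F) (Y x₂) (+ V x₂)
    V₀ x₂ = Cong-sym (proj₁ (proj₂ (proj₂ (Vs x₂))))
    V₁ : ∀ x₂ → Cong (p 1F) 1ℤ (+ V x₂)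
    V₁ x₂ = Cong-sym (proj₂ (proj₂ (proj₂ (Vs x₂))))
    W₀ : ∀ x₂ → Cong (p 0F) 0ℤ (+ W x₂)
    W₀ x₂ = Cong-sym (proj₁ (proj₂ (proj₂ (Ws x₂))))
    W₂ : ∀ x₂ → Cong (p 2F) (μ * x₂) (+ W x₂)
    W₂ x₂ = Cong-sym (proj₂ (proj₂ (proj₂ (Ws x₂))))
    N₀₁ : ∀ x₀ → Cong (p 1F) (d 0F * x₀) (+ N₀ x₀)
    N₀₁ x₀ = Cong-divˡ (proj₂ (proj₂ (Ns x₀)))
    N₀₂ : ∀ x₀ → Cong (p 2F) (d 0F * x₀) (+ N₀ x₀)
    N₀₂ x₀ = Cong-divʳ {p 1F} (proj₂ (proj₂ (Ns x₀)))
    σ : Fin 3 → Strategy 3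
    σ 0F 0F x = + N₀ x - d 0F * x
    σ 0F 1F x = 1ℤ - c 0F
    σ 0F 2F x = 0ℤ
    σ 1F 0F x = κ′
    σ 1F 1F x = 1ℤ - κ′ - c 2F - x
    σ 1F 2F x = + W x - κ′ - c 1F - x
    σ 2F 0F x = κ
    σ 2F 1F x = + U x - κ - c 2F - x
    σ 2F 2F x = + V x - κ - c 1F - x
    K : Fin 3 → ℤ
    K 0F = c 1F * (1ℤ - c 0F) - d 1F * (1ℤ - c 0F + d 2F)
    K 1F = κ′ * c 0F - (κ′ + c 2F) * (κ′ + c 1F)
    K 2F = κ * c 0F - (κ + c 2F) * (κ + c 1F)
    bound = q ℕ.* q ℕ.+ r ℕ.+ t
    N : (Fin 3 → ℤ) → ℕ
    N x = U (x 1F) ℕ.* V (x 2F) ℕ.+ W (x 2F) ℕ.+ N₀ (x 0F)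
    +N : ∀ x → + U (x 1F) * + V (x 2F) + + W (x 2F) + + N₀ (x 0F) ≡ + N x
    +N x = cong (λ z → z + + W (x 2F) + + N₀ (x 0F)) (sym (ℤ.pos-* (U (x 1F)) (V (x 2F))))
    values : ∀ x i → Cong (p i) (⟦ triangle c d ⟧ (σ i ⟨ x ⟩) x) (+ N x + K i)
    values x 0F = small-prime c d (σ 0F ⟨ x ⟩) x {n = + N₀ (x 0F)} refl refl refl (U₀ (x 1F)) (V₀ (x 2F)) (W₀ (x 2F)) (+N x) refl
    values x 1F = other-prime c d (σ 1F ⟨ x ⟩) x {k = κ′} {1ℤ} {+ W (x 2F)} refl refl refl
      (Cong-trans (≡⇒Cong (ones {κ′} {c 1F} {c 2F} {d 1F} {d 2F} {μ′} (+ W (x 2F)) (x 1F) (x 2F) refl refl)) (Cong-+ (Cong-* (U₁ (x 1F)) (V₁ (x 2F))) (Cong-refl {a = + W (x 2F)})))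
      (N₀₁ (x 0F)) (+N x) refl
    values x 2F = other-prime c d (σ 2F ⟨ x ⟩) x {k = κ} {+ U (x 1F)} {+ V (x 2F)} refl refl refl
      (Cong-trans (≡⇒Cong (gone {κ} {c 1F} {c 2F} {d 1F} {d 2F} {μ} (+ U (x 1F)) (+ V (x 2F)) (x 1F) (x 2F) refl refl)) (Cong-+ (Cong-refl {a = + U (x 1F) * + V (x 2F)}) (W₂ (x 2F))))
      (N₀₂ (x 0F)) (+N x) refl
    N<bound : ∀ x → N x ℕ.< bound
    N<bound x = ℕ.+-mono-≤-< (ℕ.+-mono-≤
      (ℕ.*-mono-≤ (ℕ.<⇒≤ (proj₁ (proj₂ (Us (x 1F))))) (ℕ.<⇒≤ (proj₁ (proj₂ (Vs (x 2F))))))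
      (ℕ.<⇒≤ (proj₁ (proj₂ (Ws (x 2F)))))) (proj₁ (proj₂ (Ns (x 0F))))
    C = cover (triangle c d) (proj₁ primes) σ bound 1 (λ i n _ → + n + K i) λ x → N x , 0 , N<bound x , ℕ.≤-refl , values x
    small : bound ℕ.* 1 ℕ.* E ℕ.≤ p 0F ℕ.* (p 1F ℕ.* (p 2F ℕ.* 1))
    small = ℕ.*-cancelʳ-≤ _ _ 3 (begin
      bound ℕ.* 1 ℕ.* E ℕ.* 3                        ≡⟨ lem (p 0F) (p 1F) (p 2F) E ⟩
      q ℕ.* (3 ℕ.* E ℕ.* q) ℕ.+ r ℕ.* (3 ℕ.* E) ℕ.+ t ℕ.* (3 ℕ.* E)
        ≤⟨ ℕ.+-mono-≤ (ℕ.+-mono-≤ (ℕ.*-monoʳ-≤ q (proj₂ (proj₂ (proj₂ primes)))) (ℕ.*-monoʳ-≤ r (proj₁ (proj₂ (proj₂ primes))))) (ℕ.*-monoʳ-≤ t (proj₁ (proj₂ primes))) ⟩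
      q ℕ.* p 2F ℕ.+ r ℕ.* p 1F ℕ.+ t ℕ.* p 0F        ≡⟨ lem′ (p 0F) (p 1F) (p 2F) ⟩
      p 0F ℕ.* (p 1F ℕ.* (p 2F ℕ.* 1)) ℕ.* 3          ∎)
      where
      lem : ∀ x y z e → (x ℕ.* y ℕ.* (x ℕ.* y) ℕ.+ x ℕ.* z ℕ.+ y ℕ.* z) ℕ.* 1 ℕ.* e ℕ.* 3 ≡
        x ℕ.* y ℕ.* (3 ℕ.* e ℕ.* (x ℕ.* y)) ℕ.+ x ℕ.* z ℕ.* (3 ℕ.* e) ℕ.+ y ℕ.* z ℕ.* (3 ℕ.* e)
      lem = ℕ-solve-∀
      lem′ : ∀ x y z → x ℕ.* y ℕ.* z ℕ.+ x ℕ.* z ℕ.* y ℕ.+ y ℕ.* z ℕ.* x ≡ x ℕ.* (y ℕ.* (z ℕ.* 1)) ℕ.* 3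
      lem′ = ℕ-solve-∀

-- An edge between two looped vertices

module LoopedEdge where

  open Congruence
  open Block
  open Transform
  open Triangle using (linear)
  open import Data.Integer.Base using (-_; _+_; _*_; _-_)

  private
    ⌈√⌉ : ∀ n → Σ ℕ λ s → n ℕ.≤ s ℕ.* s × (∀ {r} → s ≡ suc r → r ℕ.* r ℕ.< n)
    ⌈√⌉ zero    = 0 , z≤n , λ ()
    ⌈√⌉ (suc n) with ⌈√⌉ n
    ... | s , n≤s² , below with suc n ℕ.≤? s ℕ.* s
    ...   | yes n<s² = s , n<s² , λ e → ℕ.m<n⇒m<1+n (below e)
    ...   | no  n≮s² = suc s , ℕ.≤-trans (s≤s n≤s²) (s≤s (ℕ.≤-trans (ℕ.*-monoʳ-≤ s (ℕ.n≤1+n s)) (ℕ.m≤n+m _ s)))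
                     , λ { refl → ℕ.≰⇒> n≮s² }

    -- Consecutive squares up to s² differ by at most 2 s - 1.
    next-square : ∀ s n → n ℕ.≤ s ℕ.* s → Σ ℕ λ w → n ℕ.≤ w ℕ.* w × w ℕ.* w ℕ.≤ n ℕ.+ 2 ℕ.* s
    next-square zero    n n≤ = 0 , n≤ , z≤n
    next-square (suc s) n n≤ with n ℕ.≤? s ℕ.* s
    ... | yes n≤s² = let (w , l , u) = next-square s n n≤s² in w , l , ℕ.≤-trans u (ℕ.+-monoʳ-≤ n (ℕ.*-monoʳ-≤ 2 (ℕ.n≤1+n s)))
    ... | no  n≰s² = suc s , n≤ , ℕ.≤-trans (ℕ.≤-reflexive (lem s)) (ℕ.+-mono-≤ (ℕ.<⇒≤ (ℕ.≰⇒> n≰s²)) (ℕ.≤-trans (ℕ.n≤1+n _) (ℕ.≤-reflexive (lem′ s))))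
      where
      lem : ∀ s → suc s ℕ.* suc s ≡ s ℕ.* s ℕ.+ (1 ℕ.+ 2 ℕ.* s)
      lem = ℕ-solve-∀
      lem′ : ∀ s → suc (1 ℕ.+ 2 ℕ.* s) ≡ 2 ℕ.* suc s
      lem′ = ℕ-solve-∀

  private
    -- The residue y of t / l is rounded up to a square, which changes l y by at most 2 l s. Besides
    -- the congruence it matters that w² is of the size of m as an integer, because the same integer
    -- is used modulo another prime.
    near-square′ : ∀ {l m s} → Coprime l m → .{{_ : NonZero m}} → m ℕ.≤ s ℕ.* s → ∀ t →
      Σ ℕ λ w → Σ ℕ λ ρ → w ℕ.* w ℕ.≤ m ℕ.+ 2 ℕ.* s × ρ ℕ.≤ l ℕ.* (2 ℕ.* s) × Cong m (+ l * (+ w * + w)) (t + + ρ)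
    near-square′ {l} {m} {s} cop m≤s² t = w , ρ , ℕ.≤-trans w²≤ (ℕ.+-monoˡ-≤ (2 ℕ.* s) (ℕ.<⇒≤ y<m)) , ρ≤
      , ≡⇒Cong split ∙ Cong-+ {b = t} ly≡t (Cong-refl {a = + ρ})
      where
      i = proj₁ (inverse cop)
      R = residue m (i * t)
      y = proj₁ R
      y<m = proj₁ (proj₂ R)
      S = next-square s y (ℕ.≤-trans (ℕ.<⇒≤ y<m) m≤s²)
      w = proj₁ S
      y≤w² = proj₁ (proj₂ S)
      w²≤ = proj₂ (proj₂ S)
      ρ = l ℕ.* (w ℕ.* w ℕ.∸ y)
      ρ≤ = ℕ.*-monoʳ-≤ l (ℕ.≤-trans (ℕ.∸-monoˡ-≤ y w²≤) (ℕ.≤-reflexive (ℕ.m+n∸m≡n y (2 ℕ.* s))))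
      ly≡t : Cong m (+ l * + y) t
      ly≡t = Cong-trans (Cong-*ˡ (+ l) (Cong-sym (proj₂ (proj₂ R)))) (Cong-trans (≡⇒Cong (sym (ℤ.*-assoc (+ l) i t)))
        (Cong-trans (Cong-* (proj₂ (inverse cop)) (Cong-refl {a = t})) (≡⇒Cong (ℤ.*-identityˡ t))))
      split : + l * (+ w * + w) ≡ + l * + y + + ρ
      split = begin
        + l * (+ w * + w)                       ≡⟨ cong (+ l *_) (sym (ℤ.pos-* w w)) ⟩
        + l * + (w ℕ.* w)                       ≡⟨ sym (ℤ.pos-* l (w ℕ.* w)) ⟩
        + (l ℕ.* (w ℕ.* w))                     ≡⟨ cong (λ z → + (l ℕ.* z)) (sym (ℕ.m+[n∸m]≡n y≤w²)) ⟩
        + (l ℕ.* (y ℕ.+ (w ℕ.* w ℕ.∸ y)))       ≡⟨ cong +_ (ℕ.*-distribˡ-+ l y _) ⟩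
        + (l ℕ.* y ℕ.+ ρ)                       ≡⟨ ℤ.pos-+ (l ℕ.* y) ρ ⟩
        + (l ℕ.* y) + + ρ                       ≡⟨ cong (_+ + ρ) (ℤ.pos-* l y) ⟩
        + l * + y + + ρ                         ∎
        where open ≡-Reasoning

  abstract
    -- Take for s the square root of n, rounded up. If s - 1 ≤ C, the hypothesis gives C s ≤ n;
    -- otherwise C s ≤ (C + 1) (s - 1) ≤ (s - 1)² < n.
    √-bound : ∀ C n → C ℕ.* suc C ℕ.≤ n → Σ ℕ λ s → n ℕ.≤ s ℕ.* s × C ℕ.* s ℕ.≤ n
    √-bound C n big with ⌈√⌉ n
    ... | zero  , n≤ , _     = 0 , n≤ , ℕ.≤-trans (ℕ.≤-reflexive (ℕ.*-zeroʳ C)) z≤n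
    ... | suc s , n≤ , below with s ℕ.≤? C
    ...   | yes s≤C = suc s , n≤ , ℕ.≤-trans (ℕ.*-monoʳ-≤ C (s≤s s≤C)) big
    ...   | no  s≰C = suc s , n≤ , (begin
      C ℕ.* suc s       ≡⟨ ℕ.*-suc C s ⟩
      C ℕ.+ C ℕ.* s     ≤⟨ ℕ.+-monoˡ-≤ (C ℕ.* s) (ℕ.<⇒≤ (ℕ.≰⇒> s≰C)) ⟩
      suc C ℕ.* s       ≤⟨ ℕ.*-monoˡ-≤ s (ℕ.≰⇒> s≰C) ⟩
      s ℕ.* s           ≤⟨ ℕ.<⇒≤ (below refl) ⟩
      n                 ∎)
      where open ℕ.≤-Reasoning

    near-square : ∀ {l m s} → Coprime l m → .{{_ : NonZero m}} → m ℕ.≤ s ℕ.* s → ∀ t →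
      Σ ℕ λ w → Σ ℕ λ ρ → w ℕ.* w ℕ.≤ m ℕ.+ 2 ℕ.* s × ρ ℕ.≤ l ℕ.* (2 ℕ.* s) × Cong m (+ l * (+ w * + w)) (t + + ρ)
    near-square {s = s} = near-square′ {s = s}

  quad : ℤ → ℤ → ℤ → ℤ → ℤ → ℤ → ℤ → ℤ
  quad l β γ c d a x = l * (a * a) + β * (a * x) + γ * (x * x) + (c * a + d * x)

  private
    expand : ∀ l β γ c d x i w →
      l * ((w - i * (β * x + c)) * (w - i * (β * x + c))) + β * ((w - i * (β * x + c)) * x) + γ * (x * x) + (c * (w - i * (β * x + c)) + d * x)
      ≡ l * (w * w) + (l * (- (i * (β * x + c)) * - (i * (β * x + c))) + β * (- (i * (β * x + c)) * x) + γ * (x * x) + (c * - (i * (β * x + c)) + d * x))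
        + (β * x + c) * w * (1ℤ - + 2 * l * i)
    expand = solve-∀

    vanish : ∀ y z → y + z * (1ℤ - 1ℤ) ≡ y
    vanish = solve-∀

  abstract
    complete-square : ∀ {m l} → Coprime (2 ℕ.* l) m → ∀ β γ c d x →
      Σ ℤ λ h → Σ ℤ λ T → ∀ w → Cong m (quad (+ l) β γ c d (w - h) x) (+ l * (w * w) + T)
    complete-square {m} {l} cop β γ c d x = let (i , 2li≡1) = inverse cop ; T = quad (+ l) β γ c d (- (i * (β * x + c))) x in
      i * (β * x + c) , T , λ w →
      Cong-trans (≡⇒Cong (expand (+ l) β γ c d x i w))
      (Cong-trans (Cong-+ˡ (+ l * (w * w) + T) (Cong-*ˡ ((β * x + c) * w) (Cong-- (Cong-refl {a = 1ℤ}) (Cong-trans (≡⇒Cong (cong (_* i) (sym (ℤ.pos-* 2 l)))) 2li≡1))))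
      (≡⇒Cong (vanish (+ l * (w * w) + T) ((β * x + c) * w))))

    near-quad : ∀ {l m s} → Coprime l m → Coprime (2 ℕ.* l) m → .{{_ : NonZero m}} → m ℕ.≤ s ℕ.* s → ∀ β γ c d x t →
      Σ ℤ λ a → Σ ℕ λ ρ → ρ ℕ.≤ l ℕ.* (2 ℕ.* s) × Cong m (quad (+ l) β γ c d a x) (t + + ρ)
    near-quad {l} {m} {s} cop cop₂ m≤s² β γ c d x t =
      let (h , T , sq) = complete-square {l = l} cop₂ β γ c d x
          (w , ρ , _ , ρ≤ , w²≡) = near-square {s = s} cop m≤s² (t - T)
      in + w - h , ρ , ρ≤ , Cong-trans (sq (+ w)) (Cong-trans (Cong-+ w²≡ (Cong-refl {a = T})) (≡⇒Cong (rest t T (+ ρ))))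
      where
      rest : ∀ t T r → t - T + r + T ≡ t + r
      rest = solve-∀

  loop : ∀ {n} → (Fin n → ℤ) → (Fin n → ℤ) → Fin n → Form n
  loop β γ v = el v ⊗ el v ⊕ con (β v) ⊗ (el v ⊗ df v) ⊕ con (γ v) ⊗ (df v ⊗ df v)

  -- Modulo any prime one of the two vertices is held fixed to keep the edge linear in the other, so
  -- the two loops cannot both be dealt with at the smallest prime.
  loopedEdge : (β γ c d : Fin 2 → ℤ) → Form 2
  loopedEdge β γ c d = loop β γ 0F ⊕ loop β γ 1F ⊕ el 0F ⊗ el 1F ⊕ (linear c d 0F ⊕ linear c d 1F)

  private
    pair : ℤ → ℤ → Fin 2 → ℤ
    pair y₀ y₁ 0F = y₀
    pair y₀ y₁ 1F = y₁

    fix₁ : ∀ {m} β γ c d (a x : Fin 2 → ℤ) {a₀ n w} → a 0F ≡ a₀ → a 1F ≡ 1ℤ →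
      Cong m (quad 1ℤ (β 0F) (γ 0F) (c 0F + 1ℤ) (d 0F) a₀ (x 0F)) n → Cong m (quad 1ℤ (β 1F) (γ 1F) (c 1F) (d 1F) 1ℤ (x 1F)) w →
      Cong m (⟦ loopedEdge β γ c d ⟧ a x) (n + w)
    fix₁ β γ c d a x {a₀} e₀ e₁ hn hw =
      ≡⇒Cong (trans (⟦⟧-at (loopedEdge β γ c d) a (pair a₀ 1ℤ) x (λ { 0F → e₀ ; 1F → e₁ }))
        (lem a₀ (x 0F) (x 1F) (β 0F) (β 1F) (γ 0F) (γ 1F) (c 0F) (c 1F) (d 0F) (d 1F)))
      ∙ Cong-+ hn hw
      where
      lem : ∀ a₀ x₀ x₁ β₀ β₁ γ₀ γ₁ c₀ c₁ d₀ d₁ →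
        a₀ * a₀ + β₀ * (a₀ * x₀) + γ₀ * (x₀ * x₀) + (1ℤ * 1ℤ + β₁ * (1ℤ * x₁) + γ₁ * (x₁ * x₁)) + a₀ * 1ℤ + (c₀ * a₀ + d₀ * x₀ + (c₁ * 1ℤ + d₁ * x₁))
        ≡ 1ℤ * (a₀ * a₀) + β₀ * (a₀ * x₀) + γ₀ * (x₀ * x₀) + ((c₀ + 1ℤ) * a₀ + d₀ * x₀) + (1ℤ * (1ℤ * 1ℤ) + β₁ * (1ℤ * x₁) + γ₁ * (x₁ * x₁) + (c₁ * 1ℤ + d₁ * x₁))
      lem = solve-∀

    fix₀ : ∀ {m} β γ c d (a x : Fin 2 → ℤ) {a₁ n w} → a 0F ≡ 1ℤ → a 1F ≡ a₁ →
      Cong m (quad 1ℤ (β 1F) (γ 1F) (c 1F + 1ℤ) (d 1F) a₁ (x 1F)) n → Cong m (quad 1ℤ (β 0F) (γ 0F) (c 0F) (d 0F) 1ℤ (x 0F)) w →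
      Cong m (⟦ loopedEdge β γ c d ⟧ a x) (w + n)
    fix₀ β γ c d a x {a₁} e₀ e₁ hn hw =
      ≡⇒Cong (trans (⟦⟧-at (loopedEdge β γ c d) a (pair 1ℤ a₁) x (λ { 0F → e₀ ; 1F → e₁ }))
        (lem a₁ (x 1F) (x 0F) (β 1F) (β 0F) (γ 1F) (γ 0F) (c 1F) (c 0F) (d 1F) (d 0F)))
      ∙ Cong-+ hw hn
      where
      lem : ∀ a₀ x₀ x₁ β₀ β₁ γ₀ γ₁ c₀ c₁ d₀ d₁ →
        1ℤ * 1ℤ + β₁ * (1ℤ * x₁) + γ₁ * (x₁ * x₁) + (a₀ * a₀ + β₀ * (a₀ * x₀) + γ₀ * (x₀ * x₀)) + 1ℤ * a₀ + (c₁ * 1ℤ + d₁ * x₁ + (c₀ * a₀ + d₀ * x₀))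
        ≡ 1ℤ * (1ℤ * 1ℤ) + β₁ * (1ℤ * x₁) + γ₁ * (x₁ * x₁) + (c₁ * 1ℤ + d₁ * x₁) + (1ℤ * (a₀ * a₀) + β₀ * (a₀ * x₀) + γ₀ * (x₀ * x₀) + ((c₀ + 1ℤ) * a₀ + d₀ * x₀))
      lem = solve-∀

  private
    value₀ : ∀ {m} β γ c d (a x : Fin 2 → ℤ) {a₀ n w T r₁ r₂ t N R} → a 0F ≡ a₀ → a 1F ≡ 1ℤ →
      Cong m (quad 1ℤ (β 0F) (γ 0F) (c 0F + 1ℤ) (d 0F) a₀ (x 0F)) (n + r₁) →
      Cong m (1ℤ * (w * w)) (quad 1ℤ (β 1F) (γ 1F) (c 1F) (d 1F) 1ℤ (x 1F) - T + r₂) →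
      n + (w * w + T) ≡ N → r₁ + (t - r₂) ≡ R → Cong m (⟦ loopedEdge β γ c d ⟧ a x) (N + R - t)
    value₀ β γ c d a x {a₀} {n} {w} {T} {r₁} {r₂} {t} e₀ e₁ hn hw refl refl = Cong-trans
      (fix₁ β γ c d a x {a₀} e₀ e₁ hn (Cong-trans (≡⇒Cong (undo W T r₂)) (Cong-+ˡ (T - r₂) (Cong-sym hw))))
      (≡⇒Cong (arrange n r₁ T r₂ w t))
      where
      W = quad 1ℤ (β 1F) (γ 1F) (c 1F) (d 1F) 1ℤ (x 1F)
      undo : ∀ W T r → W ≡ T - r + (W - T + r)
      undo = solve-∀
      arrange : ∀ n r T q w t → n + r + (T - q + 1ℤ * (w * w)) ≡ n + (w * w + T) + (r + (t - q)) - t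
      arrange = solve-∀

    value₁ : ∀ {m} β γ c d (a x : Fin 2 → ℤ) {a₁ n w T N} U → a 0F ≡ 1ℤ → a 1F ≡ a₁ →
      Cong m (quad 1ℤ (β 1F) (γ 1F) (c 1F + 1ℤ) (d 1F) a₁ (x 1F)) (1ℤ * (w * w) + U) → Cong m U T →
      Cong m (quad 1ℤ (β 0F) (γ 0F) (c 0F) (d 0F) 1ℤ (x 0F)) n → n + (w * w + T) ≡ N → Cong m (⟦ loopedEdge β γ c d ⟧ a x) N
    value₁ β γ c d a x {a₁} {n} {w} {T} U e₀ e₁ hsq hU hn refl =
      fix₀ β γ c d a x {a₁} e₀ e₁ (Cong-trans hsq (Cong-+ (≡⇒Cong (ℤ.*-identityˡ (w * w))) hU)) hn

  -- Modulo p₁ the free vertex 1 only uses the squares w² of numbers w = O(√ p₀), so that its contribution is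
  -- an honest integer, which modulo p₀ has the wanted value up to an error O(√ p₀).
  loopedEdge-solvable : ∀ β γ c d → Solvable (loopedEdge β γ c d)
  loopedEdge-solvable β γ c d M E = proj₁ C , (begin
    B (proj₁ C) ℕ.* E                 ≡⟨ cong (ℕ._* E) (proj₁ (proj₂ C)) ⟩
    bound ℕ.* suc (4 ℕ.* s) ℕ.* E     ≤⟨ small ⟩
    p 0F ℕ.* (p 1F ℕ.* 1)             ≡⟨ sym (proj₂ (proj₂ C)) ⟩
    ∣ proj₁ C ∣ₘ                      ∎)
    where
    open ℕ.≤-Reasoning
    -- The ranges of `N` and `ρ` are at most 5 p₁ and 5 s, whence 25 E; the summand 2 yields 2 s ≤
    -- p₀ for the estimate of w².
    D = 25 ℕ.* E ℕ.+ 2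
    family = primeFamily (M ℕ.⊔ D ℕ.* suc D) 2
    open PrimeFamily (proj₁ family) hiding (above)
    P : PrimeFamily M 2
    P = record { PrimeFamily (proj₁ family) hiding (above) ; above = λ i → ℕ.≤-<-trans (ℕ.m≤m⊔n M _) (PrimeFamily.above (proj₁ family) i) }
    D<p : ∀ i → D ℕ.* suc D ℕ.< p i
    D<p i = ℕ.≤-<-trans (ℕ.m≤n⊔m M _) (PrimeFamily.above (proj₁ family) i)
    p₀<p₁ : p 0F ℕ.< p 1F
    p₀<p₁ = proj₂ family (s≤s z≤n)
    instance
      p≢0 : ∀ {i} → NonZero (p i)
      p≢0 {i} = prime⇒nonZero (prime i)
    2≤D : 2 ℕ.≤ D
    2≤D = ℕ.m≤n+m 2 (25 ℕ.* E)
    2<p : ∀ i → 2 ℕ.< p i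
    2<p i = ℕ.≤-<-trans (ℕ.≤-trans 2≤D (ℕ.≤-trans (ℕ.≤-reflexive (sym (ℕ.*-identityʳ D))) (ℕ.*-monoʳ-≤ D (s≤s z≤n)))) (D<p i)
    two : ∀ i → Coprime 2 (p i)
    two i = coprime-prime (prime i) (2<p i)
    one : ∀ i → Coprime 1 (p i)
    one i = coprime-prime (prime i) (ℕ.<-trans (s≤s (s≤s z≤n)) (2<p i))
    root = √-bound D (p 0F) (ℕ.<⇒≤ (D<p 0F))
    s = proj₁ root
    p₀≤s² = proj₁ (proj₂ root)
    Ds≤p₀ = proj₂ (proj₂ root)
    W₀ W₁ : ℤ → ℤ
    W₀ = quad 1ℤ (β 0F) (γ 0F) (c 0F) (d 0F) 1ℤ
    W₁ = quad 1ℤ (β 1F) (γ 1F) (c 1F) (d 1F) 1ℤ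
    module _ (x₀ : ℤ) where
      Nr = residue (p 1F) (W₀ x₀)
      N₀ = proj₁ Nr
      move₀ = near-quad {1} {p 0F} {s} (one 0F) (two 0F) p₀≤s² (β 0F) (γ 0F) (c 0F + 1ℤ) (d 0F) x₀ (+ N₀)
      ρ₁ = proj₁ (proj₂ move₀)
    module _ (x₁ : ℤ) where
      square = complete-square {p 1F} {1} (two 1F) (β 1F) (γ 1F) (c 1F + 1ℤ) (d 1F) x₁
      Tr = residue (p 1F) (proj₁ (proj₂ square))
      T = proj₁ Tr
      move₁ = near-square {1} {p 0F} {s} (one 0F) p₀≤s² (W₁ x₁ - + T)
      w = proj₁ move₁
      ρ₂ = proj₁ (proj₂ move₁)
      ρ₂≤ : ρ₂ ℕ.≤ 2 ℕ.* s
      ρ₂≤ = ℕ.≤-trans (proj₁ (proj₂ (proj₂ (proj₂ move₁)))) (ℕ.≤-reflexive (ℕ.*-identityˡ _))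
    σ : Fin 2 → Strategy 2
    σ 0F 0F x = proj₁ (move₀ x)
    σ 0F 1F x = 1ℤ
    σ 1F 0F x = 1ℤ
    σ 1F 1F x = + w x - proj₁ (square x)
    bound = suc (4 ℕ.* p 1F)
    N ρ : (Fin 2 → ℤ) → ℕ
    N x = N₀ (x 0F) ℕ.+ (w (x 1F) ℕ.* w (x 1F) ℕ.+ T (x 1F))
    -- The errors of the two vertices enter with opposite signs. Adding 2 s keeps the recorded
    -- number natural, and `target` subtracts it again.
    ρ x = ρ₁ (x 0F) ℕ.+ (2 ℕ.* s ℕ.∸ ρ₂ (x 1F))
    target : Fin 2 → ℕ → ℕ → ℤ
    target 0F n r = + n + + r - + (2 ℕ.* s)
    target 1F n r = + n
    total : ∀ x → + N₀ (x 0F) + (+ w (x 1F) * + w (x 1F) + + T (x 1F)) ≡ + N x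
    total x = cong (λ y → + N₀ (x 0F) + (y + + T (x 1F))) (sym (ℤ.pos-* (w (x 1F)) (w (x 1F))))
    values : ∀ x i → Cong (p i) (⟦ loopedEdge β γ c d ⟧ (σ i ⟨ x ⟩) x) (target i (N x) (ρ x))
    values x 0F = value₀ β γ c d (σ 0F ⟨ x ⟩) x {proj₁ (move₀ (x 0F))} {+ N₀ (x 0F)} {+ w (x 1F)} {+ T (x 1F)} {+ ρ₁ (x 0F)} {+ ρ₂ (x 1F)} {+ (2 ℕ.* s)}
      refl refl (proj₂ (proj₂ (proj₂ (move₀ (x 0F))))) (proj₂ (proj₂ (proj₂ (proj₂ (move₁ (x 1F)))))) (total x)
      (cong (λ z → + ρ₁ (x 0F) + z) (trans (ℤ.m-n≡m⊖n (2 ℕ.* s) (ρ₂ (x 1F))) (ℤ.⊖-≥ (ρ₂≤ (x 1F)))))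
    values x 1F = value₁ β γ c d (σ 1F ⟨ x ⟩) x {+ w (x 1F) - proj₁ (square (x 1F))} {+ N₀ (x 0F)} {+ w (x 1F)} {+ T (x 1F)} (proj₁ (proj₂ (square (x 1F))))
      refl refl (proj₂ (proj₂ (square (x 1F))) (+ w (x 1F))) (proj₂ (proj₂ (Tr (x 1F)))) (proj₂ (proj₂ (Nr (x 0F)))) (total x)
    N<bound : ∀ x → N x ℕ.< bound
    N<bound x = s≤s (begin
      N x                                                            ≤⟨ ℕ.+-mono-≤ (ℕ.<⇒≤ (proj₁ (proj₂ (Nr (x 0F))))) (ℕ.+-mono-≤ w² (ℕ.<⇒≤ (proj₁ (proj₂ (Tr (x 1F)))))) ⟩
      p 1F ℕ.+ (p 1F ℕ.+ p 1F ℕ.+ p 1F)                              ≡⟨ lem (p 1F) ⟩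
      4 ℕ.* p 1F                                                     ∎)
      where
      w² : w (x 1F) ℕ.* w (x 1F) ℕ.≤ p 1F ℕ.+ p 1F
      w² = ℕ.≤-trans (proj₁ (proj₂ (proj₂ (move₁ (x 1F))))) (ℕ.+-mono-≤ (ℕ.<⇒≤ p₀<p₁)
        (ℕ.≤-trans (ℕ.*-monoˡ-≤ s 2≤D) (ℕ.≤-trans Ds≤p₀ (ℕ.<⇒≤ p₀<p₁))))
      lem : ∀ p → p ℕ.+ (p ℕ.+ p ℕ.+ p) ≡ 4 ℕ.* p
      lem = ℕ-solve-∀
    ρ< : ∀ x → ρ x ℕ.< suc (4 ℕ.* s)
    ρ< x = s≤s (ℕ.≤-trans (ℕ.+-mono-≤ (ℕ.≤-trans (proj₁ (proj₂ (proj₂ (move₀ (x 0F))))) (ℕ.≤-reflexive (ℕ.*-identityˡ _))) (ℕ.m∸n≤m (2 ℕ.* s) (ρ₂ (x 1F)))) (ℕ.≤-reflexive (lem s)))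
      where
      lem : ∀ s → 2 ℕ.* s ℕ.+ 2 ℕ.* s ≡ 4 ℕ.* s
      lem = ℕ-solve-∀
    C = cover (loopedEdge β γ c d) P σ bound (suc (4 ℕ.* s)) target λ x → N x , ρ x , N<bound x , ρ< x , values x
    1≤s : 1 ℕ.≤ s
    1≤s = ℕ.n≢0⇒n>0 λ { s≡0 → contradiction (subst (λ s → p 0F ℕ.≤ s ℕ.* s) s≡0 p₀≤s²) (ℕ.<⇒≱ (ℕ.<-trans (s≤s z≤n) (2<p 0F))) }
    small : bound ℕ.* suc (4 ℕ.* s) ℕ.* E ℕ.≤ p 0F ℕ.* (p 1F ℕ.* 1)
    small = begin
      bound ℕ.* suc (4 ℕ.* s) ℕ.* E
        ≤⟨ ℕ.*-monoˡ-≤ E {bound ℕ.* suc (4 ℕ.* s)} {(p 1F ℕ.+ 4 ℕ.* p 1F) ℕ.* (s ℕ.+ 4 ℕ.* s)} (ℕ.*-mono-≤ {bound} {p 1F ℕ.+ 4 ℕ.* p 1F} {suc (4 ℕ.* s)} {s ℕ.+ 4 ℕ.* s} (ℕ.+-monoˡ-≤ (4 ℕ.* p 1F) (ℕ.<-trans (s≤s z≤n) (2<p 1F))) (ℕ.+-monoˡ-≤ (4 ℕ.* s) 1≤s)) ⟩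
      (p 1F ℕ.+ 4 ℕ.* p 1F) ℕ.* (s ℕ.+ 4 ℕ.* s) ℕ.* E    ≡⟨ lem (p 1F) s E ⟩
      25 ℕ.* E ℕ.* s ℕ.* (p 1F ℕ.* 1)                    ≤⟨ ℕ.*-monoˡ-≤ (p 1F ℕ.* 1) (ℕ.≤-trans (ℕ.*-monoˡ-≤ s (ℕ.m≤m+n (25 ℕ.* E) 2)) Ds≤p₀) ⟩
      p 0F ℕ.* (p 1F ℕ.* 1)                              ∎
      where
      lem : ∀ p s E → (p ℕ.+ 4 ℕ.* p) ℕ.* (s ℕ.+ 4 ℕ.* s) ℕ.* E ≡ 25 ℕ.* E ℕ.* s ℕ.* (p ℕ.* 1)
      lem = ℕ-solve-∀

-- Two opposite edges with a pendant edge: intervals, labels and the game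

module Pendant where

  open Congruence
  open Block
  open Transform
  open Triangle using (linear; triple)
  open import Data.Integer.Base using (-_; _+_; _*_; _-_)

  record In (p w : ℕ) (u : ℤ) : Set where
    constructor in-interval
    field
      e   : ℕ
      e<w : e ℕ.< w
      u≡e : Cong p u (+ e)

  In-resp : ∀ {p w u v} → Cong p u v → In p w v → In p w u
  In-resp u≡v (in-interval e e<w v≡e) = in-interval e e<w (u≡v ∙ v≡e)

  abstract
    In? : ∀ p w .{{_ : NonZero p}} → w ℕ.≤ p → ∀ u → Dec (In p w u)
    In? p w w≤p u with residue p u
    ... | r , r<p , u≡r with r ℕ.<? w
    ...   | yes r<w = yes (in-interval r r<w u≡r)
    ...   | no  r≮w = no λ (in-interval e e<w u≡e) → r≮w (subst (ℕ._< w) (Cong⇒≡ (ℕ.<-≤-trans e<w w≤p) r<p (Cong-sym u≡e ∙ u≡r)) e<w)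

  -- If u and u + v lie in [0, w), then v lies in (- w, w).
  Near : ℕ → ℕ → ℤ → Set
  Near p w v = In p (w ℕ.+ w) (v + + w)

  near : ∀ {p w u t v} → In p w u → In p w t → t ≡ u + v → Near p w v
  near {p} {w} {u} {t} {v} (in-interval e e<w u≡e) (in-interval f f<w t≡f) refl =
    in-interval (f ℕ.+ (w ℕ.∸ e)) (ℕ.+-mono-<-≤ f<w (ℕ.m∸n≤m w e)) (≡⇒Cong (lem u v (+ w))
      ∙ Cong-+ t≡f (Cong-- (Cong-refl {a = + w}) u≡e ∙ ≡⇒Cong (trans (ℤ.m-n≡m⊖n w e) (ℤ.⊖-≥ (ℕ.<⇒≤ e<w)))))
    where
    lem : ∀ u v w → v + w ≡ u + v + (w - u)
    lem = solve-∀

  module _ where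
    clash : ∀ {p a b} → a ℕ.< p → b ℕ.< p → b ℕ.< a → Cong p (+ a) (+ b) → ⊥
    clash a<p b<p b<a c = ℕ.<-irrefl (sym (Cong⇒≡ a<p b<p c)) b<a

    scale : ∀ {p w} k → 8 ℕ.* w ℕ.≤ p → k ℕ.≤ 8 → k ℕ.* w ℕ.≤ p
    scale {w = w} k 8w≤p k≤8 = ℕ.≤-trans (ℕ.*-monoˡ-≤ w k≤8) 8w≤p

    disjoint₁ : ∀ {p w} u → 8 ℕ.* w ℕ.≤ p → In p w u → In p w (u + + w) → ⊥
    disjoint₁ {p} {w} u 8w≤p (in-interval e e<w u≡e) (in-interval f f<w uw≡f) = clash
      (ℕ.<-≤-trans (ℕ.+-monoˡ-< w e<w) (ℕ.≤-trans (ℕ.≤-reflexive (lem w)) (scale {p} {w} 2 8w≤p (s≤s (s≤s z≤n)))))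
      (ℕ.<-≤-trans f<w (ℕ.≤-trans (ℕ.≤-reflexive (sym (ℕ.*-identityˡ w))) (scale {p} {w} 1 8w≤p (s≤s z≤n))))
      (ℕ.<-≤-trans f<w (ℕ.m≤n+m w e))
      (Cong-+ (Cong-sym u≡e) (Cong-refl {a = + w}) ∙ uw≡f)
      where
      lem : ∀ w → w ℕ.+ w ≡ 2 ℕ.* w
      lem = ℕ-solve-∀

    -- The two choices ± 1 of b cannot both be spoilt by small v.
    opposite : ∀ {p w} u → 1 ℕ.≤ w → 8 ℕ.* w ℕ.≤ p →
      In p (3 ℕ.* w) (u + + w + + w + + w) → In p (3 ℕ.* w) (u - + w - + w + + w) → ⊥
    opposite {p} {w} u 1≤w 8w≤p (in-interval e e<3w u≡e) (in-interval f f<3w u≡f) = clash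
      (ℕ.<-≤-trans (ℕ.+-monoʳ-< (4 ℕ.* w) f<3w) (ℕ.≤-trans (ℕ.≤-reflexive (lem w)) (scale {p} {w} 7 8w≤p (ℕ.n≤1+n 7))))
      (ℕ.<-≤-trans e<3w (scale {p} {w} 3 8w≤p (s≤s (s≤s (s≤s z≤n)))))
      (ℕ.<-≤-trans e<3w (ℕ.≤-trans (ℕ.*-monoˡ-≤ w (ℕ.n≤1+n 3)) (ℕ.m≤m+n (4 ℕ.* w) f)))
      (≡⇒Cong (cong (_+ + f) (ℤ.pos-* 4 w)) ∙ Cong-+ˡ (+ 4 * + w) (Cong-sym u≡f) ∙ ≡⇒Cong (lem′ u (+ w)) ∙ u≡e)
      where
      lem : ∀ w → 4 ℕ.* w ℕ.+ 3 ℕ.* w ≡ 7 ℕ.* w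
      lem = ℕ-solve-∀
      lem′ : ∀ u w → + 4 * w + (u - w - w + w) ≡ u + w + w + w
      lem′ = solve-∀

    -- Here v lies in [- 3 w , - w) modulo p, so v + z lies in [- 3 w , 0), which is disjoint from
    -- [0 , w).
    far : ∀ {p w} z v → 1 ℕ.≤ w → 8 ℕ.* w ℕ.≤ p → In p w z → Near p w (+ w + + w + v) → In p w (v + z) → ⊥
    far {p} {w} z v 1≤w 8w≤p (in-interval e e<w z≡e) (in-interval f f<2w v≡f) (in-interval g g<w vz≡g) = clash
      (ℕ.<-≤-trans (ℕ.+-monoʳ-< (3 ℕ.* w) g<w) (ℕ.≤-trans (ℕ.≤-reflexive (lem w)) (scale {p} {w} 4 8w≤p (s≤s (s≤s (s≤s (s≤s z≤n)))))))
      (ℕ.<-≤-trans fe< (scale {p} {w} 3 8w≤p (s≤s (s≤s (s≤s z≤n)))))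
      (ℕ.<-≤-trans fe< (ℕ.m≤m+n (3 ℕ.* w) g))
      (≡⇒Cong (cong (_+ + g) (ℤ.pos-* 3 w)) ∙ Cong-+ˡ (+ 3 * + w) (Cong-sym vz≡g) ∙ ≡⇒Cong (lem′ z v (+ w)) ∙ Cong-+ v≡f z≡e)
      where
      lem : ∀ w → 3 ℕ.* w ℕ.+ w ≡ 4 ℕ.* w
      lem = ℕ-solve-∀
      lem₂ : ∀ w → w ℕ.+ w ℕ.+ w ≡ 3 ℕ.* w
      lem₂ = ℕ-solve-∀
      fe< : f ℕ.+ e ℕ.< 3 ℕ.* w
      fe< = ℕ.<-≤-trans (ℕ.+-mono-< f<2w e<w) (ℕ.≤-reflexive (lem₂ w))
      lem′ : ∀ z v w → + 3 * w + (v + z) ≡ w + w + v + w + z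
      lem′ = solve-∀

    -- Vertex 1 has to choose `b` without knowing v. The conclusion is a necessary condition in
    -- which v no longer occurs, so `b` may be chosen by testing it.
    spoil₊ : ∀ {p w} u v → Near p w v → In p w (u + (+ w + + w + v)) → In p (3 ℕ.* w) (u + + w + + w + + w)
    spoil₊ {p} {w} u v (in-interval f f<2w v≡f) (in-interval e e<w u≡e) = in-interval (e ℕ.+ (w ℕ.+ w ℕ.∸ f))
      (ℕ.<-≤-trans (ℕ.+-mono-<-≤ e<w (ℕ.m∸n≤m (w ℕ.+ w) f)) (ℕ.≤-reflexive (lem w)))
      (≡⇒Cong (lem′ u v (+ w)) ∙ Cong-+ u≡e (Cong-- (Cong-refl {a = + (w ℕ.+ w)}) v≡f ∙ ≡⇒Cong (trans (ℤ.m-n≡m⊖n (w ℕ.+ w) f) (ℤ.⊖-≥ (ℕ.<⇒≤ f<2w)))))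
      where
      lem : ∀ w → w ℕ.+ (w ℕ.+ w) ≡ 3 ℕ.* w
      lem = ℕ-solve-∀
      lem′ : ∀ u v w → u + w + w + w ≡ u + (w + w + v) + (w + w - (v + w))
      lem′ = solve-∀

    spoil₋ : ∀ {p w} u v → Near p w v → In p w (u - (+ w + + w + v)) → In p (3 ℕ.* w) (u - + w - + w + + w)
    spoil₋ {p} {w} u v (in-interval f f<2w v≡f) (in-interval e e<w u≡e) = in-interval (e ℕ.+ f)
      (ℕ.<-≤-trans (ℕ.+-mono-< e<w f<2w) (ℕ.≤-reflexive (lem w)))
      (≡⇒Cong (lem′ u v (+ w)) ∙ Cong-+ u≡e v≡f)
      where
      lem : ∀ w → w ℕ.+ (w ℕ.+ w) ≡ 3 ℕ.* w
      lem = ℕ-solve-∀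
      lem′ : ∀ u v w → u - w - w + w ≡ u - (w + w + v) + (v + w)
      lem′ = solve-∀

  -- Freeing vertex 0 or vertex 1 by fixing ends would require both elements at the other of the two
  -- to be fixed.
  pendant : (Fin 3 → ℤ) → (Fin 3 → ℤ) → Form 3
  pendant c d = el 0F ⊗ el 1F ⊕ (el 0F ⊕ df 0F) ⊗ (el 1F ⊕ df 1F) ⊕ el 0F ⊗ el 2F ⊕ (linear c d 0F ⊕ linear c d 1F ⊕ linear c d 2F)

  -- What vertex 2 announces about z = d₂ x₂: `ℓ₀` if z is in the interval [0 , w₁) modulo p₁, `ℓ₁`
  -- if it is only in [0 , w₂) modulo p₂, `ℓ₂` if it is in neither.
  data Label : Set where
    ℓ₀ ℓ₁ ℓ₂ : Label

  module _ where
    rank : Label → ℤ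
    rank ℓ₀ = 0ℤ
    rank ℓ₁ = 1ℤ
    rank ℓ₂ = + 2

    labelOf : ∀ {A B : Set} → Dec A → Dec B → Label
    labelOf (yes _) _       = ℓ₀
    labelOf (no _)  (yes _) = ℓ₁
    labelOf (no _)  (no _)  = ℓ₂

    Labels : Set → Set → Label → Set
    Labels A B ℓ₀ = A
    Labels A B ℓ₁ = ¬ A × B
    Labels A B ℓ₂ = ¬ A × ¬ B

    labels : ∀ {A B : Set} (a : Dec A) (b : Dec B) → Labels A B (labelOf a b)
    labels (yes a) _       = a
    labels (no ¬a) (yes b) = ¬a , b
    labels (no ¬a) (no ¬b) = ¬a , ¬b

    decide : ∀ {A : Set} {X : Set} → Dec A → X → X → X
    decide (yes _) x y = x
    decide (no _)  x y = y

    -- The coordinates are A = a₀ + c₂, b = a₁ + x₁ + d₀ and t = a₂. The relation between c₁, c₂ and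
    -- d₁ makes A the factor of y as well as of t: at A = 0 the difference x₁ drops out, but then z
    -- cannot be compensated by t.
    value : ∀ c d (a x : Fin 3 → ℤ) {A b t v y z K} → c 1F ≡ c 2F + d 1F →
      a 0F ≡ A - c 2F → a 1F ≡ b - d 0F - x 1F → a 2F ≡ t →
      v ≡ x 0F + d 1F - c 2F → y ≡ x 1F + d 0F + d 0F - c 0F → z ≡ d 2F * x 2F → K ≡ - (c 2F) * (c 0F - d 0F) - d 1F * d 0F →
      ⟦ pendant c d ⟧ a x - K ≡ A * (b - y + t) + (A + v) * b + z
    value c d a x {A} {b} {t} e e₀ e₁ e₂ refl refl refl refl = trans
      (cong (_- (- (c 2F) * (c 0F - d 0F) - d 1F * d 0F)) (trans (⟦⟧-at (pendant c d) a (triple (A - c 2F) (b - d 0F - x 1F) t) x (λ { 0F → e₀ ; 1F → e₁ ; 2F → e₂ }))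
        (cong (λ c₁ → (A - c 2F) * (b - d 0F - x 1F) + (A - c 2F + x 0F) * (b - d 0F - x 1F + x 1F) + (A - c 2F) * t
          + (c 0F * (A - c 2F) + d 0F * x 0F + (c₁ * (b - d 0F - x 1F) + d 1F * x 1F) + (c 2F * t + d 2F * x 2F))) e)))
      (lem A b t (x 0F) (x 1F) (x 2F) (c 0F) (c 2F) (d 0F) (d 1F) (d 2F))
      where
      lem : ∀ A b t x₀ x₁ x₂ c₀ c₂ d₀ d₁ d₂ →
        (A - c₂) * (b - d₀ - x₁) + (A - c₂ + x₀) * (b - d₀ - x₁ + x₁) + (A - c₂) * t
          + (c₀ * (A - c₂) + d₀ * x₀ + ((c₂ + d₁) * (b - d₀ - x₁) + d₁ * x₁) + (c₂ * t + d₂ * x₂)) - (- c₂ * (c₀ - d₀) - d₁ * d₀)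
        ≡ A * (b - (x₁ + d₀ + d₀ - c₀) + t) + (A + (x₀ + d₁ - c₂)) * b + d₂ * x₂
      lem = solve-∀

    move₁ : ∀ {A : Set} → Label → Dec A → ℤ
    move₁ ℓ₀ D = decide D (- 1ℤ) 1ℤ
    move₁ ℓ₁ _ = 0ℤ
    move₁ ℓ₂ _ = 0ℤ

    move₂ : ∀ {A : Set} → Label → Dec A → ℤ
    move₂ ℓ₀ D = decide D 1ℤ 0ℤ
    move₂ ℓ₁ _ = 1ℤ
    move₂ ℓ₂ _ = 0ℤ

    -- The reduced form at A = w, where t = - z / w cancels z. Its counterpart `passive` is the
    -- reduced form at A = 0, where t has no influence.
    active : ℕ → ℤ → ℤ → ℤ → ℤ
    active w v y b = - (+ w * y) + (+ w + + w + v) * b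

    passive : ℤ → ℤ → ℤ → ℤ
    passive v z b = v * b + z

    -- Vertex 0 makes p₁ or p₂ active by looking at v; vertex 1 chooses `b` from y and the label. If
    -- v is not near 0 modulo p₁, both primes are passive and p₁ decides: for `ℓ₀` the shift by v or
    -- - v drives z out of the interval, otherwise b = 0 leaves z outside. If v is near 0 there but
    -- 2 w₂ + v is not near 0 modulo p₂, then p₂ is active; it decides for `ℓ₀`, and p₁ for the
    -- other labels. If both are near, p₁ is active and decides for `ℓ₀` by the right sign of 2 w₁ +
    -- v, while p₂ is passive and decides for the others, with v close to - 2 w₂ pushing z out in
    -- the case `ℓ₁`.
    endgame : ∀ {p₁ w₁ p₂ w₂} v y z ℓ →
      1 ℕ.≤ w₁ → 8 ℕ.* w₁ ℕ.≤ p₁ → 1 ℕ.≤ w₂ → 8 ℕ.* w₂ ℕ.≤ p₂ →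
      Labels (In p₁ w₁ z) (In p₂ w₂ z) ℓ →
      (D₁ : Dec (In p₁ (3 ℕ.* w₁) (- (+ w₁ * y) + + w₁ + + w₁ + + w₁))) (D₂ : Dec (In p₂ w₂ (- (+ w₂ * y)))) →
      (N₁ : Dec (Near p₁ w₁ v)) (N₂ : Dec (Near p₂ w₂ (+ w₂ + + w₂ + v))) →
      In p₁ w₁ (decide N₁ (decide N₂ (active w₁ v y (move₁ ℓ D₁)) (passive v z (move₁ ℓ D₁))) (passive v z (move₁ ℓ D₁))) →
      In p₂ w₂ (decide N₁ (decide N₂ (passive v z (move₂ ℓ D₂)) (active w₂ v y (move₂ ℓ D₂))) (passive v z (move₂ ℓ D₂))) → ⊥
    endgame {p₁} {w₁} {p₂} {w₂} v y z ℓ 1≤w₁ 8w₁ 1≤w₂ 8w₂ = go ℓ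
      where
      one : ∀ v z → v * 1ℤ + z ≡ z + v
      one = solve-∀
      one′ : ∀ v z → v * 1ℤ + z ≡ v + z
      one′ = solve-∀
      none : ∀ v z → z ≡ v * 0ℤ + z
      none = solve-∀
      none′ : ∀ u v → u ≡ u + v * 0ℤ
      none′ = solve-∀
      minus : ∀ v z → z ≡ v * - 1ℤ + z + v
      minus = solve-∀
      plus : ∀ u v → u + v * 1ℤ ≡ u + v
      plus = solve-∀
      subtract : ∀ u v → u - v ≡ u + v * - 1ℤ
      subtract = solve-∀
      sub : ∀ {p w u t} → t ≡ u → In p w u → In p w t
      sub refl i = i
      u₁ = - (+ w₁ * y)
      u₂ = - (+ w₂ * y)
      s₁ = + w₁ + + w₁ + v
      s₂ = + w₂ + + w₂ + v
      go : ∀ ℓ → Labels (In p₁ w₁ z) (In p₂ w₂ z) ℓ →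
        (D₁ : Dec (In p₁ (3 ℕ.* w₁) (u₁ + + w₁ + + w₁ + + w₁))) (D₂ : Dec (In p₂ w₂ u₂))
        (N₁ : Dec (Near p₁ w₁ v)) (N₂ : Dec (Near p₂ w₂ s₂)) →
        In p₁ w₁ (decide N₁ (decide N₂ (u₁ + s₁ * move₁ ℓ D₁) (v * move₁ ℓ D₁ + z)) (v * move₁ ℓ D₁ + z)) →
        In p₂ w₂ (decide N₁ (decide N₂ (v * move₂ ℓ D₂ + z) (u₂ + s₂ * move₂ ℓ D₂)) (v * move₂ ℓ D₂ + z)) → ⊥
      go ℓ₀ A (yes _) _ (no ¬N) _ U₁ _ = ¬N (near U₁ A (minus v z))
      go ℓ₀ A (no _)  _ (no ¬N) _ U₁ _ = ¬N (near A U₁ (one v z))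
      go ℓ₁ (¬A , _) _ _ (no _) _ U₁ _ = ¬A (sub (none v z) U₁)
      go ℓ₂ (¬A , _) _ _ (no _) _ U₁ _ = ¬A (sub (none v z) U₁)
      go ℓ₀ A _ (yes D) (yes _) (no ¬N) _ U₂ = ¬N (near D U₂ (plus u₂ s₂))
      go ℓ₀ A _ (no ¬D) (yes _) (no _)  _ U₂ = ¬D (sub (none′ u₂ s₂) U₂)
      go ℓ₁ (¬A , _) _ _ (yes _) (no _) U₁ _ = ¬A (sub (none v z) U₁)
      go ℓ₂ (¬A , _) _ _ (yes _) (no _) U₁ _ = ¬A (sub (none v z) U₁)
      go ℓ₀ A (yes D) _ (yes N) (yes _) U₁ _ = opposite u₁ 1≤w₁ 8w₁ D (spoil₋ u₁ v N (sub (subtract u₁ s₁) U₁))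
      go ℓ₀ A (no ¬D) _ (yes N) (yes _) U₁ _ = ¬D (spoil₊ u₁ v N (sub (sym (plus u₁ s₁)) U₁))
      go ℓ₁ (_ , B) _ _ (yes _) (yes N) _ U₂ = far z v 1≤w₂ 8w₂ B N (sub (sym (one′ v z)) U₂)
      go ℓ₂ (_ , ¬B) _ _ (yes _) (yes _) _ U₂ = ¬B (sub (none v z) U₂)

    -- The disjointness arguments add up as many as seven widths, so an eighth of p is safe; the
    -- last inequality bounds the density of the interval from below.
    width : ∀ p → 8 ℕ.≤ p → Σ ℕ λ w → 1 ℕ.≤ w × 8 ℕ.* w ℕ.≤ p × p ℕ.≤ 16 ℕ.* w
    width p 8≤p = p ℕ./ 8 , 1≤w , ℕ.≤-trans (ℕ.≤-reflexive (ℕ.*-comm 8 (p ℕ./ 8))) (ℕ.m/n*n≤m p 8) , (begin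
      p                            ≡⟨ ℕ.m≡m%n+[m/n]*n p 8 ⟩
      p ℕ.% 8 ℕ.+ p ℕ./ 8 ℕ.* 8    ≤⟨ ℕ.+-monoˡ-≤ _ (ℕ.<⇒≤ (ℕ.m%n<n p 8)) ⟩
      8 ℕ.+ p ℕ./ 8 ℕ.* 8          ≤⟨ ℕ.+-monoˡ-≤ _ (ℕ.*-monoˡ-≤ 8 1≤w) ⟩
      p ℕ./ 8 ℕ.* 8 ℕ.+ p ℕ./ 8 ℕ.* 8 ≡⟨ lem (p ℕ./ 8) ⟩
      16 ℕ.* (p ℕ./ 8)             ∎)
      where
      open ℕ.≤-Reasoning
      1≤w : 1 ℕ.≤ p ℕ./ 8
      1≤w = ℕ.m≥n⇒m/n>0 8≤p
      lem : ∀ w → w ℕ.* 8 ℕ.+ w ℕ.* 8 ≡ 16 ℕ.* w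
      lem = ℕ-solve-∀

    -- The translates of [0 , w) by 0, - w and - 2 w are disjoint. If - y plus the announced
    -- multiple of w lands in [0 , w), vertex 1, which knows only y, can tell which multiple it was.
    recover : ∀ {p w} y ℓ → 8 ℕ.* w ℕ.≤ p → (A : Dec (In p w (- y))) (B : Dec (In p w (- y + + w))) →
      In p w (- y + rank ℓ * + w) → labelOf A B ≡ ℓ
    recover {p} {w} y = go
      where
      zero-shift : ∀ y w → - y ≡ - y + 0ℤ * w
      zero-shift = solve-∀
      one-shift : ∀ y w → - y + w ≡ - y + 1ℤ * w
      one-shift = solve-∀
      two-shift : ∀ y w → - y + w + w ≡ - y + + 2 * w
      two-shift = solve-∀
      sub : ∀ {u t} → t ≡ u → In p w u → In p w t
      sub refl i = i
      apart : 8 ℕ.* w ℕ.≤ p → In p w (- y) → In p w (- y + + w + + w) → ⊥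
      apart 8w≤p (in-interval e e<w u≡e) (in-interval f f<w t≡f) = clash
        (ℕ.<-≤-trans (ℕ.+-monoˡ-< w (ℕ.+-monoˡ-< w e<w)) (ℕ.≤-trans (ℕ.≤-reflexive (lem w)) (scale {p} {w} 3 8w≤p (s≤s (s≤s (s≤s z≤n))))))
        (ℕ.<-≤-trans f<w (ℕ.≤-trans (ℕ.≤-reflexive (sym (ℕ.*-identityˡ w))) (scale {p} {w} 1 8w≤p (s≤s z≤n))))
        (ℕ.<-≤-trans f<w (ℕ.m≤n+m w (e ℕ.+ w)))
        (Cong-+ (Cong-+ (Cong-sym u≡e) (Cong-refl {a = + w})) (Cong-refl {a = + w}) ∙ t≡f)
        where
        lem : ∀ w → w ℕ.+ w ℕ.+ w ≡ 3 ℕ.* w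
        lem = ℕ-solve-∀
      go : ∀ ℓ → 8 ℕ.* w ℕ.≤ p → (A : Dec (In p w (- y))) (B : Dec (In p w (- y + + w))) → In p w (- y + rank ℓ * + w) → labelOf A B ≡ ℓ
      go ℓ₀ h (yes a) b       i = refl
      go ℓ₀ h (no ¬a) b       i = contradiction (sub (zero-shift y (+ w)) i) ¬a
      go ℓ₁ h (yes a) b       i = contradiction (sub (one-shift y (+ w)) i) (disjoint₁ _ h a)
      go ℓ₁ h (no ¬a) (yes b) i = refl
      go ℓ₁ h (no ¬a) (no ¬b) i = contradiction (sub (one-shift y (+ w)) i) ¬b
      go ℓ₂ h (yes a) b       i = contradiction (sub (two-shift y (+ w)) i) (apart h a)
      go ℓ₂ h (no ¬a) (yes b) i = contradiction (sub (two-shift y (+ w)) i) (disjoint₁ _ h b)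
      go ℓ₂ h (no ¬a) (no ¬b) i = refl

    go-active : ∀ {m} w i b v y z → Cong m (w * i) 1ℤ →
      Cong m (w * (b - y + - (i * z)) + (w + v) * b + z) (- (w * y) + (w + w + v) * b)
    go-active w i b v y z wi≡1 = Cong-trans (≡⇒Cong (lem w i b v y z))
      (Cong-trans {b = - (w * y) + (w + w + v) * b + z * (1ℤ - 1ℤ)} (tail (- (w * y) + (w + w + v) * b)) (≡⇒Cong (lem′ (- (w * y) + (w + w + v) * b) z)))
      where
      tail : ∀ u → Cong _ (u + z * (1ℤ - w * i)) (u + z * (1ℤ - 1ℤ))
      tail u = Cong-+ˡ u (Cong-*ˡ z (Cong-- (Cong-refl {a = 1ℤ}) wi≡1))
      lem : ∀ w i b v y z → w * (b - y + - (i * z)) + (w + v) * b + z ≡ - (w * y) + (w + w + v) * b + z * (1ℤ - w * i)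
      lem = solve-∀
      lem′ : ∀ u z → u + z * (1ℤ - 1ℤ) ≡ u
      lem′ = solve-∀

    go-passive : ∀ {m} b v y z t → Cong m (0ℤ * (b - y + t) + (0ℤ + v) * b + z) (v * b + z)
    go-passive b v y z t = ≡⇒Cong (lem b v y z t)
      where
      lem : ∀ b v y z t → 0ℤ * (b - y + t) + (0ℤ + v) * b + z ≡ v * b + z
      lem = solve-∀

    cases : ∀ {m} {X Y : Set} (N₁ : Dec X) (N₂ : Dec Y) (f : ℤ → ℤ) {A₁ A₂ A₃ u₁ u₂ u₃} →
      Cong m (f A₁) u₁ → Cong m (f A₂) u₂ → Cong m (f A₃) u₃ →
      Cong m (f (decide N₁ (decide N₂ A₁ A₂) A₃)) (decide N₁ (decide N₂ u₁ u₂) u₃)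
    cases (yes _) (yes _) f h₁ h₂ h₃ = h₁
    cases (yes _) (no _)  f h₁ h₂ h₃ = h₂
    cases (no _)  _       f h₁ h₂ h₃ = h₃

  Out : ℕ → ℕ → ℤ → Set
  Out p w u = Σ ℕ λ e → e ℕ.< p ℕ.∸ w × Cong p u (+ (w ℕ.+ e))

  abstract
    in-or-out : ∀ p w .{{_ : NonZero p}} → w ℕ.≤ p → ∀ u → In p w u ⊎ Out p w u
    in-or-out p w w≤p u with residue p u
    ... | r , r<p , u≡r with r ℕ.<? w
    ...   | yes r<w = inj₁ (in-interval r r<w u≡r)
    ...   | no  r≮w = inj₂ (r ℕ.∸ w , ℕ.∸-monoˡ-< r<p (ℕ.≮⇒≥ r≮w) , u≡r ∙ ≡⇒Cong (cong +_ (sym (ℕ.m+[n∸m]≡n (ℕ.≮⇒≥ r≮w)))))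

  Size-In : ∀ {p w} K → Size p (λ z → In p w (z - K)) w
  Size-In K = record
    { code  = In.e
    ; code< = In.e<w
    ; inj   = λ { {z} {z′} (in-interval e _ u≡e) (in-interval _ _ u′≡e) refl →
        ≡⇒Cong (shift z K) ∙ Cong-+ (u≡e ∙ Cong-sym u′≡e) (Cong-refl {a = K}) ∙ ≡⇒Cong (sym (shift z′ K)) } }
    where
    shift : ∀ z K → z ≡ z - K + K
    shift = solve-∀

  Size-Out : ∀ {p w} K → Size p (λ z → Out p w (z - K)) (p ℕ.∸ w)
  Size-Out K = record
    { code  = proj₁
    ; code< = λ o → proj₁ (proj₂ o)
    ; inj   = λ { {z} {z′} (e , _ , u≡e) (_ , _ , u′≡e) refl →
        ≡⇒Cong (shift z K) ∙ Cong-+ (u≡e ∙ Cong-sym u′≡e) (Cong-refl {a = K}) ∙ ≡⇒Cong (sym (shift z′ K)) } }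
    where
    shift : ∀ z K → z ≡ z - K + K
    shift = solve-∀

-- Two opposite edges with a pendant edge: the cover

module PendantSolvable where

  open Pendant
  open Congruence
  open Block
  open Transform
  open import Data.Integer.Base using (-_; _+_; _*_; _-_)

  private
    density : ∀ T D r size rest → T ≡ suc D → r ≡ size ℕ.+ rest → r ℕ.≤ T ℕ.* rest → size ℕ.* T ℕ.≤ D ℕ.* r
    density T D r size rest refl refl r≤ = ℕ.+-cancelˡ-≤ (size ℕ.+ rest) _ _ (begin
      size ℕ.+ rest ℕ.+ size ℕ.* suc D              ≤⟨ ℕ.+-monoˡ-≤ _ r≤ ⟩
      suc D ℕ.* rest ℕ.+ size ℕ.* suc D             ≡⟨ lem D size rest ⟩
      size ℕ.+ rest ℕ.+ D ℕ.* (size ℕ.+ rest)       ∎)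
      where
      open ℕ.≤-Reasoning
      lem : ∀ D s r → suc D ℕ.* r ℕ.+ s ℕ.* suc D ≡ s ℕ.+ r ℕ.+ D ℕ.* (s ℕ.+ r)
      lem = ℕ-solve-∀

    shifted : ∀ {m a b} K → Cong m a b → Cong m (a - K) (b - K)
    shifted K a≡b = Cong-- a≡b (Cong-refl {a = K})

    Out-resp : ∀ {p w u v} → Cong p u v → Out p w v → Out p w u
    Out-resp u≡v (e , e< , v≡e) = e , e< , u≡v ∙ v≡e

    first : ∀ y v z r → 1ℤ * (0ℤ - y + (r - z)) + (1ℤ + v) * 0ℤ + z ≡ - y + r
    first = solve-∀

    -- After subtraction of `K` the values avoid the box of classes lying in [0 , w i) modulo all
    -- three primes. Modulo p₀ the value is - y plus the announced label: if it lies in the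
    -- interval, vertex 1 has guessed the label correctly, and `endgame` excludes one of the other
    -- two primes. As p ≤ 16 w, the box has density at least 1 / 16³ = 1 / 4096.
    pendant-cover : ∀ c d → c 1F ≡ c 2F + d 1F → ∀ M → Σ (Cover (pendant c d) M) λ C → B C ℕ.* 4096 ℕ.≤ 4095 ℕ.* ∣ C ∣ₘ
    pendant-cover c d c₁≡ M = record
      { P = P.primeList ; σ = proj₁ (glue P σ) ; Bad = Bad ; resp = resp ; B = size ; size = Bad-size ; catch = catch } , dense
      where
      family = primeFamily (M ℕ.⊔ 8) 3
      module Q = PrimeFamily (proj₁ family)
      P : PrimeFamily M 3
      P = record { p = Q.p ; prime = Q.prime ; p-inj = Q.p-inj ; above = λ i → ℕ.≤-<-trans (ℕ.m≤m⊔n M 8) (Q.above i) }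
      module P = PrimeFamily P
      p = P.p
      instance
        p≢0 : ∀ {i} → NonZero (p i)
        p≢0 {i} = prime⇒nonZero (Q.prime i)
      widths = λ i → width (p i) (ℕ.<⇒≤ (ℕ.≤-<-trans (ℕ.m≤n⊔m M 8) (Q.above i)))
      w : Fin 3 → ℕ
      w i = proj₁ (widths i)
      1≤w = λ i → proj₁ (proj₂ (widths i))
      8w≤p = λ i → proj₁ (proj₂ (proj₂ (widths i)))
      p≤16w = λ i → proj₂ (proj₂ (proj₂ (widths i)))
      w≤p : ∀ i → w i ℕ.≤ p i
      w≤p i = ℕ.≤-trans (ℕ.m≤n*m (w i) 8) (8w≤p i)
      kw≤p : ∀ i k → k ℕ.≤ 8 → k ℕ.* w i ℕ.≤ p i
      kw≤p i k = scale {p i} {w i} k (8w≤p i)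
      2w≤p : ∀ i → w i ℕ.+ w i ℕ.≤ p i
      2w≤p i = subst (ℕ._≤ p i) (cong (w i ℕ.+_) (ℕ.+-identityʳ (w i))) (kw≤p i 2 (s≤s (s≤s z≤n)))
      3w≤p : ∀ i → 3 ℕ.* w i ℕ.≤ p i
      3w≤p i = kw≤p i 3 (s≤s (s≤s (s≤s z≤n)))
      w<p : ∀ i → w i ℕ.< p i
      w<p i = ℕ.<-≤-trans (ℕ.m<m+n (w i) (1≤w i)) (2w≤p i)
      invs = λ i → inverse (coprime-prime {{ℕ.>-nonZero (1≤w i)}} (Q.prime i) (w<p i))
      K = - (c 2F) * (c 0F - d 0F) - d 1F * d 0F
      v y z : ℤ → ℤ
      v x₀ = x₀ + d 1F - c 2F
      y x₁ = x₁ + d 0F + d 0F - c 0F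
      z x₂ = d 2F * x₂
      A? = λ x₂ → In? (p 1F) (w 1F) (w≤p 1F) (z x₂)
      B? = λ x₂ → In? (p 2F) (w 2F) (w≤p 2F) (z x₂)
      said guessed : ℤ → Label
      said x₂ = labelOf (A? x₂) (B? x₂)
      G₀? = λ x₁ → In? (p 0F) (w 0F) (w≤p 0F) (- y x₁)
      G₁? = λ x₁ → In? (p 0F) (w 0F) (w≤p 0F) (- y x₁ + + w 0F)
      guessed x₁ = labelOf (G₀? x₁) (G₁? x₁)
      D₁? = λ x₁ → In? (p 1F) (3 ℕ.* w 1F) (3w≤p 1F) (- (+ w 1F * y x₁) + + w 1F + + w 1F + + w 1F)
      D₂? = λ x₁ → In? (p 2F) (w 2F) (w≤p 2F) (- (+ w 2F * y x₁))
      N₁? = λ x₀ → In? (p 1F) (w 1F ℕ.+ w 1F) (2w≤p 1F) (v x₀ + + w 1F)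
      N₂? = λ x₀ → In? (p 2F) (w 2F ℕ.+ w 2F) (2w≤p 2F) (+ w 2F + + w 2F + v x₀ + + w 2F)
      b₁ b₂ A₁ A₂ : ℤ → ℤ
      b₁ x₁ = move₁ (guessed x₁) (D₁? x₁)
      b₂ x₁ = move₂ (guessed x₁) (D₂? x₁)
      A₁ x₀ = decide (N₁? x₀) (decide (N₂? x₀) (+ w 1F) 0ℤ) 0ℤ
      A₂ x₀ = decide (N₁? x₀) (decide (N₂? x₀) 0ℤ (+ w 2F)) 0ℤ
      σ : Fin 3 → Strategy 3
      -- Modulo p₀ one has A = 1 and b = 0: v drops out and vertex 2 is free to announce its label.
      σ 0F 0F x = 1ℤ - c 2F
      σ 0F 1F x = 0ℤ - d 0F - x
      σ 0F 2F x = rank (said x) * + w 0F - z x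
      σ 1F 0F x = A₁ x - c 2F
      σ 1F 1F x = b₁ x - d 0F - x
      σ 1F 2F x = - (proj₁ (invs 1F) * z x)
      σ 2F 0F x = A₂ x - c 2F
      σ 2F 1F x = b₂ x - d 0F - x
      σ 2F 2F x = - (proj₁ (invs 2F) * z x)
      -- The complement of the box is cut up by the first prime at which the interval is left, so
      -- that the sizes add up to the exact complement.
      S₀ S₁ S₂ Bad : ℤ → Set
      S₀ u = Out (p 0F) (w 0F) (u - K) × ⊤
      S₁ u = In (p 0F) (w 0F) (u - K) × Out (p 1F) (w 1F) (u - K) × ⊤
      S₂ u = In (p 0F) (w 0F) (u - K) × In (p 1F) (w 1F) (u - K) × Out (p 2F) (w 2F) (u - K) × ⊤
      Bad u = S₀ u ⊎ S₁ u ⊎ S₂ u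
      h : Fin 3 → ℕ
      h i = p i ℕ.∸ w i
      size = h 0F ℕ.* (p 1F ℕ.* (p 2F ℕ.* 1)) ℕ.+ (w 0F ℕ.* (h 1F ℕ.* (p 2F ℕ.* 1)) ℕ.+ w 0F ℕ.* (w 1F ℕ.* (h 2F ℕ.* 1)))
      cop₂ : Coprime (p 2F) 1
      cop₂ = coprime-∏ {p 2F} {0} (λ ()) (λ ())
      cop₁ : Coprime (p 1F) (p 2F ℕ.* 1)
      cop₁ = coprime-* (P.coprime 1F 2F λ ()) (coprime-∏ {p 1F} {0} (λ ()) (λ ()))
      cop₀ : Coprime (p 0F) (p 1F ℕ.* (p 2F ℕ.* 1))
      cop₀ = coprime-* (P.coprime 0F 1F λ ()) (coprime-* (P.coprime 0F 2F λ ()) (coprime-∏ {p 0F} {0} (λ ()) (λ ())))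
      Bad-size : Size (∏ p) Bad size
      Bad-size = Size-⊎ (Size-× cop₀ (Size-Out K) (Size-all (p 1F ℕ.* (p 2F ℕ.* 1)) {{ℕ.m*n≢0 (p 1F) _ {{p≢0}} {{ℕ.m*n≢0 (p 2F) 1 {{p≢0}}}}}}))
        (Size-⊎ (Size-× cop₀ (Size-In K) (Size-× cop₁ (Size-Out K) (Size-all (p 2F ℕ.* 1) {{ℕ.m*n≢0 (p 2F) 1 {{p≢0}}}})))
                (Size-× cop₀ (Size-In K) (Size-× cop₁ (Size-In K) (Size-× cop₂ (Size-Out K) (Size-all 1)))))
      resp : ∀ {t u} → Cong (∏ p) t u → Bad t → Bad u
      resp {t} {u} t≡u = λ { (inj₁ (o , _)) → inj₁ (out 0F o , tt)
                   ; (inj₂ (inj₁ (i , o , _))) → inj₂ (inj₁ (inn 0F i , out 1F o , tt))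
                   ; (inj₂ (inj₂ (i , j , o , _))) → inj₂ (inj₂ (inn 0F i , inn 1F j , out 2F o , tt)) }
        where
        at : ∀ i → Cong (p i) (u - K) (t - K)
        at i = shifted K (Cong-sym (Cong-∏⇒ p t≡u i))
        inn : ∀ i → In (p i) (w i) (t - K) → In (p i) (w i) (u - K)
        inn i = In-resp (at i)
        out : ∀ i → Out (p i) (w i) (t - K) → Out (p i) (w i) (u - K)
        out i = Out-resp (at i)
      U₀ : (Fin 3 → ℤ) → ℤ
      U₀ x = - y (x 1F) + rank (said (x 2F)) * + w 0F
      U₁ U₂ : Label → (Fin 3 → ℤ) → ℤ
      U₁ ℓ x = let b = move₁ ℓ (D₁? (x 1F)) in
        decide (N₁? (x 0F)) (decide (N₂? (x 0F)) (active (w 1F) (v (x 0F)) (y (x 1F)) b) (passive (v (x 0F)) (z (x 2F)) b)) (passive (v (x 0F)) (z (x 2F)) b)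
      U₂ ℓ x = let b = move₂ ℓ (D₂? (x 1F)) in
        decide (N₁? (x 0F)) (decide (N₂? (x 0F)) (passive (v (x 0F)) (z (x 2F)) b) (active (w 2F) (v (x 0F)) (y (x 1F)) b)) (passive (v (x 0F)) (z (x 2F)) b)
      reduced₀ : ∀ x → Cong (p 0F) (⟦ pendant c d ⟧ (σ 0F ⟨ x ⟩) x - K) (U₀ x)
      reduced₀ x = ≡⇒Cong (trans (value c d (σ 0F ⟨ x ⟩) x {1ℤ} {0ℤ} {rank (said (x 2F)) * + w 0F - z (x 2F)} {v (x 0F)} {y (x 1F)} {z (x 2F)} c₁≡ refl refl refl refl refl refl refl)
        (first (y (x 1F)) (v (x 0F)) (z (x 2F)) (rank (said (x 2F)) * + w 0F)))
      reduced₁ : ∀ x → Cong (p 1F) (⟦ pendant c d ⟧ (σ 1F ⟨ x ⟩) x - K) (U₁ (guessed (x 1F)) x)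
      reduced₁ x = Cong-trans (≡⇒Cong (value c d (σ 1F ⟨ x ⟩) x {A₁ (x 0F)} {b} {t = - (i * z′)} {v′} {y′} {z′} c₁≡ refl refl refl refl refl refl refl))
        (cases (N₁? (x 0F)) (N₂? (x 0F)) (λ A → A * (b - y′ + - (i * z′)) + (A + v′) * b + z′)
          (go-active (+ w 1F) i b v′ y′ z′ (proj₂ (invs 1F))) (go-passive b v′ y′ z′ (- (i * z′))) (go-passive b v′ y′ z′ (- (i * z′))))
        where
        b = b₁ (x 1F)
        i = proj₁ (invs 1F)
        v′ = v (x 0F)
        y′ = y (x 1F)
        z′ = z (x 2F)
      reduced₂ : ∀ x → Cong (p 2F) (⟦ pendant c d ⟧ (σ 2F ⟨ x ⟩) x - K) (U₂ (guessed (x 1F)) x)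
      reduced₂ x = Cong-trans (≡⇒Cong (value c d (σ 2F ⟨ x ⟩) x {A₂ (x 0F)} {b} {t = - (i * z′)} {v′} {y′} {z′} c₁≡ refl refl refl refl refl refl refl))
        (cases (N₁? (x 0F)) (N₂? (x 0F)) (λ A → A * (b - y′ + - (i * z′)) + (A + v′) * b + z′)
          (go-passive b v′ y′ z′ (- (i * z′))) (go-active (+ w 2F) i b v′ y′ z′ (proj₂ (invs 2F))) (go-passive b v′ y′ z′ (- (i * z′))))
        where
        b = b₂ (x 1F)
        i = proj₁ (invs 2F)
        v′ = v (x 0F)
        y′ = y (x 1F)
        z′ = z (x 2F)
      τ = proj₁ (glue P σ)
      val : (Fin 3 → ℤ) → ℤ
      val x = ⟦ pendant c d ⟧ (τ ⟨ x ⟩) x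
      glued : ∀ x i → Cong (p i) (val x - K) (⟦ pendant c d ⟧ (σ i ⟨ x ⟩) x - K)
      glued x i = shifted K (proj₂ (glue P σ) (pendant c d) x i)
      never : ∀ x → In (p 0F) (w 0F) (val x - K) → In (p 1F) (w 1F) (val x - K) → In (p 2F) (w 2F) (val x - K) → ⊥
      never x i₀ i₁ i₂ = endgame (v (x 0F)) (y (x 1F)) (z (x 2F)) (said (x 2F)) (1≤w 1F) (8w≤p 1F) (1≤w 2F) (8w≤p 2F)
        (labels (A? (x 2F)) (B? (x 2F))) (D₁? (x 1F)) (D₂? (x 1F)) (N₁? (x 0F)) (N₂? (x 0F))
        (subst (λ ℓ → In (p 1F) (w 1F) (U₁ ℓ x)) agree (In-resp (Cong-sym (Cong-trans (glued x 1F) (reduced₁ x))) i₁))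
        (subst (λ ℓ → In (p 2F) (w 2F) (U₂ ℓ x)) agree (In-resp (Cong-sym (Cong-trans (glued x 2F) (reduced₂ x))) i₂))
        where
        agree : guessed (x 1F) ≡ said (x 2F)
        agree = recover (y (x 1F)) (said (x 2F)) (8w≤p 0F) (G₀? (x 1F)) (G₁? (x 1F)) (In-resp (Cong-sym (Cong-trans (glued x 0F) (reduced₀ x))) i₀)
      sort : ∀ u → ¬ (In (p 0F) (w 0F) (u - K) × In (p 1F) (w 1F) (u - K) × In (p 2F) (w 2F) (u - K)) →
        In (p 0F) (w 0F) (u - K) ⊎ Out (p 0F) (w 0F) (u - K) → In (p 1F) (w 1F) (u - K) ⊎ Out (p 1F) (w 1F) (u - K) →
        In (p 2F) (w 2F) (u - K) ⊎ Out (p 2F) (w 2F) (u - K) → Bad u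
      sort u ¬all (inj₂ o) _        _        = inj₁ (o , tt)
      sort u ¬all (inj₁ i) (inj₂ o) _        = inj₂ (inj₁ (i , o , tt))
      sort u ¬all (inj₁ i) (inj₁ j) (inj₂ o) = inj₂ (inj₂ (i , j , o , tt))
      sort u ¬all (inj₁ i) (inj₁ j) (inj₁ k) = contradiction (i , j , k) ¬all
      split : ∀ u i → In (p i) (w i) (u - K) ⊎ Out (p i) (w i) (u - K)
      split u i = in-or-out (p i) (w i) (w≤p i) (u - K)
      catch : ∀ x → Bad (val x)
      catch x = sort (val x) (λ (i₀ , i₁ , i₂) → never x i₀ i₁ i₂) (split (val x) 0F) (split (val x) 1F) (split (val x) 2F)
      dense : size ℕ.* 4096 ℕ.≤ 4095 ℕ.* ∏ p
      dense = density 4096 4095 (∏ p) size (w 0F ℕ.* (w 1F ℕ.* w 2F)) refl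
        (trans (cong₂ (λ a b → a ℕ.* (b ℕ.* (p 2F ℕ.* 1))) (whole 0F) (whole 1F)) (trans (cong (λ a → (w 0F ℕ.+ h 0F) ℕ.* ((w 1F ℕ.+ h 1F) ℕ.* (a ℕ.* 1))) (whole 2F))
          (trans (lem (w 0F) (h 0F) (w 1F) (h 1F) (w 2F) (h 2F))
            (cong₂ (λ a b → h 0F ℕ.* (a ℕ.* (b ℕ.* 1)) ℕ.+ (w 0F ℕ.* (h 1F ℕ.* (b ℕ.* 1)) ℕ.+ w 0F ℕ.* (w 1F ℕ.* (h 2F ℕ.* 1))) ℕ.+ w 0F ℕ.* (w 1F ℕ.* w 2F)) (sym (whole 1F)) (sym (whole 2F))))))
        (ℕ.≤-trans (ℕ.*-mono-≤ (p≤16w 0F) (ℕ.*-mono-≤ (p≤16w 1F) (ℕ.*-monoˡ-≤ 1 (p≤16w 2F)))) (ℕ.≤-reflexive (lem′ 16 (w 0F) (w 1F) (w 2F))))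
        where
        whole : ∀ i → p i ≡ w i ℕ.+ h i
        whole i = sym (ℕ.m+[n∸m]≡n (w≤p i))
        lem : ∀ a b c d e f → (a ℕ.+ b) ℕ.* ((c ℕ.+ d) ℕ.* ((e ℕ.+ f) ℕ.* 1)) ≡
          b ℕ.* ((c ℕ.+ d) ℕ.* ((e ℕ.+ f) ℕ.* 1)) ℕ.+ (a ℕ.* (d ℕ.* ((e ℕ.+ f) ℕ.* 1)) ℕ.+ a ℕ.* (c ℕ.* (f ℕ.* 1))) ℕ.+ a ℕ.* (c ℕ.* e)
        lem = ℕ-solve-∀
        lem′ : ∀ k a b c → k ℕ.* a ℕ.* (k ℕ.* b ℕ.* (k ℕ.* c ℕ.* 1)) ≡ k ℕ.* (k ℕ.* k) ℕ.* (a ℕ.* (b ℕ.* c))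
        lem′ = ℕ-solve-∀

  pendant-solvable : ∀ c d → c 1F ≡ c 2F + d 1F → Solvable (pendant c d)
  pendant-solvable c d c₁≡ = amplify 4095 (pendant-cover c d c₁≡)

-- Forms that a strategy makes constant

module Exact where

  open Congruence
  open Block
  open Transform
  open Triangle using (linear; triple)
  open Pendant using (pendant)
  open import Data.Integer.Base using (-_; _+_; _*_; _-_; ∣_∣)

  substitute : ∀ {k n} → Form k → (Fin k → Form n) → (Fin k → Form n) → Form n
  substitute (el v)  e f = e v
  substitute (df v)  e f = f v
  substitute (con c) e f = con c
  substitute (F ⊕ G) e f = substitute F e f ⊕ substitute G e f
  substitute (F ⊗ G) e f = substitute F e f ⊗ substitute G e f
  substitute (sm F)  e f = sm (λ i → substitute (F i) e f)

  ⟦substitute⟧ : ∀ {k n} (F : Form k) (e f : Fin k → Form n) a x →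
    ⟦ substitute F e f ⟧ a x ≡ ⟦ F ⟧ (λ i → ⟦ e i ⟧ a x) (λ i → ⟦ f i ⟧ a x)
  ⟦substitute⟧ (el v)  e f a x = refl
  ⟦substitute⟧ (df v)  e f a x = refl
  ⟦substitute⟧ (con c) e f a x = refl
  ⟦substitute⟧ (F ⊕ G) e f a x = cong₂ _+_ (⟦substitute⟧ F e f a x) (⟦substitute⟧ G e f a x)
  ⟦substitute⟧ (F ⊗ G) e f a x = cong₂ _*_ (⟦substitute⟧ F e f a x) (⟦substitute⟧ G e f a x)
  ⟦substitute⟧ (sm F)  e f a x = ∑-cong (λ i → ⟦substitute⟧ (F i) e f a x)

  flipped-el flipped-df : ∀ {n} → Bool → Fin n → Form n
  flipped-el b v = if b then el v ⊕ df v else el v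
  flipped-df b v = if b then con (- 1ℤ) ⊗ df v else df v

  ⟦flipped-el⟧ : ∀ {n} b (v : Fin n) a x → ⟦ flipped-el b v ⟧ a x ≡ flip-el b (a v) (x v)
  ⟦flipped-el⟧ true  v a x = refl
  ⟦flipped-el⟧ false v a x = refl

  ⟦flipped-df⟧ : ∀ {n} b (v : Fin n) a x → ⟦ flipped-df b v ⟧ a x ≡ flip-df b (x v)
  ⟦flipped-df⟧ true  v a x = lem (x v)
    where lem : ∀ y → - 1ℤ * y ≡ - y
          lem = solve-∀
  ⟦flipped-df⟧ false v a x = refl

  place : ∀ {k n} → Form k → (Fin k → Fin n) → (Fin k → Bool) → Form n
  place F ι φ = substitute F (λ i → flipped-el (φ i) (ι i)) (λ i → flipped-df (φ i) (ι i))

  ⟦place⟧ : ∀ {k n} (F : Form k) (ι : Fin k → Fin n) φ a x →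
    ⟦ place F ι φ ⟧ a x ≡ ⟦ F ⟧ (λ i → flip-el (φ i) (a (ι i)) (x (ι i))) (λ i → flip-df (φ i) (x (ι i)))
  ⟦place⟧ F ι φ a x = trans (⟦substitute⟧ F _ _ a x)
    (⟦⟧-cong F (λ i → ⟦flipped-el⟧ (φ i) (ι i) a x) (λ i → ⟦flipped-df⟧ (φ i) (ι i) a x))

  total : ∀ {n} → (Fin n → ℕ) → ℕ
  total {zero}  f = 0
  total {suc n} f = f zero ℕ.+ total (f ∘ suc)

  ≤-total : ∀ {n} (f : Fin n → ℕ) v → f v ℕ.≤ total f
  ≤-total f zero    = ℕ.m≤m+n _ _
  ≤-total f (suc v) = ℕ.≤-trans (≤-total (f ∘ suc) v) (ℕ.m≤n+m _ _)

  Avoids : ∀ {k n} → (Fin k → Fin n) → (c : Fin n → ℕ) → Set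
  Avoids ι c = ∀ i → c (ι i) ≡ 0

  linearPart : ∀ {n} → (Fin n → ℕ) → (Fin n → ℕ) → Form n
  linearPart c d = sm (linear (+_ ∘ c) (+_ ∘ d))

  -- Variables that occur only linearly can be made to vanish identically.
  extend : ∀ {k n} {T : Form k} {F : Form n} (ι : Fin k → Fin n) → (∀ {i j} → ι i ≡ ι j → i ≡ j) → (φ : Fin k → Bool) →
    (c d : Fin n → ℕ) → (∀ v → d v ℕ.≤ c v) → Avoids ι c →
    (∀ a x → ⟦ F ⟧ a x ≡ ⟦ place T ι φ ⟧ a x + ⟦ linearPart c d ⟧ a x) → Solvable T → Solvable F
  extend {k} {n} {T} {F} ι ι-inj φ c d d≤c avoids split s =
    kill {F = F} {place T ι φ} {linearPart c d} K split indep (total c) exact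
      (embed {F = T} {place T ι φ} ι ι-inj φ (⟦place⟧ T ι φ) s)
    where
    image? : ∀ v → Dec (Σ (Fin k) λ i → ι i ≡ v)
    image? v = Fin.any? (λ i → ι i Fin.≟ v)
    outside : ∀ {v} → Dec (Σ (Fin k) λ i → ι i ≡ v) → Bool
    outside (yes _) = false
    outside (no _)  = true
    K : Fin n → Bool
    K v = outside (image? v)
    K-ι : ∀ i → K (ι i) ≡ false
    K-ι i with image? (ι i)
    ... | yes _ = refl
    ... | no ¬e = contradiction (i , refl) ¬e
    indep : ∀ {a a′} x → (∀ v → K v ≡ false → a v ≡ a′ v) → ⟦ place T ι φ ⟧ a x ≡ ⟦ place T ι φ ⟧ a′ x
    indep {a} {a′} x h = trans (⟦place⟧ T ι φ a x) (trans (⟦⟧-cong T (λ i → cong (λ y → flip-el (φ i) y (x (ι i))) (h (ι i) (K-ι i))) (λ _ → refl)) (sym (⟦place⟧ T ι φ a′ x)))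
    exact : (P : PrimeList (total c)) → Σ (Strategy n) λ τ → Σ ℤ λ κ → ∀ a x →
      (∀ v → K v ≡ true → a v ≡ τ v (x v)) → Cong (modulus P) (⟦ linearPart c d ⟧ a x) κ
    exact P = τ , ∑ {n} (λ _ → 0ℤ) , λ a x h → Cong-∑ (λ v → term v (a v) (x v) (image? v) (h v))
      where
      inv : ∀ v → Dec (c v ≡ 0) → ℤ
      inv v (yes _) = 0ℤ
      inv v (no c≢0) = proj₁ (inverse (PrimeList.coprime-modulus P {c v} {{ℕ.≢-nonZero c≢0}} (≤-total c v)))
      τ : Strategy n
      τ v y = - (inv v (c v ℕ.≟ 0) * (+ d v * y))
      no-terms : ∀ u y → 0ℤ * u + 0ℤ * y ≡ 0ℤ
      no-terms = solve-∀
      none : ∀ v u y → c v ≡ 0 → + c v * u + + d v * y ≡ 0ℤ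
      none v u y c≡0 = trans (cong₂ (λ c d → + c * u + + d * y) c≡0 (ℕ.n≤0⇒n≡0 (ℕ.≤-trans (d≤c v) (ℕ.≤-reflexive c≡0)))) (no-terms u y)
      cancel : ∀ c i y → c * - (i * y) + y ≡ y * (1ℤ - c * i)
      cancel = solve-∀
      zero-term : ∀ y → y * (1ℤ - 1ℤ) ≡ 0ℤ
      zero-term = solve-∀
      occurs : ∀ v u y (D : Dec (c v ≡ 0)) → u ≡ - (inv v D * (+ d v * y)) → Cong (modulus P) (+ c v * u + + d v * y) 0ℤ
      occurs v u y (yes c≡0) e = ≡⇒Cong (none v u y c≡0)
      occurs v u y (no c≢0)  e = Cong-trans (≡⇒Cong (trans (cong (λ u → + c v * u + + d v * y) e) (cancel (+ c v) _ (+ d v * y))))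
        (Cong-trans (Cong-*ˡ (+ d v * y) (Cong-- (Cong-refl {a = 1ℤ}) (proj₂ (inverse (PrimeList.coprime-modulus P {c v} {{ℕ.≢-nonZero c≢0}} (≤-total c v))))))
          (≡⇒Cong (zero-term (+ d v * y))))
      term : ∀ v u y (D : Dec (Σ (Fin k) λ i → ι i ≡ v)) → (outside D ≡ true → u ≡ τ v y) → Cong (modulus P) (+ c v * u + + d v * y) 0ℤ
      term v u y (yes (i , refl)) h = ≡⇒Cong (none v u y (avoids i))
      term v u y (no _)           h = occurs v u y (c v ℕ.≟ 0) (h refl)

  Exact : ∀ {n} → Form n → Set
  Exact {n} F = Σ ℕ λ M → (P : PrimeList M) → Σ (Strategy n) λ τ → Σ ℤ λ κ → ∀ x → Cong (modulus P) (⟦ F ⟧ (τ ⟨ x ⟩) x) κ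

  -- There is a single bad class, so one prime above `E` is enough.
  exact⇒solvable : ∀ {n} {F : Form n} → Exact F → Solvable F
  exact⇒solvable {n} {F} (M₀ , exact) M E = record
    { P = P ; σ = proj₁ τκ ; Bad = λ z → Cong (modulus P) z κ ; resp = λ z≡z′ b → Cong-sym z≡z′ ∙ b ; B = 1
    ; size = record { code = λ _ → 0 ; code< = λ _ → s≤s z≤n ; inj = λ b b′ _ → b ∙ Cong-sym b′ }
    ; catch = proj₂ (proj₂ τκ)
    } , ℕ.≤-trans (ℕ.≤-reflexive (ℕ.*-identityˡ E)) (ℕ.≤-trans (ℕ.<⇒≤ E<p) (ℕ.≤-reflexive (sym (ℕ.*-identityʳ _))))
    where
    family = primeFamily (E ℕ.⊔ (M ℕ.⊔ M₀)) 1
    Q = PrimeFamily.primeList (proj₁ family)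
    P = weaken (ℕ.≤-trans (ℕ.m≤m⊔n M M₀) (ℕ.m≤n⊔m E _)) Q
    E<p = ℕ.≤-<-trans (ℕ.m≤m⊔n E _) (PrimeFamily.above (proj₁ family) 0F)
    τκ = exact (weaken (ℕ.≤-trans (ℕ.m≤n⊔m M M₀) (ℕ.m≤n⊔m E _)) Q)
    κ = proj₁ (proj₂ τκ)

  private
    pair : ℤ → ℤ → Fin 2 → ℤ
    pair y₀ y₁ 0F = y₀
    pair y₀ y₁ 1F = y₁

  -- The three half-edges of each vertex of the triangle are distributed so that every vertex kills one edge.
  cycle : (Fin 3 → ℤ) → (Fin 3 → ℤ) → Form 3
  cycle c d = el 0F ⊗ el 1F ⊕ (el 1F ⊕ df 1F) ⊗ el 2F ⊕ (el 2F ⊕ df 2F) ⊗ (el 0F ⊕ df 0F) ⊕ (linear c d 0F ⊕ linear c d 1F ⊕ linear c d 2F)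

  cycle-exact : ∀ c d → Exact (cycle c d)
  cycle-exact c d = 0 , λ P → τ , _ , λ x → ≡⇒Cong (trans
    (⟦⟧-at (cycle c d) (τ ⟨ x ⟩) (triple (- d 2F - x 0F) (d 0F - c 0F) (- d 1F)) x (λ { 0F → refl ; 1F → refl ; 2F → refl }))
    (lem (x 0F) (x 1F) (x 2F) (c 0F) (c 1F) (c 2F) (d 0F) (d 1F) (d 2F)))
    where
    τ : Strategy 3
    τ 0F x = - d 2F - x
    τ 1F x = d 0F - c 0F
    τ 2F x = - d 1F
    lem : ∀ x₀ x₁ x₂ c₀ c₁ c₂ d₀ d₁ d₂ →
      (- d₂ - x₀) * (d₀ - c₀) + (d₀ - c₀ + x₁) * - d₁ + (- d₁ + x₂) * (- d₂ - x₀ + x₀)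
        + (c₀ * (- d₂ - x₀) + d₀ * x₀ + (c₁ * (d₀ - c₀) + d₁ * x₁) + (c₂ * - d₁ + d₂ * x₂))
      ≡ - d₂ * (d₀ - c₀) + (d₀ - c₀) * - d₁ + - d₁ * - d₂ + (c₀ * - d₂ + c₁ * (d₀ - c₀) + c₂ * - d₁)
    lem = solve-∀

  private
    inverseℤ : ∀ e → e ≢ 0ℤ → (P : PrimeList ∣ e ∣) → Σ ℤ λ i → Cong (modulus P) (e * i) 1ℤ
    inverseℤ (+ zero)    e≢0 P = contradiction refl e≢0
    inverseℤ (+ suc n)   e≢0 P = inverse (PrimeList.coprime-modulus P ℕ.≤-refl)
    inverseℤ (-[1+ n ])  e≢0 P = let (i , h) = inverse (PrimeList.coprime-modulus P {suc n} ℕ.≤-refl) in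
      - i , Cong-trans (≡⇒Cong (lem (+ suc n) i)) h
      where
      lem : ∀ e i → - e * - i ≡ e * i
      lem = solve-∀

  -- The constants a₀ = d₁ - c₁ and a₁ + x₁ = - d₀ cancel x₁ and x₀. Then a₂ has the coefficient d₁
  -- - c₁ + c₂, and cancels x₂ if this is invertible, which a nonzero integer is modulo all large
  -- primes.
  pendant-exact : ∀ c d → d 1F - c 1F + c 2F ≢ 0ℤ → Exact (pendant c d)
  pendant-exact c d e≢0 = ∣ d 1F - c 1F + c 2F ∣ , λ P → let (i , ei≡1) = inverseℤ (d 1F - c 1F + c 2F) e≢0 P in
    τ i , κ , λ x → Cong-trans (≡⇒Cong (trans
    (⟦⟧-at (pendant c d) (τ i ⟨ x ⟩) (triple (d 1F - c 1F) (- d 0F - x 1F) (- (i * (d 2F * x 2F)))) x (λ { 0F → refl ; 1F → refl ; 2F → refl }))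
    (lem i (x 0F) (x 1F) (d 2F * x 2F) (c 0F) (c 1F) (c 2F) (d 0F) (d 1F))))
    (Cong-trans {b = κ + d 2F * x 2F * (1ℤ - 1ℤ)} (Cong-+ˡ κ (Cong-*ˡ (d 2F * x 2F) (Cong-- (Cong-refl {a = 1ℤ}) ei≡1))) (≡⇒Cong (lem′ κ (d 2F * x 2F))))
    where
    κ = (d 1F - c 1F) * - d 0F + (d 1F - c 1F) * - d 0F + (c 0F * (d 1F - c 1F) + c 1F * - d 0F)
    τ : ℤ → Strategy 3
    τ i 0F x = d 1F - c 1F
    τ i 1F x = - d 0F - x
    τ i 2F x = - (i * (d 2F * x))
    lem : ∀ i x₀ x₁ z c₀ c₁ c₂ d₀ d₁ →
      (d₁ - c₁) * (- d₀ - x₁) + (d₁ - c₁ + x₀) * (- d₀ - x₁ + x₁) + (d₁ - c₁) * - (i * z)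
        + (c₀ * (d₁ - c₁) + d₀ * x₀ + (c₁ * (- d₀ - x₁) + d₁ * x₁) + (c₂ * - (i * z) + z))
      ≡ (d₁ - c₁) * - d₀ + (d₁ - c₁) * - d₀ + (c₀ * (d₁ - c₁) + c₁ * - d₀) + z * (1ℤ - (d₁ - c₁ + c₂) * i)
    lem = solve-∀
    lem′ : ∀ u z → u + z * (1ℤ - 1ℤ) ≡ u
    lem′ = solve-∀

  Slot : ℕ → Set
  Slot n = Fin n × Bool

  sl : ∀ {n} → Slot n → Form n
  sl (v , false) = el v
  sl (v , true)  = el v ⊕ df v

  twoEdges : (Fin 2 → ℤ) → (Fin 2 → ℤ) → Form 2
  twoEdges c d = el 0F ⊗ el 1F ⊕ (el 0F ⊕ df 0F) ⊗ (el 1F ⊕ df 1F) ⊕ (linear c d 0F ⊕ linear c d 1F)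

  private
    -- Holding the first element of pair 0 and the second element of pair 1 gives each of the two
    -- opposite edges a constant end.
    steady : ℤ → ℤ → Strategy 2
    steady A k 0F x = A
    steady A k 1F x = k - x

    steady-value : ∀ {m} c d A k g₀ g₁ (x : Fin 2 → ℤ) → Cong m (k + d 0F + g₀) 0ℤ → Cong m (d 1F - c 1F - A + g₁) 0ℤ →
      Cong m (⟦ twoEdges c d ⟧ (steady A k ⟨ x ⟩) x + (g₀ * x 0F + g₁ * x 1F)) (A * k + A * k + c 0F * A + c 1F * k)
    steady-value {m} c d A k g₀ g₁ x h₀ h₁ = Cong-trans (≡⇒Cong (trans
      (cong (_+ (g₀ * x 0F + g₁ * x 1F)) (⟦⟧-at (twoEdges c d) (steady A k ⟨ x ⟩) (pair A (k - x 1F)) x (λ { 0F → refl ; 1F → refl })))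
      (lem A k g₀ g₁ (x 0F) (x 1F) (c 0F) (c 1F) (d 0F) (d 1F)))) (tail (A * k + A * k + c 0F * A + c 1F * k))
      where
      lem : ∀ A k g₀ g₁ x₀ x₁ c₀ c₁ d₀ d₁ →
        A * (k - x₁) + (A + x₀) * (k - x₁ + x₁) + (c₀ * A + d₀ * x₀ + (c₁ * (k - x₁) + d₁ * x₁)) + (g₀ * x₀ + g₁ * x₁)
        ≡ A * k + A * k + c₀ * A + c₁ * k + (x₀ * (k + d₀ + g₀) + x₁ * (d₁ - c₁ - A + g₁))
      lem = solve-∀
      vanish : ∀ u x₀ x₁ → u + (x₀ * 0ℤ + x₁ * 0ℤ) ≡ u
      vanish = solve-∀
      tail : ∀ u → Cong m (u + (x 0F * (k + d 0F + g₀) + x 1F * (d 1F - c 1F - A + g₁))) u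
      tail u = Cong-trans (Cong-+ˡ u (Cong-+ (Cong-*ˡ (x 0F) h₀) (Cong-*ˡ (x 1F) h₁))) (≡⇒Cong (vanish u (x 0F) (x 1F)))

    -- The functions g₀ and g₁ give the coefficients of x₀ and x₁ that `E` contributes under the
    -- strategy. Their argument `h` is an inverse of 2: when the third edge repeats one of the
    -- opposite edges, the equation for A or k has leading coefficient 2.
    exactly : ∀ c d (E : Form 2) (A k : ℤ → ℤ) (u g₀ g₁ : ℤ → ℤ) →
      (∀ {m} h → Cong m (+ 2 * h) 1ℤ → Cong m (k h + d 0F + g₀ h) 0ℤ × Cong m (d 1F - c 1F - A h + g₁ h) 0ℤ) →
      (∀ h x → ⟦ E ⟧ (steady (A h) (k h) ⟨ x ⟩) x ≡ u h + (g₀ h * x 0F + g₁ h * x 1F)) →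
      Solvable (twoEdges c d ⊕ E)
    exactly c d E A k u g₀ g₁ hk hE = exact⇒solvable {F = twoEdges c d ⊕ E} (2 , λ P →
      let (h , 2h≡1) = inverse (PrimeList.coprime-modulus P {2} ℕ.≤-refl) in
      steady (A h) (k h) , A h * k h + A h * k h + c 0F * A h + c 1F * k h + u h , λ x →
      regroup (⟦ twoEdges c d ⟧ (steady (A h) (k h) ⟨ x ⟩) x) (u h) (g₀ h * x 0F + g₁ h * x 1F) (hE h x)
        (steady-value c d (A h) (k h) (g₀ h) (g₁ h) x (proj₁ (hk h 2h≡1)) (proj₂ (hk h 2h≡1))))
      where
      assoc : ∀ w u g → w + (u + g) ≡ w + g + u
      assoc = solve-∀
      regroup : ∀ {m} w u g {e κ} → e ≡ u + g → Cong m (w + g) κ → Cong m (w + e) (κ + u)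
      regroup w u g e≡ h = Cong-trans (≡⇒Cong (trans (cong (λ e → w + e) e≡) (assoc w u g))) (Cong-+ h (Cong-refl {a = u}))

    plain₀ : ∀ {m} a → Cong m (- a + a + 0ℤ) 0ℤ
    plain₀ a = ≡⇒Cong (lem a)
      where lem : ∀ a → - a + a + 0ℤ ≡ 0ℤ
            lem = solve-∀

    plain₁ : ∀ {m} a → Cong m (a - a + 0ℤ) 0ℤ
    plain₁ a = ≡⇒Cong (lem a)
      where lem : ∀ a → a - a + 0ℤ ≡ 0ℤ
            lem = solve-∀

    moved₀ : ∀ {m} a b → Cong m (- a - b + a + b) 0ℤ
    moved₀ a b = ≡⇒Cong (lem a b)
      where lem : ∀ a b → - a - b + a + b ≡ 0ℤ
            lem = solve-∀

    moved₁ : ∀ {m} a b → Cong m (a - (a - b) + - b) 0ℤ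
    moved₁ a b = ≡⇒Cong (lem a b)
      where lem : ∀ a b → a - (a - b) + - b ≡ 0ℤ
            lem = solve-∀

    halved : ∀ {m} a h → Cong m (+ 2 * h) 1ℤ → Cong m (a - h * a + - (h * a)) 0ℤ
    halved a h 2h≡1 = Cong-trans (≡⇒Cong (lem a h)) (Cong-trans (Cong-*ˡ a (Cong-- (Cong-refl {a = 1ℤ}) 2h≡1)) (≡⇒Cong (lem′ a)))
      where lem : ∀ a h → a - h * a + - (h * a) ≡ a * (1ℤ - + 2 * h)
            lem = solve-∀
            lem′ : ∀ a → a * (1ℤ - 1ℤ) ≡ 0ℤ
            lem′ = solve-∀

    halved′ : ∀ {m} a h → Cong m (+ 2 * h) 1ℤ → Cong m (- (h * a) + a + - (h * a)) 0ℤ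
    halved′ a h 2h≡1 = Cong-trans (≡⇒Cong (lem a h)) (halved a h 2h≡1)
      where lem : ∀ a h → - (h * a) + a + - (h * a) ≡ a - h * a + - (h * a)
            lem = solve-∀

  twoEdges-exact : ∀ c d → Exact (twoEdges c d)
  twoEdges-exact c d = 0 , λ P → steady (d 1F - c 1F) (- d 0F) , A * k + A * k + c 0F * A + c 1F * k , λ x →
    Cong-trans (≡⇒Cong (pad (⟦ twoEdges c d ⟧ (steady A k ⟨ x ⟩) x) (x 0F) (x 1F))) (steady-value c d A k 0ℤ 0ℤ x (plain₀ (d 0F)) (plain₁ (d 1F - c 1F)))
    where
    A = d 1F - c 1F
    k = - d 0F
    pad : ∀ u x₀ x₁ → u ≡ u + (0ℤ * x₀ + 0ℤ * x₁)
    pad = solve-∀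

  thirdEdge : (Fin 2 → ℤ) → (Fin 2 → ℤ) → Slot 2 → Slot 2 → Form 2
  thirdEdge c d s t = twoEdges c d ⊕ sl s ⊗ sl t

  private
    back : ∀ a x → a ≡ a + x + - x
    back = solve-∀

    -- Interchanging the elements of both pairs permutes the two opposite edges, and turns a third
    -- edge using b₀ or a₁ into one using a₀ or b₁.
    interchange : ∀ c d s t s′ t′ →
      (∀ a x → ⟦ sl s′ ⟧ a x ≡ ⟦ sl s ⟧ (λ i → a i + x i) (λ i → - x i)) →
      (∀ a x → ⟦ sl t′ ⟧ a x ≡ ⟦ sl t ⟧ (λ i → a i + x i) (λ i → - x i)) →
      Solvable (thirdEdge c (λ i → c i - d i) s t) → Solvable (thirdEdge c d s′ t′)
    interchange c d s t s′ t′ hs ht = embed {F = thirdEdge c (λ i → c i - d i) s t} {thirdEdge c d s′ t′} (λ i → i) (λ e → e) (λ _ → true)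
      λ a x → cong₂ _+_ (lem (a 0F) (a 1F) (x 0F) (x 1F) (c 0F) (c 1F) (d 0F) (d 1F)) (cong₂ _*_ (hs a x) (ht a x))
      where
      lem : ∀ a₀ a₁ x₀ x₁ c₀ c₁ d₀ d₁ →
        a₀ * a₁ + (a₀ + x₀) * (a₁ + x₁) + (c₀ * a₀ + d₀ * x₀ + (c₁ * a₁ + d₁ * x₁))
        ≡ (a₀ + x₀) * (a₁ + x₁) + (a₀ + x₀ + - x₀) * (a₁ + x₁ + - x₁) + (c₀ * (a₀ + x₀) + (c₀ - d₀) * - x₀ + (c₁ * (a₁ + x₁) + (c₁ - d₁) * - x₁))
      lem = solve-∀

    -- With a₀ and b₁ constant every third edge that uses a₀ or b₁ stays linear.
    held : Bool → Slot 2
    held false = (0F , false)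
    held true  = (1F , true)

    held-solvable : ∀ c d b t → Solvable (thirdEdge c d (held b) t)
    held-solvable c d false (0F , false) = exactly c d _ (λ _ → d 1F - c 1F) (λ _ → - d 0F) (λ _ → (d 1F - c 1F) * (d 1F - c 1F)) (λ _ → 0ℤ) (λ _ → 0ℤ)
      (λ _ _ → plain₀ (d 0F) , plain₁ (d 1F - c 1F)) (λ h x → lem (d 1F - c 1F) (x 0F) (x 1F))
      where lem : ∀ A x₀ x₁ → A * A ≡ A * A + (0ℤ * x₀ + 0ℤ * x₁)
            lem = solve-∀
    held-solvable c d false (0F , true) = exactly c d _ (λ _ → d 1F - c 1F) (λ _ → - d 0F - (d 1F - c 1F)) (λ _ → (d 1F - c 1F) * (d 1F - c 1F)) (λ _ → d 1F - c 1F) (λ _ → 0ℤ)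
      (λ _ _ → moved₀ (d 0F) (d 1F - c 1F) , plain₁ (d 1F - c 1F)) (λ h x → lem (d 1F - c 1F) (x 0F) (x 1F))
      where lem : ∀ A x₀ x₁ → A * (A + x₀) ≡ A * A + (A * x₀ + 0ℤ * x₁)
            lem = solve-∀
    held-solvable c d false (1F , false) = exactly c d _ (λ h → h * (d 1F - c 1F)) (λ _ → - d 0F) (λ h → h * (d 1F - c 1F) * - d 0F) (λ _ → 0ℤ) (λ h → - (h * (d 1F - c 1F)))
      (λ h 2h≡1 → plain₀ (d 0F) , halved (d 1F - c 1F) h 2h≡1) (λ h x → lem (h * (d 1F - c 1F)) (- d 0F) (x 0F) (x 1F))
      where lem : ∀ A k x₀ x₁ → A * (k - x₁) ≡ A * k + (0ℤ * x₀ + - A * x₁)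
            lem = solve-∀
    held-solvable c d false (1F , true) = exactly c d _ (λ _ → d 1F - c 1F) (λ _ → - d 0F) (λ _ → (d 1F - c 1F) * - d 0F) (λ _ → 0ℤ) (λ _ → 0ℤ)
      (λ _ _ → plain₀ (d 0F) , plain₁ (d 1F - c 1F)) (λ h x → lem (d 1F - c 1F) (- d 0F) (x 0F) (x 1F))
      where lem : ∀ A k x₀ x₁ → A * (k - x₁ + x₁) ≡ A * k + (0ℤ * x₀ + 0ℤ * x₁)
            lem = solve-∀
    held-solvable c d true (0F , true) = exactly c d _ (λ _ → d 1F - c 1F) (λ h → - (h * d 0F)) (λ h → - (h * d 0F) * (d 1F - c 1F)) (λ h → - (h * d 0F)) (λ _ → 0ℤ)
      (λ h 2h≡1 → halved′ (d 0F) h 2h≡1 , plain₁ (d 1F - c 1F)) (λ h x → lem (d 1F - c 1F) (- (h * d 0F)) (x 0F) (x 1F))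
      where lem : ∀ A k x₀ x₁ → (k - x₁ + x₁) * (A + x₀) ≡ k * A + (k * x₀ + 0ℤ * x₁)
            lem = solve-∀
    held-solvable c d true (1F , false) = exactly c d _ (λ _ → d 1F - c 1F - - d 0F) (λ _ → - d 0F) (λ _ → - d 0F * - d 0F) (λ _ → 0ℤ) (λ _ → - (- d 0F))
      (λ _ _ → plain₀ (d 0F) , moved₁ (d 1F - c 1F) (- d 0F)) (λ h x → lem (- d 0F) (x 0F) (x 1F))
      where lem : ∀ k x₀ x₁ → (k - x₁ + x₁) * (k - x₁) ≡ k * k + (0ℤ * x₀ + - k * x₁)
            lem = solve-∀
    held-solvable c d true (1F , true) = exactly c d _ (λ _ → d 1F - c 1F) (λ _ → - d 0F) (λ _ → - d 0F * - d 0F) (λ _ → 0ℤ) (λ _ → 0ℤ)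
      (λ _ _ → plain₀ (d 0F) , plain₁ (d 1F - c 1F)) (λ h x → lem (- d 0F) (x 0F) (x 1F))
      where lem : ∀ k x₀ x₁ → (k - x₁ + x₁) * (k - x₁ + x₁) ≡ k * k + (0ℤ * x₀ + 0ℤ * x₁)
            lem = solve-∀
    held-solvable c d true (0F , false) = Solvable-≗ (λ a x → cong (λ e → ⟦ twoEdges c d ⟧ a x + e) (ℤ.*-comm (a 0F) (a 1F + x 1F))) (held-solvable c d false (1F , true))

  thirdEdge-solvable : ∀ c d s t → Solvable (thirdEdge c d s t)
  thirdEdge-solvable c d (0F , false) t = held-solvable c d false t
  thirdEdge-solvable c d (1F , true)  t = held-solvable c d true t
  thirdEdge-solvable c d (0F , true)  (0F , false) = Solvable-≗ (λ a x → cong (λ e → ⟦ twoEdges c d ⟧ a x + e) (ℤ.*-comm (a 0F) (a 0F + x 0F))) (held-solvable c d false (0F , true))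
  thirdEdge-solvable c d (0F , true)  (1F , true)  = Solvable-≗ (λ a x → cong (λ e → ⟦ twoEdges c d ⟧ a x + e) (ℤ.*-comm (a 1F + x 1F) (a 0F + x 0F))) (held-solvable c d true (0F , true))
  thirdEdge-solvable c d (1F , false) (0F , false) = Solvable-≗ (λ a x → cong (λ e → ⟦ twoEdges c d ⟧ a x + e) (ℤ.*-comm (a 0F) (a 1F))) (held-solvable c d false (1F , false))
  thirdEdge-solvable c d (1F , false) (1F , true)  = Solvable-≗ (λ a x → cong (λ e → ⟦ twoEdges c d ⟧ a x + e) (ℤ.*-comm (a 1F + x 1F) (a 1F))) (held-solvable c d true (1F , false))
  thirdEdge-solvable c d (0F , true)  (0F , true)  = interchange c d (0F , false) (0F , false) (0F , true)  (0F , true)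
    (λ a x → refl) (λ a x → refl) (held-solvable c (λ i → c i - d i) false (0F , false))
  thirdEdge-solvable c d (0F , true)  (1F , false) = interchange c d (0F , false) (1F , true)  (0F , true)  (1F , false)
    (λ a x → refl) (λ a x → back (a 1F) (x 1F)) (held-solvable c (λ i → c i - d i) false (1F , true))
  thirdEdge-solvable c d (1F , false) (0F , true)  = interchange c d (1F , true)  (0F , false) (1F , false) (0F , true)
    (λ a x → back (a 1F) (x 1F)) (λ a x → refl) (held-solvable c (λ i → c i - d i) true (0F , false))
  thirdEdge-solvable c d (1F , false) (1F , false) = interchange c d (1F , true)  (1F , true)  (1F , false) (1F , false)
    (λ a x → back (a 1F) (x 1F)) (λ a x → back (a 1F) (x 1F)) (held-solvable c (λ i → c i - d i) true (1F , true))

-- Graphs whose edges can be charged to vertices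

module Graph where

  open Congruence
  open Block
  open Transform
  open Exact using (total; ≤-total)
  open LoopedEdge using (quad; √-bound; near-quad)
  open import Data.Integer.Base using (-_; _+_; _*_; _-_)
  open import Data.List.Membership.Propositional using (_∈_)

  ∑-bump : ∀ {n} (u : Fin n) (e : ℤ) {f g : Fin n → ℤ} → g u ≡ e + f u → (∀ v → u ≢ v → g v ≡ f v) → ∑ g ≡ e + ∑ f
  ∑-bump zero e {f} {g} at off = trans (cong₂ _+_ at (∑-cong (λ v → off (suc v) (λ ())))) (ℤ.+-assoc e (f zero) _)
  ∑-bump (suc u) e {f} {g} at off = trans (cong₂ _+_ (off zero (λ ())) (∑-bump u e at (λ v u≢v → off (suc v) (u≢v ∘ Fin.suc-injective))))
    (lem (f zero) e (∑ (f ∘ suc)))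
    where lem : ∀ a b c → a + (b + c) ≡ b + (a + c)
          lem = solve-∀

  -- The end w a + r x of an edge: r out of w parallel edges end in a + x, the others in a.
  record Half (n : ℕ) : Set where
    constructor half
    field
      vt      : Fin n
      w r     : ℕ
      {{w≢0}} : NonZero w
      r≤w     : r ℕ.≤ w

  open Half

  ⟪_⟫ : ∀ {n} → Half n → Form n
  ⟪ h ⟫ = con (+ w h) ⊗ el (vt h) ⊕ con (+ r h) ⊗ df (vt h)

  Edge : ℕ → Set
  Edge n = Half n × Half n

  edgesForm : ∀ {n} → List (Edge n) → Form n
  edgesForm []             = con 0ℤ
  edgesForm ((h , g) ∷ es) = ⟪ h ⟫ ⊗ ⟪ g ⟫ ⊕ edgesForm es

  -- Coefficients of a², a x, x², a and x at one vertex. For natural numbers below all the primes,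
  -- invertible means nonzero, and sums of contributions do not cancel.
  record Coeffs : Set where
    field
      l β γ c d : ℕ

  open Coeffs

  quadForm : ∀ {n} → Coeffs → Fin n → Form n
  quadForm q v = con (+ l q) ⊗ (el v ⊗ el v) ⊕ con (+ β q) ⊗ (el v ⊗ df v) ⊕ con (+ γ q) ⊗ (df v ⊗ df v)
    ⊕ (con (+ c q) ⊗ el v ⊕ con (+ d q) ⊗ df v)

  add-linear : ℕ → ℕ → Coeffs → Coeffs
  add-linear w r q = record q { c = w ℕ.+ c q ; d = r ℕ.+ d q }

  private
    add-linear-lemma : ∀ w r c d a x u → u + ((w + c) * a + (r + d) * x) ≡ w * a + r * x + (u + (c * a + d * x))
    add-linear-lemma = solve-∀

    solve-linear : ∀ {m} c d x i t → Cong m (+ c * i) 1ℤ → Cong m (quad 0ℤ 0ℤ 0ℤ (+ c) d (i * (t - d * x)) x) t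
    solve-linear c d x i t ci≡1 = Cong-trans (≡⇒Cong (lem (+ c) d x i t))
      (Cong-trans (Cong-+ (Cong-* ci≡1 (Cong-refl {a = t - d * x})) (Cong-refl {a = d * x})) (≡⇒Cong (lem′ d x t)))
      where
      lem : ∀ c d x i t → quad 0ℤ 0ℤ 0ℤ c d (i * (t - d * x)) x ≡ c * i * (t - d * x) + d * x
      lem c d x i t = lem₀ c d x (i * (t - d * x)) (c * i * (t - d * x)) (sym (ℤ.*-assoc c i (t - d * x)))
        where lem₁ : ∀ c d x a → 0ℤ * (a * a) + 0ℤ * (a * x) + 0ℤ * (x * x) + (c * a + d * x) ≡ c * a + d * x
              lem₁ = solve-∀
              lem₀ : ∀ c d x a e → c * a ≡ e → quad 0ℤ 0ℤ 0ℤ c d a x ≡ e + d * x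
              lem₀ c d x a e eq = trans (lem₁ c d x a) (cong (_+ d * x) eq)
      lem′ : ∀ d x t → 1ℤ * (t - d * x) + d * x ≡ t
      lem′ = solve-∀

    quad-zero : ∀ a x → quad 0ℤ 0ℤ 0ℤ 0ℤ 0ℤ a x ≡ 0ℤ
    quad-zero = lem
      where lem : ∀ a x → 0ℤ * (a * a) + 0ℤ * (a * x) + 0ℤ * (x * x) + (0ℤ * a + 0ℤ * x) ≡ 0ℤ
            lem = solve-∀

  abstract
    eval : Coeffs → ℤ → ℤ → ℤ
    eval q = quad (+ l q) (+ β q) (+ γ q) (+ c q) (+ d q)

    ⟦quadForm⟧ : ∀ {n} q (v : Fin n) a x → ⟦ quadForm q v ⟧ a x ≡ eval q (a v) (x v)
    ⟦quadForm⟧ q v a x = refl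

    end : ∀ {n} → Half n → ℤ → ℤ → ℤ
    end h a x = + w h * a + + r h * x

    ⟦⟪⟫⟧ : ∀ {n} (h : Half n) a x → ⟦ ⟪ h ⟫ ⟧ a x ≡ end h (a (vt h)) (x (vt h))
    ⟦⟪⟫⟧ h a x = refl

    eval-add : ∀ {n} (h : Half n) q a x → eval (add-linear (w h) (r h) q) a x ≡ end h a x + eval q a x
    eval-add h q a x = add-linear-lemma (+ w h) (+ r h) (+ c q) (+ d q) a x (+ l q * (a * a) + + β q * (a * x) + + γ q * (x * x))

    eval-zero : ∀ q → l q ≡ 0 → β q ≡ 0 → γ q ≡ 0 → c q ≡ 0 → d q ≡ 0 → ∀ a x → eval q a x ≡ 0ℤ
    eval-zero record { l = .0 ; β = .0 ; γ = .0 ; c = .0 ; d = .0 } refl refl refl refl refl a x = quad-zero a x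

    eval-linear : ∀ {m} q → l q ≡ 0 → β q ≡ 0 → γ q ≡ 0 → Coprime (c q) m → ∀ x t → Σ ℤ λ a → Cong m (eval q a x) t
    eval-linear record { l = .0 ; β = .0 ; γ = .0 ; c = c ; d = d } refl refl refl cop x t =
      _ , solve-linear c (+ d) x (proj₁ (inverse cop)) t (proj₂ (inverse cop))

    eval-near : ∀ {m s} q → Coprime (l q) m → Coprime (2 ℕ.* l q) m → .{{_ : NonZero m}} → m ℕ.≤ s ℕ.* s → ∀ x t →
      Σ ℤ λ a → Σ ℕ λ ρ → ρ ℕ.≤ l q ℕ.* (2 ℕ.* s) × Cong m (eval q a x) (t + + ρ)
    eval-near {s = s} q cop cop₂ m≤s² x t = near-quad {l = l q} {s = s} cop cop₂ m≤s² (+ β q) (+ γ q) (+ c q) (+ d q) x t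

  graphForm : ∀ {n} → List (Edge n) → (Fin n → Coeffs) → Form n
  graphForm es V = edgesForm es ⊕ sm (λ v → quadForm (V v) v)

  bump : ∀ {n} → Half n → (Fin n → Coeffs) → Fin n → Coeffs
  bump h V v with vt h Fin.≟ v
  ... | yes _ = add-linear (w h) (r h) (V v)
  ... | no _  = V v

  ∑-bump-eval : ∀ {n} (h : Half n) (V : Fin n → Coeffs) (a x : Fin n → ℤ) → ∑ (λ v → eval (bump h V v) (a v) (x v)) ≡ end h (a (vt h)) (x (vt h)) + ∑ (λ v → eval (V v) (a v) (x v))
  ∑-bump-eval h V a x = ∑-bump (vt h) (end h (a (vt h)) (x (vt h))) at off
    where
    at : eval (bump h V (vt h)) (a (vt h)) (x (vt h)) ≡ end h (a (vt h)) (x (vt h)) + eval (V (vt h)) (a (vt h)) (x (vt h))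
    at with vt h Fin.≟ vt h
    ... | yes _ = eval-add h (V (vt h)) (a (vt h)) (x (vt h))
    ... | no ¬e = contradiction refl ¬e
    off : ∀ v → vt h ≢ v → eval (bump h V v) (a v) (x v) ≡ eval (V v) (a v) (x v)
    off v h≢v with vt h Fin.≟ v
    ... | yes e = contradiction e h≢v
    ... | no _  = refl

  -- An oriented edge (h , g) is charged to the vertex of h: there the half-edge h is given the value 1.
  push : ∀ {n} → List (Edge n) → (Fin n → Coeffs) → Fin n → Coeffs
  push []             V = V
  push ((h , g) ∷ os) V = bump g (push os V)

  data _⇝_ {n} : List (Edge n) → List (Edge n) → Set where
    []   : [] ⇝ []
    keep : ∀ {h g es os} → es ⇝ os → ((h , g) ∷ es) ⇝ ((h , g) ∷ os)
    flip : ∀ {h g es os} → es ⇝ os → ((h , g) ∷ es) ⇝ ((g , h) ∷ os)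

  ⇝-edges : ∀ {n} {es os : List (Edge n)} → es ⇝ os → ∀ a x → ⟦ edgesForm es ⟧ a x ≡ ⟦ edgesForm os ⟧ a x
  ⇝-edges []       a x = refl
  ⇝-edges (keep {h} {g} o) a x = cong (λ e → ⟦ ⟪ h ⟫ ⟧ a x * ⟦ ⟪ g ⟫ ⟧ a x + e) (⇝-edges o a x)
  ⇝-edges (flip {h} {g} o) a x = cong₂ _+_ (ℤ.*-comm (⟦ ⟪ h ⟫ ⟧ a x) (⟦ ⟪ g ⟫ ⟧ a x)) (⇝-edges o a x)

  private
    push-step : ∀ {m H G G′ E S T U} → Cong m H 1ℤ → G ≡ G′ → Cong m (E + S) T → U ≡ G′ + T → Cong m (H * G + E + S) U
    push-step {H = H} {G} {.G} {E} {S} {T} h refl e refl = Cong-trans (≡⇒Cong (ℤ.+-assoc (H * G) E S))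
      (Cong-+ (Cong-trans (Cong-* h (Cong-refl {a = G})) (≡⇒Cong (ℤ.*-identityˡ G))) e)

    push-edges : ∀ {m n} (os : List (Edge n)) (V : Fin n → Coeffs) (a x : Fin n → ℤ) → All (λ e → Cong m (end (proj₁ e) (a (vt (proj₁ e))) (x (vt (proj₁ e)))) 1ℤ) os →
      Cong m (⟦ edgesForm os ⟧ a x + ∑ (λ v → eval (V v) (a v) (x v))) (∑ (λ v → eval (push os V v) (a v) (x v)))
    push-edges []             V a x []         = ≡⇒Cong (ℤ.+-identityˡ _)
    push-edges ((h , g) ∷ os) V a x (h≡1 ∷ hs) =
      push-step {H = ⟦ ⟪ h ⟫ ⟧ a x} {⟦ ⟪ g ⟫ ⟧ a x} {end g (a (vt g)) (x (vt g))} {⟦ edgesForm os ⟧ a x} {∑ (λ v → eval (V v) (a v) (x v))}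
        {∑ (λ v → eval (push os V v) (a v) (x v))} (Cong-trans (≡⇒Cong (⟦⟪⟫⟧ h a x)) h≡1) (⟦⟪⟫⟧ g a x) (push-edges os V a x hs) (∑-bump-eval g (push os V) a x)

  push-value : ∀ {m n} (os : List (Edge n)) (V : Fin n → Coeffs) (a x : Fin n → ℤ) → All (λ e → Cong m (end (proj₁ e) (a (vt (proj₁ e))) (x (vt (proj₁ e)))) 1ℤ) os →
    Cong m (⟦ graphForm os V ⟧ a x) (∑ (λ v → eval (push os V v) (a v) (x v)))
  push-value os V a x hs = Cong-trans (Cong-+ˡ (⟦ edgesForm os ⟧ a x) (≡⇒Cong (∑-cong (λ v → ⟦quadForm⟧ (V v) v a x)))) (push-edges os V a x hs)

  weight : ∀ {n} → Half n → Fin n → ℕ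
  weight h v with vt h Fin.≟ v
  ... | yes _ = w h
  ... | no _  = 0

  weights : ∀ {n} → List (Edge n) → Fin n → ℕ
  weights []             v = 0
  weights ((h , g) ∷ es) v = weight h v ℕ.+ weight g v ℕ.+ weights es v

  ⇝-weights : ∀ {n} {es os : List (Edge n)} → es ⇝ os → ∀ v → weights es v ≡ weights os v
  ⇝-weights []       v = refl
  ⇝-weights (keep o) v = cong₂ ℕ._+_ refl (⇝-weights o v)
  ⇝-weights (flip {h} {g} o) v = cong₂ ℕ._+_ (ℕ.+-comm (weight h v) (weight g v)) (⇝-weights o v)

  Free : ∀ {n} → Fin n → List (Edge n) → Set
  Free v = All (λ e → vt (proj₁ e) ≢ v)

  c-bump : ∀ {n} (g : Half n) V v → c (bump g V v) ≡ weight g v ℕ.+ c (V v)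
  c-bump g V v with vt g Fin.≟ v
  ... | yes _ = refl
  ... | no _  = refl

  l-bump : ∀ {n} (g : Half n) V v → l (bump g V v) ≡ l (V v) × β (bump g V v) ≡ β (V v) × γ (bump g V v) ≡ γ (V v)
  l-bump g V v with vt g Fin.≟ v
  ... | yes _ = refl , refl , refl
  ... | no _  = refl , refl , refl

  d≤c-bump : ∀ {n} (g : Half n) V v → d (V v) ℕ.≤ c (V v) → d (bump g V v) ℕ.≤ c (bump g V v)
  d≤c-bump g V v h with vt g Fin.≟ v
  ... | yes _ = ℕ.+-mono-≤ (r≤w g) h
  ... | no _  = h

  c-push≤ : ∀ {n} (os : List (Edge n)) V v → c (push os V v) ℕ.≤ weights os v ℕ.+ c (V v)
  c-push≤ []             V v = ℕ.≤-refl
  c-push≤ ((h , g) ∷ os) V v = begin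
    c (bump g (push os V) v)                                      ≡⟨ c-bump g (push os V) v ⟩
    weight g v ℕ.+ c (push os V v)                                ≤⟨ ℕ.+-mono-≤ (ℕ.m≤n+m (weight g v) (weight h v)) (c-push≤ os V v) ⟩
    weight h v ℕ.+ weight g v ℕ.+ (weights os v ℕ.+ c (V v))      ≡⟨ sym (ℕ.+-assoc (weight h v ℕ.+ weight g v) (weights os v) (c (V v))) ⟩
    weight h v ℕ.+ weight g v ℕ.+ weights os v ℕ.+ c (V v)        ∎
    where open ℕ.≤-Reasoning

  -- If no edge is charged to `v`, every half-edge at `v` becomes part of its linear term. Hence the
  -- coefficient of `a v` is nonzero as soon as `v` has an edge or a linear term at all.
  c-push≥ : ∀ {n} (os : List (Edge n)) V v → Free v os → weights os v ℕ.+ c (V v) ℕ.≤ c (push os V v)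
  c-push≥ []             V v []        = ℕ.≤-refl
  c-push≥ ((h , g) ∷ os) V v (h≢v ∷ fr) = begin
    weight h v ℕ.+ weight g v ℕ.+ weights os v ℕ.+ c (V v)        ≡⟨ cong (λ k → k ℕ.+ weight g v ℕ.+ weights os v ℕ.+ c (V v)) no-weight ⟩
    weight g v ℕ.+ weights os v ℕ.+ c (V v)                       ≡⟨ ℕ.+-assoc (weight g v) (weights os v) (c (V v)) ⟩
    weight g v ℕ.+ (weights os v ℕ.+ c (V v))                     ≤⟨ ℕ.+-monoʳ-≤ (weight g v) (c-push≥ os V v fr) ⟩
    weight g v ℕ.+ c (push os V v)                                ≡⟨ sym (c-bump g (push os V) v) ⟩
    c (bump g (push os V) v)                                      ∎
    where
    open ℕ.≤-Reasoning
    no-weight : weight h v ≡ 0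
    no-weight with vt h Fin.≟ v
    ... | yes e = contradiction e h≢v
    ... | no _  = refl

  l-push : ∀ {n} (os : List (Edge n)) V v → l (push os V v) ≡ l (V v) × β (push os V v) ≡ β (V v) × γ (push os V v) ≡ γ (V v)
  l-push []             V v = refl , refl , refl
  l-push ((h , g) ∷ os) V v = let (e₁ , e₂ , e₃) = l-push os V v ; (f₁ , f₂ , f₃) = l-bump g (push os V) v in trans f₁ e₁ , trans f₂ e₂ , trans f₃ e₃

  d≤c-push : ∀ {n} (os : List (Edge n)) V v → d (V v) ℕ.≤ c (V v) → d (push os V v) ℕ.≤ c (push os V v)
  d≤c-push []             V v h = h
  d≤c-push ((_ , g) ∷ os) V v h = d≤c-bump g (push os V) v (d≤c-push os V v h)

  charge : ∀ {n} → List (Edge n) → Fin n → Maybe (Half n)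
  charge []             v = nothing
  charge ((h , _) ∷ os) v with vt h Fin.≟ v
  ... | yes _ = just h
  ... | no _  = charge os v

  -- A fixed vertex has one value to choose, so all edges charged to it must have the same half-edge
  -- there if all of them are to become 1.
  Compatible : ∀ {n} → Edge n → Edge n → Set
  Compatible (h , _) (k , _) = vt h ≡ vt k → w h ≡ w k × r h ≡ r k

  record Config {n} (es : List (Edge n)) : Set where
    field
      os         : List (Edge n)
      oriented   : es ⇝ os
      compatible : AllPairs Compatible os

  open Config

  Charged : ∀ {n} → Half n → Maybe (Half n) → Set
  Charged h nothing  = h ≡ h × (0 ≡ 1)
  Charged h (just k) = w h ≡ w k × r h ≡ r k

  charged : ∀ {n} (os : List (Edge n)) → AllPairs Compatible os → All (λ e → Charged (proj₁ e) (charge os (vt (proj₁ e)))) os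
  charged []             []         = []
  charged ((h , g) ∷ os) (cs ∷ css) = first ∷ All.tabulate (λ {e} e∈ → later e (All.lookup cs e∈) (All.lookup (charged os css) e∈))
    where
    first : Charged h (charge ((h , g) ∷ os) (vt h))
    first with vt h Fin.≟ vt h
    ... | yes _ = refl , refl
    ... | no ¬e = contradiction refl ¬e
    later : ∀ e → Compatible (h , g) e → Charged (proj₁ e) (charge os (vt (proj₁ e))) → Charged (proj₁ e) (charge ((h , g) ∷ os) (vt (proj₁ e)))
    later (k , _) cp ch with vt h Fin.≟ vt k
    ... | yes e = let (e₁ , e₂) = cp e in sym e₁ , sym e₂
    ... | no _  = ch

  -- The solution of w a + r x = 1 for the charged half-edge; a vertex without a charge plays 0.
  passive : ∀ {n} → (ℕ → ℤ) → Maybe (Half n) → ℤ → ℤ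
  passive inv nothing  x = 0ℤ
  passive inv (just h) x = inv (w h) * (1ℤ - + r h * x)

  private
    solve-end : ∀ {m} w r i x → Cong m (+ w * i) 1ℤ → Cong m (+ w * (i * (1ℤ - + r * x)) + + r * x) 1ℤ
    solve-end w r i x wi≡1 = Cong-trans (≡⇒Cong (lem (+ w) i (+ r) x))
      (Cong-trans (Cong-+ (Cong-* wi≡1 (Cong-refl {a = 1ℤ - + r * x})) (Cong-refl {a = + r * x})) (≡⇒Cong (lem′ (+ r) x)))
      where
      lem : ∀ w i r x → w * (i * (1ℤ - r * x)) + r * x ≡ w * i * (1ℤ - r * x) + r * x
      lem = solve-∀
      lem′ : ∀ r x → 1ℤ * (1ℤ - r * x) + r * x ≡ 1ℤ
      lem′ = solve-∀

  abstract
    passive-value : ∀ {m n} (inv : ℕ → ℤ) (h : Half n) k → Cong m (+ w h * inv (w h)) 1ℤ → Charged h k → ∀ x →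
      Cong m (end h (passive inv k x) x) 1ℤ
    passive-value inv h nothing  _     (_ , ()) x
    passive-value {m} inv h (just k) wi≡1 (w≡ , r≡) x = subst₂ (λ w′ r′ → Cong m (+ w h * (inv w′ * (1ℤ - + r′ * x)) + + r h * x) 1ℤ) w≡ r≡
      (solve-end (w h) (r h) (inv (w h)) x wi≡1)

  ∏-cong : ∀ {k} {p q : Fin k → ℕ} → (∀ i → p i ≡ q i) → ∏ p ≡ ∏ q
  ∏-cong {zero}  h = refl
  ∏-cong {suc k} h = cong₂ ℕ._*_ (h zero) (∏-cong (h ∘ suc))

  -- Leaving out the smallest factor keeps the most, which gives a bound that does not depend on
  -- `j`.
  ∏-without : ∀ {k} (p : Fin (suc k) → ℕ) → (∀ i → p zero ℕ.≤ p i) → (m : Fin (suc k) → ℕ) → ∀ j → m j ≡ 1 → (∀ i → i ≢ j → m i ≡ p i) →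
    ∏ m ℕ.≤ ∏ (p ∘ suc)
  ∏-without {k} p min m zero m≡1 m≡p = ℕ.≤-reflexive (trans (cong (ℕ._* ∏ (m ∘ suc)) m≡1) (trans (ℕ.*-identityˡ _) (∏-cong (λ i → m≡p (suc i) (λ ())))))
  ∏-without {suc k} p min m (suc j) m≡1 m≡p = begin
    m zero ℕ.* ∏ (m ∘ suc)         ≤⟨ ℕ.*-monoˡ-≤ _ (ℕ.≤-trans (ℕ.≤-reflexive (m≡p zero (λ ()))) (min _)) ⟩
    p (suc j) ℕ.* ∏ (m ∘ suc)      ≤⟨ replace (p ∘ suc) (m ∘ suc) j m≡1 (λ i i≢j → m≡p (suc i) (i≢j ∘ Fin.suc-injective)) ⟩
    ∏ (p ∘ suc)                    ∎
    where
    open ℕ.≤-Reasoning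
    lem : ∀ a b c → a ℕ.* (b ℕ.* c) ≡ b ℕ.* (a ℕ.* c)
    lem = ℕ-solve-∀
    replace : ∀ {k} (p m : Fin k → ℕ) j → m j ≡ 1 → (∀ i → i ≢ j → m i ≡ p i) → p j ℕ.* ∏ m ℕ.≤ ∏ p
    replace p m zero m≡1 m≡p = ℕ.≤-reflexive (cong (p zero ℕ.*_) (trans (cong (ℕ._* ∏ (m ∘ suc)) m≡1) (trans (ℕ.*-identityˡ _) (∏-cong (λ i → m≡p (suc i) (λ ()))))))
    replace p m (suc j) m≡1 m≡p = begin
      p (suc j) ℕ.* (m zero ℕ.* ∏ (m ∘ suc))   ≡⟨ lem (p (suc j)) (m zero) _ ⟩
      m zero ℕ.* (p (suc j) ℕ.* ∏ (m ∘ suc))   ≤⟨ ℕ.*-mono-≤ (ℕ.≤-reflexive (m≡p zero (λ ()))) (replace (p ∘ suc) (m ∘ suc) j m≡1 (λ i i≢j → m≡p (suc i) (i≢j ∘ Fin.suc-injective))) ⟩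
      p zero ℕ.* ∏ (p ∘ suc)                   ∎

  private
    omit : ∀ {k} (p : Fin k → ℕ) (j : Fin k) → Fin k → ℕ
    omit p j i with i Fin.≟ j
    ... | yes _ = 1
    ... | no _  = p i

    omit-self : ∀ {k} (p : Fin k → ℕ) j → omit p j j ≡ 1
    omit-self p j with j Fin.≟ j
    ... | yes _ = refl
    ... | no ¬e = contradiction refl ¬e

    omit-other : ∀ {k} (p : Fin k → ℕ) j i → i ≢ j → omit p j i ≡ p i
    omit-other p j i i≢j with i Fin.≟ j
    ... | yes e = contradiction e i≢j
    ... | no _  = refl

    omit-coprime : ∀ {k} (p : Fin k → ℕ) j → PairwiseCoprime p → PairwiseCoprime (omit p j)
    omit-coprime p j c i i′ i≢i′ with i Fin.≟ j | i′ Fin.≟ j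
    ... | yes _ | _     = Coprime.1-coprimeTo _
    ... | no _  | yes _ = Coprime.sym (Coprime.1-coprimeTo _)
    ... | no _  | no _  = c i i′ i≢i′

    omit≢0 : ∀ {k} (p : Fin k → ℕ) j → (∀ i → NonZero (p i)) → ∀ i → NonZero (omit p j i)
    omit≢0 p j nz i with i Fin.≟ j
    ... | yes _ = _
    ... | no _  = nz i

    ∏≢0 : ∀ {k} (p : Fin k → ℕ) → (∀ i → NonZero (p i)) → NonZero (∏ p)
    ∏≢0 {zero}  p nz = _
    ∏≢0 {suc k} p nz = ℕ.m*n≢0 _ _ {{nz zero}} {{∏≢0 (p ∘ suc) (nz ∘ suc)}}

  abstract
    -- Replacing `p j` by 1 imposes nothing at the prime where the vertex is free. This is what
    -- keeps `N` within the product of the other primes.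
    crt-omit : ∀ {k} (p : Fin (suc k) → ℕ) → PairwiseCoprime p → (∀ i → NonZero (p i)) → (∀ i → p zero ℕ.≤ p i) →
      ∀ j (t : Fin (suc k) → ℤ) → Σ ℕ λ N → N ℕ.≤ ∏ (p ∘ suc) × (∀ i → i ≢ j → Cong (p i) (t i) (+ N))
    crt-omit p cop nz min j t = proj₁ u
      , ℕ.≤-trans (ℕ.<⇒≤ (proj₁ (proj₂ u))) (∏-without p min (omit p j) j (omit-self p j) (omit-other p j))
      , λ i i≢j → subst (λ m → Cong m (t i) (+ proj₁ u)) (omit-other p j i i≢j)
          (Cong-trans (Cong-sym (proj₂ z i)) (Cong-∏⇒ (omit p j) (proj₂ (proj₂ u)) i))
      where
      z : Σ ℤ λ z → ∀ i → Cong (omit p j i) z (t i)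
      z = crt (omit p j) (omit-coprime p j cop) t
      u : Σ ℕ λ u → u ℕ.< ∏ (omit p j) × Cong (∏ (omit p j)) (proj₁ z) (+ u)
      u = residue (∏ (omit p j)) {{∏≢0 (omit p j) (omit≢0 p j nz)}} (proj₁ z)

    inverter : ∀ m K → (∀ {w} .{{_ : NonZero w}} → w ℕ.≤ K → Coprime w m) → Σ (ℕ → ℤ) λ inv → ∀ w .{{_ : NonZero w}} → w ℕ.≤ K → Cong m (+ w * inv w) 1ℤ
    inverter m K cop = inv , good
      where
      inv : ℕ → ℤ
      inv zero = 0ℤ
      inv (suc w) with suc w ℕ.≤? K
      ... | yes w≤K = proj₁ (inverse (cop w≤K))
      ... | no _    = 0ℤ
      good : ∀ w .{{_ : NonZero w}} → w ℕ.≤ K → Cong m (+ w * inv w) 1ℤ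
      good (suc w) w≤K′ with suc w ℕ.≤? K
      ... | yes w≤K = proj₂ (inverse (cop w≤K))
      ... | no w≰K  = contradiction w≤K′ w≰K

  +-total : ∀ {n} (f : Fin n → ℕ) → + total f ≡ ∑ (+_ ∘ f)
  +-total {zero}  f = refl
  +-total {suc n} f = trans (ℤ.pos-+ (f zero) (total (f ∘ suc))) (cong (λ z → + f zero + z) (+-total (f ∘ suc)))

  total-≤ : ∀ {n} (f : Fin n → ℕ) K → (∀ v → f v ℕ.≤ K) → total f ℕ.≤ n ℕ.* K
  total-≤ {zero}  f K h = z≤n
  total-≤ {suc n} f K h = ℕ.+-mono-≤ (h zero) (total-≤ (f ∘ suc) K (h ∘ suc))

  w≤weights : ∀ {n} (es : List (Edge n)) → All (λ e → w (proj₁ e) ℕ.≤ weights es (vt (proj₁ e))) es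
  w≤weights []             = []
  w≤weights ((h , g) ∷ es) = first ∷ All.map (λ {e} h′ → ℕ.≤-trans h′ (ℕ.m≤n+m _ _)) (w≤weights es)
    where
    first : w h ℕ.≤ weight h (vt h) ℕ.+ weight g (vt h) ℕ.+ weights es (vt h)
    first with vt h Fin.≟ vt h
    ... | yes _ = ℕ.≤-trans (ℕ.m≤m+n (w h) _) (ℕ.m≤m+n _ _)
    ... | no ¬e = contradiction refl ¬e

  -- The answer of one vertex to its difference: `N` is its contribution at the primes where it is
  -- fixed, and at its own prime it contributes `N` with an excess `ρ`, which can be nonzero only at
  -- the smallest prime.
  record Move {n} (p : Fin (suc n) → ℕ) (wild : Fin (suc n) → ℤ) (own : Fin (suc n)) (value : ℤ → ℤ) (Π R : ℕ) : Set where
    field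
      a   : ℤ
      N ρ : ℕ
      N≤  : N ℕ.≤ Π
      ρ≤  : ρ ℕ.≤ R
      off : ∀ i → i ≢ own → Cong (p i) (wild i) (+ N)
      at  : Cong (p own) (value a) (+ N + + ρ)
      err : own ≢ zero → ρ ≡ 0

  -- Vertices with a loop are free modulo the smallest prime p zero, vertex v without a loop modulo p (suc v).
  -- All other values are collected by the Chinese remainder theorem in a number N below ∏ p / p zero, which the
  -- free vertex then matches, with an error O(√ (p zero)) in the case of a loop.
  graph-solvable : ∀ {n} (es : List (Edge n)) (V : Fin n → Coeffs) → (∀ v → d (V v) ℕ.≤ c (V v)) →
    (∀ v → l (V v) ≡ 0 → β (V v) ≡ 0 × γ (V v) ≡ 0) →
    (Σ (Config es) λ χ → ∀ v → l (V v) ≢ 0 → Free v (os χ)) → (∀ v → Σ (Config es) λ χ → Free v (os χ)) →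
    Solvable (graphForm es V)
  graph-solvable {n} es V d≤c loopless χ₀ χ M E = proj₁ C , (begin
    B (proj₁ C) ℕ.* E                                                       ≡⟨ cong (ℕ._* E) (proj₁ (proj₂ C)) ⟩
    suc (n ℕ.* Π) ℕ.* suc (n ℕ.* R) ℕ.* E                                   ≤⟨ ℕ.*-monoˡ-≤ E (ℕ.*-mono-≤ (ℕ.+-monoˡ-≤ (n ℕ.* Π) 1≤Π) (ℕ.+-monoˡ-≤ (n ℕ.* R) 1≤s)) ⟩
    (Π ℕ.+ n ℕ.* Π) ℕ.* (s ℕ.+ n ℕ.* (K ℕ.* s)) ℕ.* E                       ≡⟨ lem n Π s K E ⟩
    D ℕ.* s ℕ.* Π                                                           ≤⟨ ℕ.*-monoˡ-≤ Π Ds≤p₀ ⟩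
    p zero ℕ.* Π                                                            ≡⟨ sym (proj₂ (proj₂ C)) ⟩
    ∣ proj₁ C ∣ₘ                                                            ∎)
    where
    open ℕ.≤-Reasoning
    lem : ∀ n Π s K E → (Π ℕ.+ n ℕ.* Π) ℕ.* (s ℕ.+ n ℕ.* (K ℕ.* s)) ℕ.* E ≡ suc n ℕ.* suc (n ℕ.* K) ℕ.* E ℕ.* s ℕ.* Π
    lem = ℕ-solve-∀
    deg : Fin n → ℕ
    deg v = weights es v ℕ.+ c (V v)
    -- `K` bounds every coefficient that has to be inverted. With s about √ p₀, the sum of the `N`
    -- takes at most (n + 1) Π values and the sum of the errors at most (n K + 1) s; then
    -- `D s ≤ p zero` leaves the factor `E`.
    K D : ℕ
    K = total deg ℕ.+ total (λ v → 2 ℕ.* l (V v))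
    D = suc n ℕ.* suc (n ℕ.* K) ℕ.* E
    deg≤K : ∀ v → deg v ℕ.≤ K
    deg≤K v = ℕ.≤-trans (≤-total deg v) (ℕ.m≤m+n _ _)
    2l≤K : ∀ v → 2 ℕ.* l (V v) ℕ.≤ K
    2l≤K v = ℕ.≤-trans (≤-total (λ v → 2 ℕ.* l (V v)) v) (ℕ.m≤n+m _ _)
    family = primeFamily (M ℕ.⊔ (K ℕ.⊔ D ℕ.* suc D)) (suc n)
    module F = PrimeFamily (proj₁ family)
    P : PrimeFamily M (suc n)
    P = record { p = F.p ; prime = F.prime ; p-inj = F.p-inj ; above = λ i → ℕ.≤-<-trans (ℕ.m≤m⊔n M _) (F.above i) }
    open PrimeFamily P using (p ; prime ; coprime)
    K<p : ∀ i → K ℕ.< p i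
    K<p i = ℕ.≤-<-trans (ℕ.≤-trans (ℕ.m≤m⊔n K (D ℕ.* suc D)) (ℕ.m≤n⊔m M _)) (F.above i)
    DD≤p₀ : D ℕ.* suc D ℕ.≤ p zero
    DD≤p₀ = ℕ.≤-trans (ℕ.≤-trans (ℕ.m≤n⊔m K (D ℕ.* suc D)) (ℕ.m≤n⊔m M _)) (ℕ.<⇒≤ (F.above zero))
    p≢0 : ∀ i → NonZero (p i)
    p≢0 i = prime⇒nonZero (prime i)
    min : ∀ i → p zero ℕ.≤ p i
    min zero    = ℕ.≤-refl
    min (suc i) = ℕ.<⇒≤ (proj₂ family (s≤s z≤n))
    small-coprime : ∀ i {w} .{{_ : NonZero w}} → w ℕ.≤ K → Coprime w (p i)
    small-coprime i w≤K = coprime-prime (prime i) (ℕ.≤-<-trans w≤K (K<p i))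
    root = √-bound D (p zero) DD≤p₀
    s R Π : ℕ
    s = proj₁ root
    R = K ℕ.* s
    Π = ∏ (p ∘ suc)
    p₀≤s² : p zero ℕ.≤ s ℕ.* s
    p₀≤s² = proj₁ (proj₂ root)
    Ds≤p₀ : D ℕ.* s ℕ.≤ p zero
    Ds≤p₀ = proj₂ (proj₂ root)
    1≤Π : 1 ℕ.≤ Π
    1≤Π = ℕ.>-nonZero⁻¹ Π {{∏≢0 (p ∘ suc) (p≢0 ∘ suc)}}
    1≤s : 1 ℕ.≤ s
    1≤s = ℕ.n≢0⇒n>0 λ s≡0 → contradiction (subst (λ s → p zero ℕ.≤ s ℕ.* s) s≡0 p₀≤s²) (ℕ.<⇒≱ (ℕ.≤-<-trans z≤n (K<p zero)))
    config : Fin (suc n) → Config es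
    config zero    = proj₁ χ₀
    config (suc v) = proj₁ (χ v)
    edges : Fin (suc n) → List (Edge n)
    edges i = os (config i)
    Q : Fin (suc n) → Fin n → Coeffs
    Q i = push (edges i) V
    inv : Fin (suc n) → ℕ → ℤ
    inv i = proj₁ (inverter (p i) K (small-coprime i))
    own′ : ∀ v → Dec (l (V v) ≡ 0) → Fin (suc n)
    own′ v (yes _) = suc v
    own′ v (no _)  = zero
    own : Fin n → Fin (suc n)
    own v = own′ v (l (V v) ℕ.≟ 0)
    rest : Fin (suc n) → Fin n → ℤ → ℤ
    rest i v = passive (inv i) (charge (edges i) v)
    wild : Fin n → ℤ → Fin (suc n) → ℤ
    wild v x i = eval (Q i v) (rest i v x) x
    weights≡ : ∀ i v → weights es v ≡ weights (edges i) v
    weights≡ i = ⇝-weights (oriented (config i))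
    c≤deg : ∀ i v → c (Q i v) ℕ.≤ deg v
    c≤deg i v = ℕ.≤-trans (c-push≤ (edges i) V v) (ℕ.≤-reflexive (cong (ℕ._+ c (V v)) (sym (weights≡ i v))))
    l≡ : ∀ i v → l (Q i v) ≡ l (V v)
    l≡ i v = proj₁ (l-push (edges i) V v)
    β≡ : ∀ i v → l (V v) ≡ 0 → β (Q i v) ≡ 0
    β≡ i v l≡0 = trans (proj₁ (proj₂ (l-push (edges i) V v))) (proj₁ (loopless v l≡0))
    γ≡ : ∀ i v → l (V v) ≡ 0 → γ (Q i v) ≡ 0
    γ≡ i v l≡0 = trans (proj₂ (proj₂ (l-push (edges i) V v))) (proj₂ (loopless v l≡0))
    value : Fin n → ℤ → ℤ → ℤ
    value v x a = eval (Q (own v) v) a x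
    matched : ∀ v x → Σ ℕ λ N → N ℕ.≤ Π × (∀ i → i ≢ own v → Cong (p i) (wild v x i) (+ N))
    matched v x = crt-omit p coprime p≢0 min (own v) (wild v x)
    move : ∀ v x → Move p (wild v x) (own v) (value v x) Π R
    move v x with l (V v) ℕ.≟ 0 | matched v x
    ... | no l≢0 | (N , N≤ , off) = record
      { a = proj₁ near ; N = N ; ρ = proj₁ (proj₂ near) ; N≤ = N≤ ; ρ≤ = ρ≤ ; off = off
      ; at = proj₂ (proj₂ (proj₂ near)) ; err = λ z≢z → contradiction refl z≢z }
      where
      l≢0′ : NonZero (l (Q zero v))
      l≢0′ = ℕ.≢-nonZero (l≢0 ∘ trans (sym (l≡ zero v)))
      2l≤ : 2 ℕ.* l (Q zero v) ℕ.≤ K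
      2l≤ = ℕ.≤-trans (ℕ.≤-reflexive (cong (2 ℕ.*_) (l≡ zero v))) (2l≤K v)
      near : Σ ℤ λ a → Σ ℕ λ ρ → ρ ℕ.≤ l (Q zero v) ℕ.* (2 ℕ.* s) × Cong (p zero) (eval (Q zero v) a x) (+ N + + ρ)
      near = eval-near {s = s} (Q zero v) (small-coprime zero {{l≢0′}} (ℕ.≤-trans (ℕ.m≤m+n _ _) 2l≤))
        (small-coprime zero {{ℕ.m*n≢0 2 _ {{_}} {{l≢0′}}}} 2l≤) {{p≢0 zero}} p₀≤s² x (+ N)
      shuffle : ∀ l s → l ℕ.* (2 ℕ.* s) ≡ 2 ℕ.* l ℕ.* s
      shuffle = ℕ-solve-∀
      ρ≤ : proj₁ (proj₂ near) ℕ.≤ R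
      ρ≤ = ℕ.≤-trans (proj₁ (proj₂ (proj₂ near))) (ℕ.≤-trans (ℕ.≤-reflexive (shuffle (l (Q zero v)) s)) (ℕ.*-monoˡ-≤ s 2l≤))
    ... | yes l≡0 | (N , N≤ , off) with deg v ℕ.≟ 0
    -- A vertex that does not occur has no coefficient to invert, but it contributes 0 at every
    -- prime whatever it plays.
    ...   | yes deg≡0 = record
      { a = 0ℤ ; N = 0 ; ρ = 0 ; N≤ = z≤n ; ρ≤ = z≤n ; off = λ i _ → dead i _ ; at = dead (suc v) _ ; err = λ _ → refl }
      where
      c≡0 : ∀ i → c (Q i v) ≡ 0
      c≡0 i = ℕ.n≤0⇒n≡0 (subst (c (Q i v) ℕ.≤_) deg≡0 (c≤deg i v))
      dead : ∀ i a → Cong (p i) (eval (Q i v) a x) 0ℤ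
      dead i a = ≡⇒Cong (eval-zero (Q i v) (trans (l≡ i v) l≡0) (β≡ i v l≡0) (γ≡ i v l≡0) (c≡0 i)
        (ℕ.n≤0⇒n≡0 (subst (d (Q i v) ℕ.≤_) (c≡0 i) (d≤c-push (edges i) V v (d≤c v)))) a x)
    ...   | no deg≢0 = record
      { a = proj₁ exact ; N = N ; ρ = 0 ; N≤ = N≤ ; ρ≤ = z≤n ; off = off
      ; at = Cong-trans (proj₂ exact) (≡⇒Cong (sym (ℤ.+-identityʳ (+ N)))) ; err = λ _ → refl }
      where
      c≢0 : c (Q (suc v) v) ≢ 0
      c≢0 c≡0 = deg≢0 (ℕ.n≤0⇒n≡0 (subst₂ ℕ._≤_ (cong (ℕ._+ c (V v)) (sym (weights≡ (suc v) v))) c≡0 (c-push≥ (edges (suc v)) V v (proj₂ (χ v)))))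
      exact : Σ ℤ λ a → Cong (p (suc v)) (eval (Q (suc v) v) a x) (+ N)
      exact = eval-linear (Q (suc v) v) (trans (l≡ (suc v) v) l≡0) (β≡ (suc v) v l≡0) (γ≡ (suc v) v l≡0)
        (small-coprime (suc v) {{ℕ.≢-nonZero c≢0}} (ℕ.≤-trans (c≤deg (suc v) v) (deg≤K v))) x (+ N)
    module Mv v x = Move (move v x)
    σ : Fin (suc n) → Strategy n
    σ i v x with i Fin.≟ own v
    ... | yes _ = Mv.a v x
    ... | no _  = rest i v x
    error : Fin (suc n) → ℕ → ℕ
    error zero    ρ = ρ
    error (suc _) ρ = 0
    own-error : ∀ v x → Mv.ρ v x ≡ error (own v) (Mv.ρ v x)
    own-error v x = go (own v) refl
      where
      go : ∀ i → own v ≡ i → Mv.ρ v x ≡ error i (Mv.ρ v x)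
      go zero    _  = refl
      go (suc i) eq = Mv.err v x (λ e → contradiction (trans (sym eq) e) λ ())
    no-error : ∀ i v x → i ≢ own v → error i (Mv.ρ v x) ≡ 0
    no-error (suc i) v x _ = refl
    no-error zero    v x z≢own = Mv.err v x (z≢own ∘ sym)
    local : ∀ i v x → Cong (p i) (eval (Q i v) (σ i v x) x) (+ (Mv.N v x ℕ.+ error i (Mv.ρ v x)))
    local i v x with i Fin.≟ own v
    ... | yes refl = Cong-trans (Mv.at v x) (≡⇒Cong (cong (λ r → + (Mv.N v x ℕ.+ r)) (own-error v x)))
    ... | no i≢own = Cong-trans (Mv.off v x i i≢own) (≡⇒Cong (cong +_ (sym (trans (cong (Mv.N v x ℕ.+_) (no-error i v x i≢own)) (ℕ.+-identityʳ _)))))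
    N ρ : (Fin n → ℤ) → ℕ
    N x = total (λ v → Mv.N v (x v))
    ρ x = total (λ v → Mv.ρ v (x v))
    target : Fin (suc n) → ℕ → ℕ → ℤ
    target i N ρ = + (N ℕ.+ error i ρ)
    total-+ : ∀ {n} (f g : Fin n → ℕ) → total (λ v → f v ℕ.+ g v) ≡ total f ℕ.+ total g
    total-+ {zero}  f g = refl
    total-+ {suc n} f g = trans (cong (f zero ℕ.+ g zero ℕ.+_) (total-+ (f ∘ suc) (g ∘ suc))) (lem′ (f zero) (g zero) (total (f ∘ suc)) (total (g ∘ suc)))
      where lem′ : ∀ a b c d → a ℕ.+ b ℕ.+ (c ℕ.+ d) ≡ a ℕ.+ c ℕ.+ (b ℕ.+ d)
            lem′ = ℕ-solve-∀
    total-error : ∀ i {m} (f : Fin m → ℕ) → total (λ v → error i (f v)) ≡ error i (total f)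
    total-error zero    f = refl
    total-error (suc i) {m} f = zeros m
      where zeros : ∀ m → total {m} (λ _ → 0) ≡ 0
            zeros zero    = refl
            zeros (suc m) = zeros m
    sum≡ : ∀ i x → ∑ (λ v → + (Mv.N v (x v) ℕ.+ error i (Mv.ρ v (x v)))) ≡ target i (N x) (ρ x)
    sum≡ i x = trans (sym (+-total (λ v → Mv.N v (x v) ℕ.+ error i (Mv.ρ v (x v)))))
      (cong +_ (trans (total-+ (λ v → Mv.N v (x v)) (λ v → error i (Mv.ρ v (x v)))) (cong (N x ℕ.+_) (total-error i (λ v → Mv.ρ v (x v))))))
    w≤K : ∀ i → All (λ e → w (proj₁ e) ℕ.≤ K) (edges i)
    w≤K i = All.map (λ {e} w≤ → ℕ.≤-trans w≤ (ℕ.≤-trans (ℕ.≤-trans (ℕ.≤-reflexive (sym (weights≡ i (vt (proj₁ e))))) (ℕ.m≤m+n _ _)) (deg≤K (vt (proj₁ e))))) (w≤weights (edges i))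
    -- No charged vertex is free, so it plays its passive value.
    Free-own : ∀ i → All (λ e → i ≢ own (vt (proj₁ e))) (edges i)
    Free-own i = All.tabulate λ {e} e∈ i≡own → free i (vt (proj₁ e)) i≡own e∈ refl
      where
      free : ∀ i v → i ≡ own v → ∀ {e} → e ∈ edges i → vt (proj₁ e) ≢ v
      free i v eq e∈ with l (V v) ℕ.≟ 0
      free _ v refl e∈ | yes _  = All.lookup (proj₂ (χ v)) e∈
      free _ v refl e∈ | no l≢0 = All.lookup (proj₂ χ₀ v l≢0) e∈
    σ-rest : ∀ i v x → i ≢ own v → σ i v x ≡ rest i v x
    σ-rest i v x i≢own with i Fin.≟ own v
    ... | yes e = contradiction e i≢own
    ... | no _  = refl
    charges : ∀ i x → All (λ e → Cong (p i) (end (proj₁ e) (σ i (vt (proj₁ e)) (x (vt (proj₁ e)))) (x (vt (proj₁ e)))) 1ℤ) (edges i)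
    charges i x = All.tabulate λ {e} e∈ → one e (All.lookup (Free-own i) e∈) (All.lookup (w≤K i) e∈)
        (All.lookup (charged (edges i) (compatible (config i))) e∈)
      where
      one : ∀ e → i ≢ own (vt (proj₁ e)) → w (proj₁ e) ℕ.≤ K → Charged (proj₁ e) (charge (edges i) (vt (proj₁ e))) →
        Cong (p i) (end (proj₁ e) (σ i (vt (proj₁ e)) (x (vt (proj₁ e)))) (x (vt (proj₁ e)))) 1ℤ
      one (h , _) i≢own w≤ ch = subst (λ a → Cong (p i) (end h a (x (vt h))) 1ℤ) (sym (σ-rest i (vt h) (x (vt h)) i≢own))
        (passive-value (inv i) h (charge (edges i) (vt h)) (proj₂ (inverter (p i) K (small-coprime i)) (w h) w≤) ch (x (vt h)))
    values : ∀ x i → Cong (p i) (⟦ graphForm es V ⟧ (σ i ⟨ x ⟩) x) (target i (N x) (ρ x))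
    values x i = Cong-trans (≡⇒Cong (cong (_+ ⟦ sm (λ v → quadForm (V v) v) ⟧ (σ i ⟨ x ⟩) x) (⇝-edges (oriented (config i)) (σ i ⟨ x ⟩) x)))
      (Cong-trans (push-value (edges i) V (σ i ⟨ x ⟩) x (charges i x))
      (Cong-trans (Cong-∑ (λ v → local i v (x v))) (≡⇒Cong (sum≡ i x))))
    C = cover (graphForm es V) P σ (suc (n ℕ.* Π)) (suc (n ℕ.* R)) target
      λ x → N x , ρ x , s≤s (total-≤ _ Π (λ v → Mv.N≤ v (x v))) , s≤s (total-≤ _ R (λ v → Mv.ρ≤ v (x v))) , values x

-- Small graphs as templates inside larger sets of variables

module Templates where

  open Block
  open Transform
  open Triangle using (linear; triangle; triangle-solvable)
  open LoopedEdge using (loop; loopedEdge; loopedEdge-solvable)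
  open Pendant using (pendant)
  open PendantSolvable using (pendant-solvable)
  open Exact
  open Graph using (∑-bump)
  open import Data.Integer.Base using (-_; _+_; _*_; _-_)

  Pair : ℕ → Set
  Pair n = Slot n × Slot n

  ed : ∀ {n} → Pair n → Form n
  ed e = sl (proj₁ e) ⊗ sl (proj₂ e)

  tri : ∀ {n} → Pair n → Pair n → Pair n → (Fin n → ℤ) → (Fin n → ℤ) → Form n
  tri e f g c d = ed e ⊕ ed f ⊕ ed g ⊕ sm (linear c d)

  erase₁ : ∀ {n} → Fin n → (Fin n → ℕ) → Fin n → ℕ
  erase₁ u c v with u Fin.≟ v
  ... | yes _ = 0
  ... | no _  = c v

  -- Used to split the linear part: the coefficients at the variables of a template become
  -- coefficients of the template, and the rest avoids these variables as `extend` demands.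
  erase : ∀ {k n} → (Fin k → Fin n) → (Fin n → ℕ) → Fin n → ℕ
  erase {zero}  ι c = c
  erase {suc k} ι c = erase (ι ∘ suc) (erase₁ (ι zero) c)

  erase₁-self : ∀ {n} (u : Fin n) c → erase₁ u c u ≡ 0
  erase₁-self u c with u Fin.≟ u
  ... | yes _ = refl
  ... | no ¬e = contradiction refl ¬e

  erase₁-other : ∀ {n} (u : Fin n) c v → u ≢ v → erase₁ u c v ≡ c v
  erase₁-other u c v u≢v with u Fin.≟ v
  ... | yes e = contradiction e u≢v
  ... | no _  = refl

  erase₁-mono : ∀ {n} (u : Fin n) {c d} → (∀ v → d v ℕ.≤ c v) → ∀ v → erase₁ u d v ℕ.≤ erase₁ u c v
  erase₁-mono u h v with u Fin.≟ v
  ... | yes _ = z≤n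
  ... | no _  = h v

  erase-mono : ∀ {k n} (ι : Fin k → Fin n) {c d} → (∀ v → d v ℕ.≤ c v) → ∀ v → erase ι d v ℕ.≤ erase ι c v
  erase-mono {zero}  ι h = h
  erase-mono {suc k} ι h = erase-mono (ι ∘ suc) (erase₁-mono (ι zero) h)

  erase-0 : ∀ {k n} (ι : Fin k → Fin n) c v → c v ≡ 0 → erase ι c v ≡ 0
  erase-0 {zero}  ι c v e = e
  erase-0 {suc k} ι c v e = erase-0 (ι ∘ suc) (erase₁ (ι zero) c) v (lem (ι zero))
    where
    lem : ∀ u → erase₁ u c v ≡ 0
    lem u with u Fin.≟ v
    ... | yes _ = refl
    ... | no _  = e

  erase-avoids : ∀ {k n} (ι : Fin k → Fin n) c → Avoids ι (erase ι c)
  erase-avoids ι c zero    = erase-0 (ι ∘ suc) (erase₁ (ι zero) c) (ι zero) (erase₁-self (ι zero) c)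
  erase-avoids ι c (suc i) = erase-avoids (ι ∘ suc) (erase₁ (ι zero) c) i

  private
    term : ℕ → ℕ → ℤ → ℤ → ℤ
    term c d a x = + c * a + + d * x

  ∑-erase : ∀ {k n} (ι : Fin k → Fin n) → (∀ {i j} → ι i ≡ ι j → i ≡ j) → (c d : Fin n → ℕ) (a x : Fin n → ℤ) →
    ⟦ linearPart c d ⟧ a x ≡ ∑ (λ i → + c (ι i) * a (ι i) + + d (ι i) * x (ι i)) + ⟦ linearPart (erase ι c) (erase ι d) ⟧ a x
  ∑-erase {zero}  ι ι-inj c d a x = sym (ℤ.+-identityˡ _)
  ∑-erase {suc k} ι ι-inj c d a x = trans
    (∑-bump (ι zero) (term (c (ι zero)) (d (ι zero)) (a (ι zero)) (x (ι zero))) {λ v → term (c′ v) (d′ v) (a v) (x v)} {λ v → term (c v) (d v) (a v) (x v)}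
      (sym (trans (cong₂ (λ y z → T + term y z (a (ι zero)) (x (ι zero))) (erase₁-self (ι zero) c) (erase₁-self (ι zero) d)) (gone T (a (ι zero)) (x (ι zero)))))
      (λ v u≢v → sym (cong₂ (λ y z → term y z (a v) (x v)) (erase₁-other (ι zero) c v u≢v) (erase₁-other (ι zero) d v u≢v))))
    (trans (cong (λ z → T + z) (trans (∑-erase (ι ∘ suc) (λ e → Fin.suc-injective (ι-inj e)) c′ d′ a x)
        (cong (_+ ⟦ linearPart (erase ι c) (erase ι d) ⟧ a x) (∑-cong same))))
      (sym (ℤ.+-assoc T (∑ (λ i → term (c (ι (suc i))) (d (ι (suc i))) (a (ι (suc i))) (x (ι (suc i))))) (⟦ linearPart (erase ι c) (erase ι d) ⟧ a x))))
    where
    c′ = erase₁ (ι zero) c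
    d′ = erase₁ (ι zero) d
    T = term (c (ι zero)) (d (ι zero)) (a (ι zero)) (x (ι zero))
    gone : ∀ t a x → t + (0ℤ * a + 0ℤ * x) ≡ t
    gone = solve-∀
    same : ∀ i → term (c′ (ι (suc i))) (d′ (ι (suc i))) (a (ι (suc i))) (x (ι (suc i))) ≡ term (c (ι (suc i))) (d (ι (suc i))) (a (ι (suc i))) (x (ι (suc i)))
    same i = cong₂ (λ y z → term y z (a (ι (suc i))) (x (ι (suc i)))) (erase₁-other (ι zero) c (ι (suc i)) (λ e → contradiction (ι-inj e) λ ()))
      (erase₁-other (ι zero) d (ι (suc i)) (λ e → contradiction (ι-inj e) λ ()))

  module _ {k n} (ι : Fin k → Fin n) (φ : Fin k → Bool) where

    lift : Slot k → Slot n
    lift (i , b) = ι i , b xor φ i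

    lift₂ : Pair k → Pair n
    lift₂ (s , t) = lift s , lift t

    els dfs : (Fin n → ℤ) → (Fin n → ℤ) → Fin k → ℤ
    els a x i = flip-el (φ i) (a (ι i)) (x (ι i))
    dfs a x i = flip-df (φ i) (x (ι i))

    ⟦lift⟧ : ∀ s a x → ⟦ sl (lift s) ⟧ a x ≡ ⟦ sl s ⟧ (els a x) (dfs a x)
    ⟦lift⟧ (i , false) a x with φ i
    ... | true  = refl
    ... | false = refl
    ⟦lift⟧ (i , true) a x with φ i
    ... | true  = lem (a (ι i)) (x (ι i))
      where lem : ∀ a x → a ≡ a + x + - x
            lem = solve-∀
    ... | false = refl

    -- From c a + d x = c (a + x) + (c - d) (- x): interchanging the elements of a pair keeps c and
    -- turns d into c - d.
    lift-c lift-d : (c d : Fin n → ℕ) → Fin k → ℤ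
    lift-c c d i = + c (ι i)
    lift-d c d i = if φ i then + c (ι i) - + d (ι i) else + d (ι i)

    private
      flip-term : ∀ b c d a x → c * flip-el b a x + (if b then c - d else d) * flip-df b x ≡ c * a + d * x
      flip-term true  = lem
        where lem : ∀ c d a x → c * (a + x) + (c - d) * - x ≡ c * a + d * x
              lem = solve-∀
      flip-term false c d a x = refl

    ⟦ed-lift⟧ : ∀ e a x → ⟦ ed (lift₂ e) ⟧ a x ≡ ⟦ ed e ⟧ (els a x) (dfs a x)
    ⟦ed-lift⟧ (s , t) a x = cong₂ _*_ (⟦lift⟧ s a x) (⟦lift⟧ t a x)

    linear-split : (∀ {i j} → ι i ≡ ι j → i ≡ j) → (c d : Fin n → ℕ) → ∀ a x →
      ⟦ linearPart c d ⟧ a x ≡ ⟦ sm (linear (lift-c c d) (lift-d c d)) ⟧ (els a x) (dfs a x) + ⟦ linearPart (erase ι c) (erase ι d) ⟧ a x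
    linear-split ι-inj c d a x = trans (∑-erase ι ι-inj c d a x) (cong (_+ ⟦ linearPart (erase ι c) (erase ι d) ⟧ a x)
      (∑-cong (λ i → sym (flip-term (φ i) (+ c (ι i)) (+ d (ι i)) (a (ι i)) (x (ι i))))))

    tri-embed : (∀ {i j} → ι i ≡ ι j → i ≡ j) → (e f g : Pair k) (c d : Fin n → ℕ) → (∀ v → d v ℕ.≤ c v) →
      Solvable (tri e f g (lift-c c d) (lift-d c d)) → Solvable (tri (lift₂ e) (lift₂ f) (lift₂ g) (+_ ∘ c) (+_ ∘ d))
    tri-embed ι-inj e f g c d d≤c = extend {T = tri e f g (lift-c c d) (lift-d c d)} {tri (lift₂ e) (lift₂ f) (lift₂ g) (+_ ∘ c) (+_ ∘ d)}
      ι ι-inj φ (erase ι c) (erase ι d) (erase-mono ι d≤c) (erase-avoids ι c) λ a x →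
        trans (cong₂ _+_ (cong₂ _+_ (cong₂ _+_ (⟦ed-lift⟧ e a x) (⟦ed-lift⟧ f a x)) (⟦ed-lift⟧ g a x)) (linear-split ι-inj c d a x))
        (trans (sym (ℤ.+-assoc (⟦ ed e ⊕ ed f ⊕ ed g ⟧ (els a x) (dfs a x)) (⟦ sm (linear (lift-c c d) (lift-d c d)) ⟧ (els a x) (dfs a x)) (⟦ linearPart (erase ι c) (erase ι d) ⟧ a x)))
        (cong (_+ ⟦ linearPart (erase ι c) (erase ι d) ⟧ a x) (sym (⟦place⟧ (tri e f g (lift-c c d) (lift-d c d)) ι φ a x))))

  private
    linear₂ : ∀ (c d : Fin 2 → ℤ) a x q → q + (⟦ linear c d 0F ⟧ a x + ⟦ linear c d 1F ⟧ a x) ≡ q + ⟦ sm (linear c d) ⟧ a x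
    linear₂ c d a x q = lem q (⟦ linear c d 0F ⟧ a x) (⟦ linear c d 1F ⟧ a x)
      where lem : ∀ q l₀ l₁ → q + (l₀ + l₁) ≡ q + (l₀ + (l₁ + 0ℤ))
            lem = solve-∀

    linear₃ : ∀ (c d : Fin 3 → ℤ) a x q → q + (⟦ linear c d 0F ⟧ a x + ⟦ linear c d 1F ⟧ a x + ⟦ linear c d 2F ⟧ a x) ≡ q + ⟦ sm (linear c d) ⟧ a x
    linear₃ c d a x q = lem q (⟦ linear c d 0F ⟧ a x) (⟦ linear c d 1F ⟧ a x) (⟦ linear c d 2F ⟧ a x)
      where lem : ∀ q l₀ l₁ l₂ → q + (l₀ + l₁ + l₂) ≡ q + (l₀ + (l₁ + (l₂ + 0ℤ)))
            lem = solve-∀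

  pattern _₀ v = (v , false)
  pattern _₁ v = (v , true)

  cycle-tri : ∀ c d → Solvable (tri (0F ₀ , 1F ₀) (1F ₁ , 2F ₀) (2F ₁ , 0F ₁) c d)
  cycle-tri c d = Solvable-≗ {F = cycle c d} (λ a x → linear₃ c d a x (⟦ ed (0F ₀ , 1F ₀) ⊕ ed (1F ₁ , 2F ₀) ⊕ ed (2F ₁ , 0F ₁) ⟧ a x))
    (exact⇒solvable {F = cycle c d} (cycle-exact c d))

  triangle-tri : ∀ c d → Solvable (tri (0F ₀ , 1F ₀) (0F ₀ , 2F ₀) (1F ₁ , 2F ₁) c d)
  triangle-tri c d = Solvable-≗ {F = triangle c d} (λ a x → linear₃ c d a x (⟦ ed (0F ₀ , 1F ₀) ⊕ ed (0F ₀ , 2F ₀) ⊕ ed (1F ₁ , 2F ₁) ⟧ a x))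
    (triangle-solvable c d)

  pendant-tri : ∀ c d → Solvable (tri (0F ₀ , 1F ₀) (0F ₁ , 1F ₁) (0F ₀ , 2F ₀) c d)
  pendant-tri c d = Solvable-≗ {F = pendant c d} (λ a x → linear₃ c d a x (⟦ ed (0F ₀ , 1F ₀) ⊕ ed (0F ₁ , 1F ₁) ⊕ ed (0F ₀ , 2F ₀) ⟧ a x)) solvable
    where
    solvable : Solvable (pendant c d)
    solvable with d 1F - c 1F + c 2F ℤ.≟ 0ℤ
    ... | no e≢0  = exact⇒solvable {F = pendant c d} (pendant-exact c d e≢0)
    ... | yes e≡0 = pendant-solvable c d (trans (lem (c 1F) (c 2F) (d 1F)) (trans (cong (λ z → c 2F + d 1F - z) e≡0) (lem′ (c 2F) (d 1F))))
      where
      lem : ∀ c₁ c₂ d₁ → c₁ ≡ c₂ + d₁ - (d₁ - c₁ + c₂)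
      lem = solve-∀
      lem′ : ∀ c₂ d₁ → c₂ + d₁ - 0ℤ ≡ c₂ + d₁
      lem′ = solve-∀

  thirdEdge-tri : ∀ c d s t → Solvable (tri (0F ₀ , 1F ₀) (0F ₁ , 1F ₁) (s , t) c d)
  thirdEdge-tri c d s t = Solvable-≗ {F = thirdEdge c d s t} (λ a x → same a x (⟦ ed (0F ₀ , 1F ₀) ⊕ ed (0F ₁ , 1F ₁) ⟧ a x) (⟦ ed (s , t) ⟧ a x)) (thirdEdge-solvable c d s t)
    where
    lem : ∀ q r l → q + l + r ≡ q + r + l
    lem = solve-∀
    same : ∀ a x q r → q + (⟦ linear c d 0F ⟧ a x + ⟦ linear c d 1F ⟧ a x) + r ≡ q + r + ⟦ sm (linear c d) ⟧ a x
    same a x q r = trans (lem q r (⟦ linear c d 0F ⟧ a x + ⟦ linear c d 1F ⟧ a x)) (linear₂ c d a x (q + r))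

  bit : Bool → ℤ
  bit b = if b then 1ℤ else 0ℤ

  private
    ⟦sl⟧-bit : ∀ {n} (v : Fin n) b a x → ⟦ sl (v , b) ⟧ a x ≡ a v + bit b * x v
    ⟦sl⟧-bit v true  a x = cong (λ z → a v + z) (sym (ℤ.*-identityˡ (x v)))
    ⟦sl⟧-bit v false a x = lem (a v) (x v)
      where lem : ∀ a x → a ≡ a + 0ℤ * x
            lem = solve-∀

    square : ∀ {n} (v : Fin n) b b′ a x → ⟦ ed ((v , b) , (v , b′)) ⟧ a x ≡ a v * a v + (bit b + bit b′) * (a v * x v) + bit b * bit b′ * (x v * x v)
    square v b b′ a x = trans (cong₂ _*_ (⟦sl⟧-bit v b a x) (⟦sl⟧-bit v b′ a x)) (lem (bit b) (bit b′) (a v) (x v))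
      where lem : ∀ b b′ a x → (a + b * x) * (a + b′ * x) ≡ a * a + (b + b′) * (a * x) + b * b′ * (x * x)
            lem = solve-∀

  loopedEdge-tri : ∀ c d b₀ b₀′ b₁ b₁′ → Solvable (tri ((0F , b₀) , (0F , b₀′)) ((1F , b₁) , (1F , b₁′)) (0F ₀ , 1F ₀) c d)
  loopedEdge-tri c d b₀ b₀′ b₁ b₁′ = Solvable-≗ {F = loopedEdge β γ c d} (λ a x → trans
    (linear₂ c d a x (⟦ loop β γ 0F ⊕ loop β γ 1F ⊕ ed (0F ₀ , 1F ₀) ⟧ a x))
    (cong (λ q → q + ⟦ ed (0F ₀ , 1F ₀) ⟧ a x + ⟦ sm (linear c d) ⟧ a x) (sym (cong₂ _+_ (square 0F b₀ b₀′ a x) (square 1F b₁ b₁′ a x)))))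
    (loopedEdge-solvable β γ c d)
    where
    β γ : Fin 2 → ℤ
    β 0F = bit b₀ + bit b₀′
    β 1F = bit b₁ + bit b₁′
    γ 0F = bit b₀ * bit b₀′
    γ 1F = bit b₁ * bit b₁′

-- Absorbing loops, merging parallel edges, orienting the rest

module GraphForms where

  open Congruence
  open Block
  open Transform
  open Exact
  open Graph
  open Templates
  open import Data.Integer.Base using (_+_; _*_)

  open Half
  open Coeffs
  open Config

  -- The roles are opposite to those in `extend`: here the template is made constant, and the rest
  -- is the form that remains to be solved.
  exact-extend : ∀ {k n} {T : Form k} {F G : Form n} (ι : Fin k → Fin n) → (∀ {i j} → ι i ≡ ι j → i ≡ j) → (φ : Fin k → Bool) →
    Exact T → (∀ a x → ⟦ F ⟧ a x ≡ ⟦ G ⟧ a x + ⟦ place T ι φ ⟧ a x) →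
    (∀ {a a′} x → (∀ v → (∀ i → ι i ≢ v) → a v ≡ a′ v) → ⟦ G ⟧ a x ≡ ⟦ G ⟧ a′ x) → Solvable G → Solvable F
  exact-extend {k} {n} {T} {F} {G} ι ι-inj φ (M₀ , exact) split indep = kill {F = F} {G} {place T ι φ} K split
    (λ x h → indep x (λ v out → h v (K-out v out))) M₀ λ P → let (τ , κ , hτ) = exact P ; (σ , σ-at) = lift-strategy ι ι-inj φ τ in
    σ , κ , λ a x h → Cong-trans (≡⇒Cong (trans (⟦place⟧ T ι φ a x)
      (⟦⟧-cong T (λ i → trans (cong (λ y → flip-el (φ i) y (x (ι i))) (h (ι i) (K-ι i))) (σ-at i (x (ι i)))) (λ _ → refl))))
      (hτ (λ i → flip-df (φ i) (x (ι i))))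
    where
    inside : ∀ {v} → Dec (Σ (Fin k) λ i → ι i ≡ v) → Bool
    inside (yes _) = true
    inside (no _)  = false
    K : Fin n → Bool
    K v = inside (Fin.any? (λ i → ι i Fin.≟ v))
    K-ι : ∀ i → K (ι i) ≡ true
    K-ι i with Fin.any? (λ j → ι j Fin.≟ ι i)
    ... | yes _ = refl
    ... | no ¬e = contradiction (i , refl) ¬e
    K-out : ∀ v → (∀ i → ι i ≢ v) → K v ≡ false
    K-out v out with Fin.any? (λ j → ι j Fin.≟ v)
    ... | yes (i , e) = contradiction e (out i)
    ... | no _        = refl

  ⌜_⌝ : ∀ {n} → Slot n → Half n
  ⌜ v , b ⌝ = half v 1 (if b then 1 else 0) (bit≤ b)
    where
    bit≤ : ∀ b → (if b then 1 else 0) ℕ.≤ 1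
    bit≤ true  = s≤s z≤n
    bit≤ false = z≤n

  ⌜_⌝₂ : ∀ {n} → Pair n → Edge n
  ⌜ s , t ⌝₂ = ⌜ s ⌝ , ⌜ t ⌝

  private
    ⟦⌜⌝⟧ : ∀ {n} (s : Slot n) a x → ⟦ sl s ⟧ a x ≡ ⟦ ⟪ ⌜ s ⌝ ⟫ ⟧ a x
    ⟦⌜⌝⟧ (v , true)  a x = lem (a v) (x v)
      where lem : ∀ a x → a + x ≡ 1ℤ * a + 1ℤ * x
            lem = solve-∀
    ⟦⌜⌝⟧ (v , false) a x = lem (a v) (x v)
      where lem : ∀ a x → a ≡ 1ℤ * a + 0ℤ * x
            lem = solve-∀

    ⟦⌜⌝₂⟧ : ∀ {n} (e : Pair n) a x → ⟦ ed e ⟧ a x ≡ ⟦ ⟪ ⌜ proj₁ e ⌝ ⟫ ⊗ ⟪ ⌜ proj₂ e ⌝ ⟫ ⟧ a x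
    ⟦⌜⌝₂⟧ (s , t) a x = cong₂ _*_ (⟦⌜⌝⟧ s a x) (⟦⌜⌝⟧ t a x)

  linV : ∀ {n} → (Fin n → ℕ) → (Fin n → ℕ) → Fin n → Coeffs
  linV c d v = record { l = 0 ; β = 0 ; γ = 0 ; c = c v ; d = d v }

  Fine : ∀ {n} → (Fin n → Coeffs) → Set
  Fine V = (∀ v → d (V v) ℕ.≤ c (V v)) × (∀ v → l (V v) ≡ 0 → β (V v) ≡ 0 × γ (V v) ≡ 0)

  private
    ⟦linV⟧ : ∀ {n} (c d : Fin n → ℕ) a x → ⟦ linearPart c d ⟧ a x ≡ ⟦ sm (λ v → quadForm (linV c d v) v) ⟧ a x
    ⟦linV⟧ c d a x = ∑-cong (λ v → lem (+ c v) (+ d v) (a v) (x v))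
      where lem : ∀ c d a x → c * a + d * x ≡ 0ℤ * (a * a) + 0ℤ * (a * x) + 0ℤ * (x * x) + (c * a + d * x)
            lem = solve-∀

  single-graph : ∀ {n} (g : Pair n) c d → Solvable (graphForm (⌜ g ⌝₂ ∷ []) (linV c d)) → Solvable (ed g ⊕ linearPart c d)
  single-graph g c d = Solvable-≗ {F = graphForm (⌜ g ⌝₂ ∷ []) (linV c d)} λ a x → sym (trans (cong₂ _+_ (⟦⌜⌝₂⟧ g a x) (⟦linV⟧ c d a x))
    (cong (_+ ⟦ sm (λ v → quadForm (linV c d v) v) ⟧ a x) (sym (ℤ.+-identityʳ (⟦ ⟪ ⌜ proj₁ g ⌝ ⟫ ⊗ ⟪ ⌜ proj₂ g ⌝ ⟫ ⟧ a x)))))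

  tri-graph : ∀ {n} (e f g : Pair n) c d → Solvable (graphForm (⌜ e ⌝₂ ∷ ⌜ f ⌝₂ ∷ ⌜ g ⌝₂ ∷ []) (linV c d)) → Solvable (tri e f g (+_ ∘ c) (+_ ∘ d))
  tri-graph e f g c d = Solvable-≗ {F = graphForm (⌜ e ⌝₂ ∷ ⌜ f ⌝₂ ∷ ⌜ g ⌝₂ ∷ []) (linV c d)} λ a x →
    sym (trans (cong₂ _+_ (cong₂ _+_ (cong₂ _+_ (⟦⌜⌝₂⟧ e a x) (⟦⌜⌝₂⟧ f a x)) (⟦⌜⌝₂⟧ g a x)) (⟦linV⟧ c d a x))
      (cong (_+ ⟦ sm (λ v → quadForm (linV c d v) v) ⟧ a x)
        (lem (⟦ ⟪ ⌜ proj₁ e ⌝ ⟫ ⊗ ⟪ ⌜ proj₂ e ⌝ ⟫ ⟧ a x) (⟦ ⟪ ⌜ proj₁ f ⌝ ⟫ ⊗ ⟪ ⌜ proj₂ f ⌝ ⟫ ⟧ a x) (⟦ ⟪ ⌜ proj₁ g ⌝ ⟫ ⊗ ⟪ ⌜ proj₂ g ⌝ ⟫ ⟧ a x))))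
    where lem : ∀ e f g → e + f + g ≡ e + (f + (g + 0ℤ))
          lem = solve-∀

  merge : ∀ {n} → Half n → Half n → Half n
  merge g h = half (vt g) (w g ℕ.+ w h) (r g ℕ.+ r h) {{ℕ.>-nonZero (ℕ.<-≤-trans (ℕ.>-nonZero⁻¹ (w g)) (ℕ.m≤m+n (w g) (w h)))}} (ℕ.+-mono-≤ (r≤w g) (r≤w h))

  -- Distributivity: parallel edges with a common end h have the sum h (g + g′), a single edge with
  -- a weighted end. It can then be charged to either vertex.
  merge-graph : ∀ {n} (h g g′ : Half n) es V → vt g ≡ vt g′ → Solvable (graphForm ((h , merge g g′) ∷ es) V) → Solvable (graphForm ((h , g) ∷ (h , g′) ∷ es) V)
  merge-graph h g@(half v w₁ r₁ _) g′@(half .v w₂ r₂ _) es V refl = Solvable-≗ {F = graphForm ((h , merge g g′) ∷ es) V} λ a x →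
    cong (_+ ⟦ sm (λ v → quadForm (V v) v) ⟧ a x) (lem (⟦ ⟪ h ⟫ ⟧ a x) (+ w₁) (+ w₂) (+ r₁) (+ r₂) (a v) (x v) (⟦ edgesForm es ⟧ a x))
    where lem : ∀ h w₁ w₂ r₁ r₂ a x e → h * ((w₁ + w₂) * a + (r₁ + r₂) * x) + e ≡ h * (w₁ * a + r₁ * x) + (h * (w₂ * a + r₂ * x) + e)
          lem = solve-∀

  addLoop : ∀ {n} → Half n → Half n → (Fin n → Coeffs) → Fin n → Coeffs
  addLoop g h V v with vt g Fin.≟ v
  ... | yes _ = record (V v) { l = w g ℕ.* w h ℕ.+ l (V v) ; β = w g ℕ.* r h ℕ.+ r g ℕ.* w h ℕ.+ β (V v) ; γ = r g ℕ.* r h ℕ.+ γ (V v) }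
  ... | no _  = V v

  addLoop-fine : ∀ {n} (g h : Half n) V → Fine V → Fine (addLoop g h V)
  addLoop-fine g h V (d≤c , loopless) = d≤c′ , loopless′
    where
    d≤c′ : ∀ v → d (addLoop g h V v) ℕ.≤ c (addLoop g h V v)
    d≤c′ v with vt g Fin.≟ v
    ... | yes _ = d≤c v
    ... | no _  = d≤c v
    loopless′ : ∀ v → l (addLoop g h V v) ≡ 0 → β (addLoop g h V v) ≡ 0 × γ (addLoop g h V v) ≡ 0
    loopless′ v l≡0 with vt g Fin.≟ v
    ... | yes _ = contradiction (ℕ.m+n≡0⇒m≡0 (w g ℕ.* w h) l≡0) (ℕ.≢-nonZero⁻¹ (w g ℕ.* w h) {{ℕ.m*n≢0 (w g) (w h)}})
    ... | no _  = loopless v l≡0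

  addLoop-l : ∀ {n} (g h : Half n) V v → l (addLoop g h V v) ≢ 0 → vt g ≡ v ⊎ l (V v) ≢ 0
  addLoop-l g h V v l≢0 with vt g Fin.≟ v
  ... | yes e = inj₁ e
  ... | no _  = inj₂ l≢0

  private
    loop-term : ∀ w₁ r₁ w₂ r₂ l β γ u a x →
      (w₁ * w₂ + l) * (a * a) + (w₁ * r₂ + r₁ * w₂ + β) * (a * x) + (r₁ * r₂ + γ) * (x * x) + u
      ≡ (w₁ * a + r₁ * x) * (w₂ * a + r₂ * x) + (l * (a * a) + β * (a * x) + γ * (x * x) + u)
    loop-term = solve-∀

    quad-eval : Coeffs → ℤ → ℤ → ℤ
    quad-eval q a x = + l q * (a * a) + + β q * (a * x) + + γ q * (x * x) + (+ c q * a + + d q * x)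

    loop-term′ : ∀ w₁ r₁ w₂ r₂ q a x →
      quad-eval (record q { l = w₁ ℕ.* w₂ ℕ.+ l q ; β = w₁ ℕ.* r₂ ℕ.+ r₁ ℕ.* w₂ ℕ.+ β q ; γ = r₁ ℕ.* r₂ ℕ.+ γ q }) a x
      ≡ (+ w₁ * a + + r₁ * x) * (+ w₂ * a + + r₂ * x) + quad-eval q a x
    loop-term′ w₁ r₁ w₂ r₂ q a x = trans
      (cong₂ (λ y z → y * (a * a) + z * (a * x) + + (r₁ ℕ.* r₂ ℕ.+ γ q) * (x * x) + u)
        (cong (_+ + l q) (ℤ.pos-* w₁ w₂)) (cong (_+ + β q) (cong₂ _+_ (ℤ.pos-* w₁ r₂) (ℤ.pos-* r₁ w₂))))
      (trans (cong (λ z → (+ w₁ * + w₂ + + l q) * (a * a) + (+ w₁ * + r₂ + + r₁ * + w₂ + + β q) * (a * x) + (z + + γ q) * (x * x) + u) (ℤ.pos-* r₁ r₂))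
      (loop-term (+ w₁) (+ r₁) (+ w₂) (+ r₂) (+ l q) (+ β q) (+ γ q) u a x))
      where u = + c q * a + + d q * x

  absorb-graph : ∀ {n} (g h : Half n) es V → vt g ≡ vt h → Solvable (graphForm es (addLoop g h V)) → Solvable (graphForm ((g , h) ∷ es) V)
  absorb-graph {n} g@(half u w₁ r₁ _) h@(half .u w₂ r₂ _) es V refl = Solvable-≗ {F = graphForm es (addLoop g h V)} λ a x →
    trans (cong (λ z → ⟦ edgesForm es ⟧ a x + z) (∑-bump u (⟦ ⟪ g ⟫ ⊗ ⟪ h ⟫ ⟧ a x) {λ v → quad-eval (V v) (a v) (x v)} {λ v → quad-eval (addLoop g h V v) (a v) (x v)} (at a x) (off a x)))
      (lem (⟦ edgesForm es ⟧ a x) (⟦ ⟪ g ⟫ ⊗ ⟪ h ⟫ ⟧ a x) (⟦ sm (λ v → quadForm (V v) v) ⟧ a x))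
    where
    lem : ∀ e p s → e + (p + s) ≡ p + e + s
    lem = solve-∀
    at : ∀ (a x : Fin n → ℤ) → quad-eval (addLoop g h V u) (a u) (x u) ≡ (+ w₁ * a u + + r₁ * x u) * (+ w₂ * a u + + r₂ * x u) + quad-eval (V u) (a u) (x u)
    at a x with u Fin.≟ u
    ... | yes _ = loop-term′ w₁ r₁ w₂ r₂ (V u) (a u) (x u)
    ... | no ¬e = contradiction refl ¬e
    off : ∀ (a x : Fin n → ℤ) v → u ≢ v → quad-eval (addLoop g h V v) (a v) (x v) ≡ quad-eval (V v) (a v) (x v)
    off a x v u≢v with u Fin.≟ v
    ... | yes e = contradiction e u≢v
    ... | no _  = refl

  linV-fine : ∀ {n} (c d : Fin n → ℕ) → (∀ v → d v ℕ.≤ c v) → Fine (linV c d)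
  linV-fine c d d≤c = d≤c , λ _ _ → refl , refl

  empty-solvable : ∀ {n} (V : Fin n → Coeffs) → Fine V → Solvable (graphForm [] V)
  empty-solvable V (d≤c , loopless) = graph-solvable [] V d≤c loopless (χ , λ _ _ → []) (λ _ → χ , [])
    where χ : Config []
          χ = record { os = [] ; oriented = [] ; compatible = [] }

  orient : ∀ {n} → Bool → Edge n → Edge n
  orient false e = e
  orient true  e = swap e

  end-at : ∀ {n} → Bool → Edge n → Fin n
  end-at b e = vt (proj₁ (orient b e))

  private
    ⇝-cons : ∀ {n} b (e : Edge n) {es os} → es ⇝ os → (e ∷ es) ⇝ (orient b e ∷ os)
    ⇝-cons false (g , h) o = keep o
    ⇝-cons true  (g , h) o = flip o

  config₁ : ∀ {n} b (e : Edge n) → Config (e ∷ [])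
  config₁ b e = record { os = orient b e ∷ [] ; oriented = ⇝-cons b e [] ; compatible = [] ∷ [] }

  config₂ : ∀ {n} b b′ (e e′ : Edge n) → Compatible (orient b e) (orient b′ e′) → Config (e ∷ e′ ∷ [])
  config₂ b b′ e e′ h = record { os = orient b e ∷ orient b′ e′ ∷ [] ; oriented = ⇝-cons b e (⇝-cons b′ e′ []) ; compatible = (h ∷ []) ∷ [] ∷ [] }

  config₃ : ∀ {n} b b′ b″ (e e′ e″ : Edge n) → Compatible (orient b e) (orient b′ e′) → Compatible (orient b e) (orient b″ e″) → Compatible (orient b′ e′) (orient b″ e″) →
    Config (e ∷ e′ ∷ e″ ∷ [])
  config₃ b b′ b″ e e′ e″ h h′ h″ = record { os = orient b e ∷ orient b′ e′ ∷ orient b″ e″ ∷ [] ; oriented = ⇝-cons b e (⇝-cons b′ e′ (⇝-cons b″ e″ []))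
    ; compatible = (h ∷ h′ ∷ []) ∷ (h″ ∷ []) ∷ [] ∷ [] }

  Proper : ∀ {n} → Edge n → Set
  Proper e = vt (proj₁ e) ≢ vt (proj₂ e)

  avoid₁ : ∀ {n} (e : Edge n) → Proper e → ∀ v → Σ Bool λ b → end-at b e ≢ v
  avoid₁ e pr v with vt (proj₁ e) Fin.≟ v
  ... | no ≢v   = false , ≢v
  ... | yes ≡v  = true , λ ≡v′ → pr (trans ≡v (sym ≡v′))

  -- At the smallest prime all looped vertices are free together, so there the edge must be charged
  -- to an end without a loop.
  edge-solvable : ∀ {n} (e : Edge n) (V : Fin n → Coeffs) → Fine V → Proper e → (Σ Bool λ b → l (V (end-at b e)) ≡ 0) → Solvable (graphForm (e ∷ []) V)
  edge-solvable e V (d≤c , loopless) pr (b , l≡0) = graph-solvable (e ∷ []) V d≤c loopless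
    (config₁ b e , λ v l≢0 → (λ { refl → l≢0 l≡0 }) ∷ [])
    (λ v → let (b , ≢v) = avoid₁ e pr v in config₁ b e , ≢v ∷ [])

  single-solvable : ∀ {n} (g : Pair n) c d → (∀ v → d v ℕ.≤ c v) → Solvable (ed g ⊕ linearPart c d)
  single-solvable g c d d≤c = single-graph g c d (go (proj₁ (proj₁ g) Fin.≟ proj₁ (proj₂ g)))
    where
    go : Dec (proj₁ (proj₁ g) ≡ proj₁ (proj₂ g)) → Solvable (graphForm (⌜ g ⌝₂ ∷ []) (linV c d))
    go (yes e) = absorb-graph ⌜ proj₁ g ⌝ ⌜ proj₂ g ⌝ [] (linV c d) e (empty-solvable (addLoop ⌜ proj₁ g ⌝ ⌜ proj₂ g ⌝ (linV c d)) (addLoop-fine ⌜ proj₁ g ⌝ ⌜ proj₂ g ⌝ (linV c d) (linV-fine c d d≤c)))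
    go (no s≢t) = edge-solvable ⌜ g ⌝₂ (linV c d) (linV-fine c d d≤c) s≢t (false , refl)

-- Two opposite edges and an arbitrary third edge

module OppositeEdges where

  open Block
  open Triangle using (linear)
  open Exact
  open Graph
  open Templates
  open GraphForms
  open import Data.Integer.Base using (_+_; _*_)

  twoOf : ∀ {A : Set} → A → A → Fin 2 → A
  twoOf y₀ y₁ 0F = y₀
  twoOf y₀ y₁ 1F = y₁

  threeOf : ∀ {A : Set} → A → A → A → Fin 3 → A
  threeOf y₀ y₁ y₂ 0F = y₀
  threeOf y₀ y₁ y₂ 1F = y₁
  threeOf y₀ y₁ y₂ 2F = y₂

  twoOf-inj : ∀ {A : Set} {u v : A} → u ≢ v → ∀ {i j} → twoOf u v i ≡ twoOf u v j → i ≡ j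
  twoOf-inj u≢v {0F} {0F} e = refl
  twoOf-inj u≢v {0F} {1F} e = contradiction e u≢v
  twoOf-inj u≢v {1F} {0F} e = contradiction (sym e) u≢v
  twoOf-inj u≢v {1F} {1F} e = refl

  threeOf-inj : ∀ {A : Set} {u v w : A} → u ≢ v → u ≢ w → v ≢ w → ∀ {i j} → threeOf u v w i ≡ threeOf u v w j → i ≡ j
  threeOf-inj uv uw vw {0F} {0F} e = refl
  threeOf-inj uv uw vw {0F} {1F} e = contradiction e uv
  threeOf-inj uv uw vw {0F} {2F} e = contradiction e uw
  threeOf-inj uv uw vw {1F} {0F} e = contradiction (sym e) uv
  threeOf-inj uv uw vw {1F} {1F} e = refl
  threeOf-inj uv uw vw {1F} {2F} e = contradiction e vw
  threeOf-inj uv uw vw {2F} {0F} e = contradiction (sym e) uw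
  threeOf-inj uv uw vw {2F} {1F} e = contradiction (sym e) vw
  threeOf-inj uv uw vw {2F} {2F} e = refl

  xor-cancel : ∀ b f → (b xor f) xor f ≡ b
  xor-cancel true  true  = refl
  xor-cancel true  false = refl
  xor-cancel false true  = refl
  xor-cancel false false = refl

  vx : ∀ {n} → Slot n → Fin n
  vx = proj₁

  module ThreeEdges {n} (c d : Fin n → ℕ) (d≤c : ∀ v → d v ℕ.≤ c v) where

    C D : Fin n → ℤ
    C = +_ ∘ c
    D = +_ ∘ d

    S : Pair n → Pair n → Pair n → Set₁
    S e f g = Solvable (tri e f g C D)

    private
      Lin : (Fin n → ℤ) → (Fin n → ℤ) → ℤ
      Lin a x = ⟦ sm (linear C D) ⟧ a x

    exchange₁₂ : ∀ e f g → S e f g → S f e g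
    exchange₁₂ e f g = Solvable-≗ {F = tri e f g C D} {tri f e g C D} λ a x → lem (⟦ ed e ⟧ a x) (⟦ ed f ⟧ a x) (⟦ ed g ⟧ a x) (Lin a x)
      where lem : ∀ e f g l → e + f + g + l ≡ f + e + g + l
            lem = solve-∀

    exchange₂₃ : ∀ e f g → S e f g → S e g f
    exchange₂₃ e f g = Solvable-≗ {F = tri e f g C D} {tri e g f C D} λ a x → lem (⟦ ed e ⟧ a x) (⟦ ed f ⟧ a x) (⟦ ed g ⟧ a x) (Lin a x)
      where lem : ∀ e f g l → e + f + g + l ≡ e + g + f + l
            lem = solve-∀

    rotate : ∀ e f g → S e f g → S f g e
    rotate e f g s = exchange₂₃ f e g (exchange₁₂ e f g s)

    reverse₁ : ∀ e f g → S (swap e) f g → S e f g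
    reverse₁ e f g = Solvable-≗ {F = tri (swap e) f g C D} {tri e f g C D} λ a x →
      lem (⟦ sl (proj₁ e) ⟧ a x) (⟦ sl (proj₂ e) ⟧ a x) (⟦ ed f ⟧ a x) (⟦ ed g ⟧ a x) (Lin a x)
      where lem : ∀ s t f g l → t * s + f + g + l ≡ s * t + f + g + l
            lem = solve-∀

    reverse₂ : ∀ e f g → S e (swap f) g → S e f g
    reverse₂ e f g s = exchange₁₂ f e g (reverse₁ f e g (exchange₁₂ e (swap f) g s))

    reverse₃ : ∀ e f g → S e f (swap g) → S e f g
    reverse₃ e f g s = exchange₂₃ e g f (reverse₂ e g f (exchange₂₃ e f (swap g) s))

    private
      pendant-case : ∀ {u v w} → u ≢ v → u ≢ w → v ≢ w → ∀ μ ν δ → S ((u , μ) , (v , ν)) ((u , not μ) , (v , not ν)) ((u , μ) , (w , δ))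
      pendant-case {u} {v} {w} uv uw vw μ ν δ = tri-embed ι φ (threeOf-inj uv uw vw) (0F ₀ , 1F ₀) (0F ₁ , 1F ₁) (0F ₀ , 2F ₀) c d d≤c
        (pendant-tri (lift-c ι φ c d) (lift-d ι φ c d))
        where ι = threeOf u v w
              φ = threeOf μ ν δ

      -- Whichever element of the pair at `u` the pendant edge uses, one of the two opposite edges
      -- uses it too; listing that edge first gives `pendant-case`.
      pendant-case′ : ∀ {u v w} → u ≢ v → u ≢ w → v ≢ w → ∀ μ ν κ δ → S ((u , μ) , (v , ν)) ((u , not μ) , (v , not ν)) ((u , κ) , (w , δ))
      pendant-case′ {u} {v} {w} uv uw vw μ ν κ δ with κ Bool.≟ μ
      ... | yes refl = pendant-case uv uw vw κ ν δ
      ... | no κ≢μ   = subst (λ κ → S ((u , μ) , (v , ν)) ((u , not μ) , (v , not ν)) ((u , κ) , (w , δ))) (sym (Bool.¬-not κ≢μ))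
        (exchange₁₂ ((u , not μ) , (v , not ν)) ((u , μ) , (v , ν)) ((u , not μ) , (w , δ))
          (subst₂ (λ m k → S ((u , not μ) , (v , not ν)) ((u , m) , (v , k)) ((u , not μ) , (w , δ))) (not-involutive μ) (not-involutive ν)
            (pendant-case uv uw vw (not μ) (not ν) δ)))

      one-inside : ∀ {u v} → u ≢ v → ∀ μ ν s t → vx s ≡ u ⊎ vx s ≡ v → vx t ≢ u → vx t ≢ v →
        S ((u , μ) , (v , ν)) ((u , not μ) , (v , not ν)) (s , t)
      one-inside {u} {v} uv μ ν (.u , κ) (w , δ) (inj₁ refl) w≢u w≢v = pendant-case′ uv (≢-sym w≢u) (≢-sym w≢v) μ ν κ δ
      one-inside {u} {v} uv μ ν (.v , κ) (w , δ) (inj₂ refl) w≢u w≢v =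
        reverse₁ ((u , μ) , (v , ν)) ((u , not μ) , (v , not ν)) ((v , κ) , (w , δ))
        (reverse₂ ((v , ν) , (u , μ)) ((u , not μ) , (v , not ν)) ((v , κ) , (w , δ))
          (pendant-case′ (≢-sym uv) (≢-sym w≢v) (≢-sym w≢u) ν μ κ δ))

      lift-onto : ∀ {u v : Fin n} {μ ν} s → vx s ≡ u ⊎ vx s ≡ v → Σ (Slot 2) λ s′ → lift (twoOf u v) (twoOf μ ν) s′ ≡ s
      lift-onto {μ = μ} (u , b) (inj₁ refl) = (0F , b xor μ) , cong (u ,_) (xor-cancel b μ)
      lift-onto {ν = ν} (v , b) (inj₂ refl) = (1F , b xor ν) , cong (v ,_) (xor-cancel b ν)

      both-inside : ∀ {u v} → u ≢ v → ∀ μ ν s t → vx s ≡ u ⊎ vx s ≡ v → vx t ≡ u ⊎ vx t ≡ v →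
        S ((u , μ) , (v , ν)) ((u , not μ) , (v , not ν)) (s , t)
      both-inside {u} {v} uv μ ν s t s∈ t∈ = let (s′ , es) = lift-onto {μ = μ} {ν} s s∈ ; (t′ , et) = lift-onto {μ = μ} {ν} t t∈ in
        subst₂ (λ s t → S ((u , μ) , (v , ν)) ((u , not μ) , (v , not ν)) (s , t)) es et
        (tri-embed ι φ (twoOf-inj uv) (0F ₀ , 1F ₀) (0F ₁ , 1F ₁) (s′ , t′) c d d≤c (thirdEdge-tri (lift-c ι φ c d) (lift-d ι φ c d) s′ t′))
        where ι = twoOf u v
              φ = twoOf μ ν

      sl-off : ∀ (s : Slot n) {a a′ x} → a (vx s) ≡ a′ (vx s) → ⟦ sl s ⟧ a x ≡ ⟦ sl s ⟧ a′ x
      sl-off (v , true)  {x = x} e = cong (_+ x v) e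
      sl-off (v , false) e = e

      -- The opposite edges and the linear terms at their vertices are made constant; the third edge
      -- meets neither vertex and is solved by itself.
      none-inside : ∀ {u v} → u ≢ v → ∀ μ ν s t → vx s ≢ u → vx s ≢ v → vx t ≢ u → vx t ≢ v →
        S ((u , μ) , (v , ν)) ((u , not μ) , (v , not ν)) (s , t)
      none-inside {u} {v} uv μ ν s t su sv tu tv = exact-extend {T = T} {tri e f (s , t) C D} {ed (s , t) ⊕ linearPart c′ d′} ι (twoOf-inj uv) φ (twoEdges-exact c″ d″)
        split indep (single-solvable (s , t) c′ d′ (erase-mono ι d≤c))
        where
        ι = twoOf u v
        φ = twoOf μ ν
        c′ = erase ι c
        d′ = erase ι d
        c″ = lift-c ι φ c d
        d″ = lift-d ι φ c d
        T = twoEdges c″ d″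
        e f : Pair n
        e = (u , μ) , (v , ν)
        f = (u , not μ) , (v , not ν)
        lem : ∀ e f g l₀ l₁ r → e + f + g + (l₀ + (l₁ + 0ℤ) + r) ≡ g + r + (e + f + (l₀ + l₁))
        lem = solve-∀
        split : ∀ a x → ⟦ tri e f (s , t) C D ⟧ a x ≡ ⟦ ed (s , t) ⊕ linearPart c′ d′ ⟧ a x + ⟦ place T ι φ ⟧ a x
        split a x = trans (cong₂ (λ y z → y + ⟦ ed (s , t) ⟧ a x + z) (cong₂ _+_ (⟦ed-lift⟧ ι φ (0F ₀ , 1F ₀) a x) (⟦ed-lift⟧ ι φ (0F ₁ , 1F ₁) a x)) (linear-split ι φ (twoOf-inj uv) c d a x))
          (trans (lem (⟦ ed (0F ₀ , 1F ₀) ⟧ A X) (⟦ ed (0F ₁ , 1F ₁) ⟧ A X) (⟦ ed (s , t) ⟧ a x) (⟦ linear c″ d″ 0F ⟧ A X) (⟦ linear c″ d″ 1F ⟧ A X) (⟦ linearPart c′ d′ ⟧ a x))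
          (cong (λ z → ⟦ ed (s , t) ⊕ linearPart c′ d′ ⟧ a x + z) (sym (⟦place⟧ T ι φ a x))))
          where A = els ι φ a x
                X = dfs ι φ a x
        out : ∀ {w} → w ≢ u → w ≢ v → ∀ i → ι i ≢ w
        out wu wv 0F e = wu (sym e)
        out wu wv 1F e = wv (sym e)
        unused : ∀ {k a a′ x} → k ≡ 0 → + k * a + x ≡ + k * a′ + x
        unused refl = refl
        indep : ∀ {a a′} x → (∀ w → (∀ i → ι i ≢ w) → a w ≡ a′ w) → ⟦ ed (s , t) ⊕ linearPart c′ d′ ⟧ a x ≡ ⟦ ed (s , t) ⊕ linearPart c′ d′ ⟧ a′ x
        indep {a} {a′} x h = cong₂ _+_ (cong₂ _*_ (sl-off s (h (vx s) (out su sv))) (sl-off t (h (vx t) (out tu tv)))) (∑-cong (λ w → at w (w Fin.≟ u) (w Fin.≟ v)))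
          where
          at : ∀ w → Dec (w ≡ u) → Dec (w ≡ v) → + c′ w * a w + + d′ w * x w ≡ + c′ w * a′ w + + d′ w * x w
          at w (yes refl) _          = unused {a = a w} {a′ w} {+ d′ w * x w} (erase-avoids ι c 0F)
          at w (no _)     (yes refl) = unused {a = a w} {a′ w} {+ d′ w * x w} (erase-avoids ι c 1F)
          at w (no wu)    (no wv)    = cong (λ y → + c′ w * y + + d′ w * x w) (h w (out wu wv))

    opposite : ∀ {u v} → u ≢ v → ∀ μ ν g → S ((u , μ) , (v , ν)) ((u , not μ) , (v , not ν)) g
    opposite {u} {v} uv μ ν (s , t) = go (vx s Fin.≟ u) (vx s Fin.≟ v) (vx t Fin.≟ u) (vx t Fin.≟ v)
      where
      Goal = S ((u , μ) , (v , ν)) ((u , not μ) , (v , not ν)) (s , t)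
      inside? : ∀ {w} → Dec (w ≡ u) → Dec (w ≡ v) → (w ≡ u ⊎ w ≡ v) ⊎ (w ≢ u × w ≢ v)
      inside? (yes e) _       = inj₁ (inj₁ e)
      inside? (no _)  (yes e) = inj₁ (inj₂ e)
      inside? (no wu) (no wv) = inj₂ (wu , wv)
      go′ : (vx s ≡ u ⊎ vx s ≡ v) ⊎ (vx s ≢ u × vx s ≢ v) → (vx t ≡ u ⊎ vx t ≡ v) ⊎ (vx t ≢ u × vx t ≢ v) → Goal
      go′ (inj₁ s∈)        (inj₁ t∈)        = both-inside uv μ ν s t s∈ t∈
      go′ (inj₁ s∈)        (inj₂ (tu , tv)) = one-inside uv μ ν s t s∈ tu tv
      go′ (inj₂ (su , sv)) (inj₁ t∈)        = reverse₃ ((u , μ) , (v , ν)) ((u , not μ) , (v , not ν)) (s , t) (one-inside uv μ ν t s t∈ su sv)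
      go′ (inj₂ (su , sv)) (inj₂ (tu , tv)) = none-inside uv μ ν s t su sv tu tv
      go : Dec (vx s ≡ u) → Dec (vx s ≡ v) → Dec (vx t ≡ u) → Dec (vx t ≡ v) → Goal
      go su sv tu tv = go′ (inside? su sv) (inside? tu tv)

-- Distinct representatives for edges

module Representatives where

  open Block
  open Exact
  open Graph
  open Templates
  open GraphForms
  open OppositeEdges

  open Half
  open Coeffs

  data Ends {n} (e : Edge n) : Fin n → Fin n → Set where
    ends : ∀ b → Ends e (end-at b e) (end-at (not b) e)

  reversed : ∀ {n} {e : Edge n} {p q} → Ends e p q → Ends e q p
  reversed (ends false) = ends true
  reversed (ends true)  = ends false

  Ends-≢ : ∀ {n} {e : Edge n} → Proper e → ∀ {p q} → Ends e p q → p ≢ q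
  Ends-≢ pr (ends false) = pr
  Ends-≢ pr (ends true)  = ≢-sym pr

  Ends? : ∀ {n} (e : Edge n) p q → Dec (Ends e p q)
  Ends? e p q with vt (proj₁ e) Fin.≟ p | vt (proj₂ e) Fin.≟ q | vt (proj₁ e) Fin.≟ q | vt (proj₂ e) Fin.≟ p
  ... | yes refl | yes refl | _        | _        = yes (ends false)
  ... | _        | _        | yes refl | yes refl = yes (ends true)
  ... | no ¬h    | _        | no ¬k    | _        = no λ { (ends false) → ¬h refl ; (ends true) → ¬k refl }
  ... | no ¬h    | _        | _        | no ¬k    = no λ { (ends false) → ¬h refl ; (ends true) → ¬k refl }
  ... | _        | no ¬h    | no ¬k    | _        = no λ { (ends false) → ¬h refl ; (ends true) → ¬k refl }
  ... | _        | no ¬h    | _        | no ¬k    = no λ { (ends false) → ¬h refl ; (ends true) → ¬k refl }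

  Parallel : ∀ {n} → Edge n → Edge n → Set
  Parallel e f = Ends f (vt (proj₁ e)) (vt (proj₂ e))

  parallel : ∀ {n} {e f : Edge n} {p q} → Ends e p q → Ends f p q → Parallel e f
  parallel (ends false) h = h
  parallel (ends true)  h = reversed h

  -- Charging each edge to its representative leaves `w` free, and distinctness makes compatibility
  -- vacuous.
  record SDR₂ {n} (e f : Edge n) (w : Fin n) : Set where
    constructor sdr
    field
      {x x′ y y′} : Fin n
      on-e : Ends e x x′
      on-f : Ends f y y′
      x≢w  : x ≢ w
      y≢w  : y ≢ w
      x≢y  : x ≢ y

  record SDR₃ {n} (e f g : Edge n) (w : Fin n) : Set where
    constructor sdr
    field
      {x x′ y y′ z z′} : Fin n
      on-e : Ends e x x′
      on-f : Ends f y y′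
      on-g : Ends g z z′
      x≢w  : x ≢ w
      y≢w  : y ≢ w
      z≢w  : z ≢ w
      x≢y  : x ≢ y
      x≢z  : x ≢ z
      y≢z  : y ≢ z

  Triangular : ∀ {n} → Edge n → Edge n → Edge n → Set
  Triangular e f g = ∃ λ a → ∃ λ b → ∃ λ c → Ends e a b × Ends f b c × Ends g c a

  private
    data Among {n} (w x y p : Fin n) : Set where
      is-w : p ≡ w → Among w x y p
      is-x : p ≡ x → Among w x y p
      is-y : p ≡ y → Among w x y p
      else : p ≢ w → p ≢ x → p ≢ y → Among w x y p

    among : ∀ {n} (w x y p : Fin n) → Among w x y p
    among w x y p with p Fin.≟ w | p Fin.≟ x | p Fin.≟ y
    ... | yes e | _     | _     = is-w e
    ... | no _  | yes e | _     = is-x e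
    ... | no _  | no _  | yes e = is-y e
    ... | no h  | no k  | no j  = else h k j

    data Choice {n} (e : Edge n) (w x y : Fin n) : Set where
      new : ∀ {z z′} → Ends e z z′ → z ≢ w → z ≢ x → z ≢ y → Choice e w x y
      wx  : Ends e w x → Choice e w x y
      wy  : Ends e w y → Choice e w x y
      xy  : Ends e x y → Choice e w x y

    choice : ∀ {n} {e : Edge n} {p q} → Ends e p q → p ≢ q → ∀ w x y → Choice e w x y
    choice {e = e} {p} {q} e∼ p≢q w x y = go (among w x y p) (among w x y q) e∼
      where
      go : Among w x y p → Among w x y q → Ends e p q → Choice e w x y
      go (else h k j) _            e∼ = new e∼ h k j
      go _            (else h k j) e∼ = new (reversed e∼) h k j
      go (is-w refl)  (is-w e)     e∼ = contradiction (sym e) p≢q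
      go (is-w refl)  (is-x refl)  e∼ = wx e∼
      go (is-w refl)  (is-y refl)  e∼ = wy e∼
      go (is-x refl)  (is-w refl)  e∼ = wx (reversed e∼)
      go (is-x refl)  (is-x e)     e∼ = contradiction (sym e) p≢q
      go (is-x refl)  (is-y refl)  e∼ = xy e∼
      go (is-y refl)  (is-w refl)  e∼ = wy (reversed e∼)
      go (is-y refl)  (is-x refl)  e∼ = xy (reversed e∼)
      go (is-y refl)  (is-y e)     e∼ = contradiction (sym e) p≢q

  -- Let e first take an end x ≠ w. If f offers nothing outside w and x, its ends are exactly these;
  -- since e is not parallel to f, the other end of e is not w, so e can move there and f takes x.
  sdr₂ : ∀ {n} (e f : Edge n) → Proper e → Proper f → ¬ Parallel e f → ∀ w → SDR₂ e f w
  sdr₂ e f pe pf ¬par w = let (b , x≢w) = avoid₁ e pe w in go (ends b) x≢w (_ Fin.≟ w)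
    where
    go : ∀ {x x′} → Ends e x x′ → x ≢ w → Dec (x′ ≡ w) → SDR₂ e f w
    go {x} {x′} ex x≢w x′≟w with choice {e = f} (ends false) pf w x x | x′≟w
    ... | new fy y≢w y≢x _ | _        = sdr ex fy x≢w y≢w (≢-sym y≢x)
    ... | xy fxx           | _        = contradiction refl (Ends-≢ pf fxx)
    ... | wx fwx           | yes refl = contradiction (parallel (reversed ex) fwx) ¬par
    ... | wy fwx           | yes refl = contradiction (parallel (reversed ex) fwx) ¬par
    ... | wx fwx           | no x′≢w  = sdr (reversed ex) (reversed fwx) x′≢w x≢w (≢-sym (Ends-≢ pe ex))
    ... | wy fwx           | no x′≢w  = sdr (reversed ex) (reversed fwx) x′≢w x≢w (≢-sym (Ends-≢ pe ex))

  -- Augmenting paths; the only obstruction is a triangle.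
  sdr₃ : ∀ {n} (e f g : Edge n) → Proper e → Proper f → Proper g → ¬ Parallel e f → ¬ Parallel e g → ¬ Parallel f g →
    ∀ w → SDR₃ e f g w ⊎ Triangular e f g
  sdr₃ {n} e f g pe pf pg ¬ef ¬eg ¬fg w = start (sdr₂ e f pe pf ¬ef w)
    where
    shift : ∀ {e f x x′ y y′} → Proper e → Proper f → ¬ Parallel e f → ¬ Parallel e g → Ends e x x′ → Ends f y y′ → x ≢ w → y ≢ w → x ≢ y → Ends g w x →
      SDR₃ e f g w ⊎ Triangular e f g
    shift {e} {f} {x} {x′} {y} {y′} pe pf ¬ef ¬eg ex fy x≢w y≢w x≢y gw with x′ Fin.≟ w | x′ Fin.≟ y | y′ Fin.≟ w | y′ Fin.≟ x
    ... | yes refl | _        | _        | _        = contradiction (parallel (reversed ex) gw) ¬eg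
    ... | no x′≢w  | no x′≢y  | _        | _        = inj₁ (sdr (reversed ex) fy (reversed gw) x′≢w y≢w x≢w x′≢y (≢-sym (Ends-≢ pe ex)) (≢-sym x≢y))
    ... | no _     | yes refl | yes refl | _        = inj₂ (x , y , w , ex , fy , gw)
    ... | no _     | yes refl | no _     | yes refl = contradiction (parallel (reversed ex) fy) ¬ef
    ... | no x′≢w  | yes refl | no y′≢w  | no y′≢x  = inj₁ (sdr (reversed ex) (reversed fy) (reversed gw) x′≢w y′≢w x≢w (Ends-≢ pf fy) (≢-sym x≢y) y′≢x)
    across : ∀ {x x′ y y′} → Ends e x x′ → Ends f y y′ → x ≢ w → y ≢ w → x ≢ y → Ends g x y → SDR₃ e f g w ⊎ Triangular e f g
    across {x} {x′} {y} {y′} ex fy x≢w y≢w x≢y gxy with x′ Fin.≟ w | x′ Fin.≟ y | y′ Fin.≟ w | y′ Fin.≟ x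
    ... | _        | yes refl | _        | _        = contradiction (parallel ex gxy) ¬eg
    ... | _        | _        | _        | yes refl = contradiction (parallel (reversed fy) gxy) ¬fg
    ... | no x′≢w  | no x′≢y  | _        | _        = inj₁ (sdr (reversed ex) fy gxy x′≢w y≢w x≢w x′≢y (≢-sym (Ends-≢ pe ex)) (≢-sym x≢y))
    ... | yes refl | no _     | no y′≢w  | no y′≢x  = inj₁ (sdr ex (reversed fy) (reversed gxy) x≢w y′≢w y≢w (≢-sym y′≢x) x≢y (≢-sym (Ends-≢ pf fy)))
    ... | yes refl | no _     | yes refl | no _     = inj₂ (x , w , y , ex , reversed fy , reversed gxy)
    exchange : SDR₃ f e g w ⊎ Triangular f e g → SDR₃ e f g w ⊎ Triangular e f g
    exchange (inj₁ (sdr fx ey gz x≢w y≢w z≢w x≢y x≢z y≢z)) = inj₁ (sdr ey fx gz y≢w x≢w z≢w (≢-sym x≢y) y≢z x≢z)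
    exchange (inj₂ (a , b , c , fab , ebc , gca)) = inj₂ (c , b , a , reversed ebc , reversed fab , reversed gca)
    start : SDR₂ e f w → SDR₃ e f g w ⊎ Triangular e f g
    start (sdr {x} {x′} {y} {y′} ex fy x≢w y≢w x≢y) with choice {e = g} (ends false) pg w x y
    ... | new gz z≢w z≢x z≢y = inj₁ (sdr ex fy gz x≢w y≢w z≢w x≢y (≢-sym z≢x) (≢-sym z≢y))
    ... | wx gwx = shift pe pf ¬ef ¬eg ex fy x≢w y≢w x≢y gwx
    ... | wy gwy = exchange (shift pf pe (λ fe → ¬ef (parallel fe (ends false))) ¬fg fy ex y≢w x≢w (≢-sym x≢y) gwy)
    ... | xy gxy = across ex fy x≢w y≢w x≢y gxy

  config-sdr₂ : ∀ {n} {e f : Edge n} {w} → SDR₂ e f w → Σ (Config (e ∷ f ∷ [])) λ χ → Free w (Config.os χ)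
  config-sdr₂ {e = e} {f} (sdr (ends b) (ends b′) x≢w y≢w x≢y) = config₂ b b′ e f (λ x≡y → contradiction x≡y x≢y) , x≢w ∷ y≢w ∷ []

  config-sdr₃ : ∀ {n} {e f g : Edge n} {w} → SDR₃ e f g w → Σ (Config (e ∷ f ∷ g ∷ [])) λ χ → Free w (Config.os χ)
  config-sdr₃ {e = e} {f} {g} (sdr (ends b) (ends b′) (ends b″) x≢w y≢w z≢w x≢y x≢z y≢z) =
    config₃ b b′ b″ e f g (λ x≡y → contradiction x≡y x≢y) (λ x≡z → contradiction x≡z x≢z) (λ y≡z → contradiction y≡z y≢z)
    , x≢w ∷ y≢w ∷ z≢w ∷ []

  ∀-⊎ : ∀ {n} {P : Fin n → Set} {Q : Set} → (∀ v → P v ⊎ Q) → (∀ v → P v) ⊎ Q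
  ∀-⊎ {zero}  h = inj₁ λ ()
  ∀-⊎ {suc n} h with h zero | ∀-⊎ (h ∘ suc)
  ... | inj₂ q | _      = inj₂ q
  ... | inj₁ _ | inj₂ q = inj₂ q
  ... | inj₁ p | inj₁ f = inj₁ λ { zero → p ; (suc v) → f v }

  twoEdges-graph : ∀ {n} (e f : Edge n) (V : Fin n → Coeffs) → Fine V → Proper e → Proper f → ¬ Parallel e f →
    (p : Fin n) → (∀ v → l (V v) ≢ 0 → p ≡ v) → Solvable (graphForm (e ∷ f ∷ []) V)
  twoEdges-graph e f V (d≤c , loopless) pe pf ¬par p only = graph-solvable (e ∷ f ∷ []) V d≤c loopless
    (let (χ , fr) = χ p in χ , λ v l≢0 → subst (λ v → Free v (Config.os χ)) (only v l≢0) fr) χ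
    where χ = λ v → config-sdr₂ (sdr₂ e f pe pf ¬par v)

  Opposite : ∀ {n} → Pair n → Pair n → Set
  Opposite ((u , μ) , (v , ν)) ((u′ , μ′) , (v′ , ν′)) = (u ≡ u′ × v ≡ v′) × (μ′ ≡ not μ × ν′ ≡ not ν)

  Opposite? : ∀ {n} (e f : Pair n) → Dec (Opposite e f)
  Opposite? ((u , μ) , (v , ν)) ((u′ , μ′) , (v′ , ν′)) = ((u Fin.≟ u′) ×-dec (v Fin.≟ v′)) ×-dec ((μ′ Bool.≟ not μ) ×-dec (ν′ Bool.≟ not ν))

  Clashing : ∀ {n} → Pair n → Pair n → Set
  Clashing e f = Opposite e f ⊎ Opposite e (swap f)

  Clashing? : ∀ {n} (e f : Pair n) → Dec (Clashing e f)
  Clashing? e f = Opposite? e f ⊎-dec Opposite? e (swap f)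

  Clashing-swap : ∀ {n} (e f : Pair n) → Clashing (swap e) f → Clashing e f
  Clashing-swap e f (inj₁ ((h , k) , (i , j))) = inj₂ ((k , h) , (j , i))
  Clashing-swap e f (inj₂ ((h , k) , (i , j))) = inj₁ ((k , h) , (j , i))

  Clashing-swap′ : ∀ {n} (e f : Pair n) → Clashing e (swap f) → Clashing e f
  Clashing-swap′ e f (inj₁ h) = inj₂ h
  Clashing-swap′ e f (inj₂ h) = inj₁ h

-- All graphs with three edges

module ThreeEdgeForms where

  open Block
  open Exact
  open Graph
  open Templates
  open GraphForms
  open OppositeEdges
  open Representatives

  open Half
  open Coeffs

  private
    ¬same : ∀ {a b : Bool} → a ≢ b → b ≡ not a
    ¬same a≢b = Bool.¬-not (≢-sym a≢b)

    aligned : ∀ {n} (e : Pair n) {p q} → Ends ⌜ e ⌝₂ p q → (vx (proj₁ e) ≡ p × vx (proj₂ e) ≡ q) ⊎ (vx (proj₁ e) ≡ q × vx (proj₂ e) ≡ p)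
    aligned e (ends false) = inj₁ (refl , refl)
    aligned e (ends true)  = inj₂ (refl , refl)

  private
    Clashing-sym : ∀ {n} (e f : Pair n) → Clashing e f → Clashing f e
    Clashing-sym ((u , μ) , (v , ν)) _ (inj₁ ((refl , refl) , (refl , refl))) = inj₁ ((refl , refl) , (sym (not-involutive μ) , sym (not-involutive ν)))
    Clashing-sym ((u , μ) , (v , ν)) _ (inj₂ ((refl , refl) , (refl , refl))) = inj₂ ((refl , refl) , (sym (not-involutive ν) , sym (not-involutive μ)))

  module _ {n} (c d : Fin n → ℕ) (d≤c : ∀ v → d v ℕ.≤ c v) where

    open ThreeEdges c d d≤c

    private
      V : Fin n → Coeffs
      V = linV c d

      V-fine : Fine V
      V-fine = linV-fine c d d≤c

      ProperP : Pair n → Set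
      ProperP e = vx (proj₁ e) ≢ vx (proj₂ e)

      looped : Pair n → (Fin n → Coeffs) → Fin n → Coeffs
      looped p = addLoop ⌜ proj₁ p ⌝ ⌜ proj₂ p ⌝

      looped-fine : ∀ p {V} → Fine V → Fine (looped p V)
      looped-fine p {V} = addLoop-fine ⌜ proj₁ p ⌝ ⌜ proj₂ p ⌝ V

      only-loop : ∀ p v → l (looped p V v) ≢ 0 → vx (proj₁ p) ≡ v
      only-loop p v l≢0 with addLoop-l ⌜ proj₁ p ⌝ ⌜ proj₂ p ⌝ V v l≢0
      ... | inj₁ e = e
      ... | inj₂ h = contradiction refl h

      loops₃ : ∀ e f g → vx (proj₁ e) ≡ vx (proj₂ e) → vx (proj₁ f) ≡ vx (proj₂ f) → vx (proj₁ g) ≡ vx (proj₂ g) → S e f g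
      loops₃ e f g he hf hg = tri-graph e f g c d
        (absorb-graph ⌜ proj₁ e ⌝ ⌜ proj₂ e ⌝ (⌜ f ⌝₂ ∷ ⌜ g ⌝₂ ∷ []) V he
        (absorb-graph ⌜ proj₁ f ⌝ ⌜ proj₂ f ⌝ (⌜ g ⌝₂ ∷ []) (looped e V) hf
        (absorb-graph ⌜ proj₁ g ⌝ ⌜ proj₂ g ⌝ [] (looped f (looped e V)) hg
        (empty-solvable (looped g (looped f (looped e V))) (looped-fine g (looped-fine f (looped-fine e V-fine)))))))

      loops₂-across : ∀ (p q : Slot n × Slot n) u v μ ν → u ≢ v → vx (proj₁ p) ≡ vx (proj₂ p) → vx (proj₁ q) ≡ vx (proj₂ q) → vx (proj₁ p) ≡ u → vx (proj₁ q) ≡ v →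
        S p q ((u , μ) , (v , ν))
      loops₂-across ((u , π) , (.u , π′)) ((v , κ) , (.v , κ′)) .u .v μ ν uv refl refl refl refl =
        subst₂ (λ p q → S p q ((u , μ) , (v , ν))) (cong₂ _,_ (cong (u ,_) (xor-cancel π μ)) (cong (u ,_) (xor-cancel π′ μ))) (cong₂ _,_ (cong (v ,_) (xor-cancel κ ν)) (cong (v ,_) (xor-cancel κ′ ν)))
          (tri-embed ι φ (twoOf-inj uv) ((0F , π xor μ) , (0F , π′ xor μ)) ((1F , κ xor ν) , (1F , κ′ xor ν)) (0F ₀ , 1F ₀) c d d≤c
            (loopedEdge-tri (lift-c ι φ c d) (lift-d ι φ c d) (π xor μ) (π′ xor μ) (κ xor ν) (κ′ xor ν)))
        where
        ι = twoOf u v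
        φ = twoOf μ ν

      -- If an end of `g` has no loop, `g` can be charged to it. Otherwise the two loops sit at
      -- different ends of `g`, which is the looped edge.
      loops₂ : ∀ p q g → vx (proj₁ p) ≡ vx (proj₂ p) → vx (proj₁ q) ≡ vx (proj₂ q) → ProperP g → S p q g
      loops₂ p q g hp hq pg = go (l (W u) ℕ.≟ 0) (l (W v) ℕ.≟ 0)
        where
        u = vx (proj₁ g)
        v = vx (proj₂ g)
        W = looped q (looped p V)
        free-end : (Σ Bool λ b → l (W (end-at b ⌜ g ⌝₂)) ≡ 0) → S p q g
        free-end h = tri-graph p q g c d
          (absorb-graph ⌜ proj₁ p ⌝ ⌜ proj₂ p ⌝ (⌜ q ⌝₂ ∷ ⌜ g ⌝₂ ∷ []) V hp
          (absorb-graph ⌜ proj₁ q ⌝ ⌜ proj₂ q ⌝ (⌜ g ⌝₂ ∷ []) (looped p V) hq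
          (edge-solvable ⌜ g ⌝₂ W (looped-fine q (looped-fine p V-fine)) pg h)))
        at : ∀ w → l (W w) ≢ 0 → vx (proj₁ q) ≡ w ⊎ vx (proj₁ p) ≡ w
        at w l≢0 with addLoop-l ⌜ proj₁ q ⌝ ⌜ proj₂ q ⌝ (looped p V) w l≢0
        ... | inj₁ e = inj₁ e
        ... | inj₂ h = inj₂ (only-loop p w h)
        across : vx (proj₁ q) ≡ u ⊎ vx (proj₁ p) ≡ u → vx (proj₁ q) ≡ v ⊎ vx (proj₁ p) ≡ v → S p q g
        across (inj₁ e) (inj₁ e′) = contradiction (trans (sym e) e′) pg
        across (inj₂ e) (inj₂ e′) = contradiction (trans (sym e) e′) pg
        across (inj₂ e) (inj₁ e′) = loops₂-across p q u v (proj₂ (proj₁ g)) (proj₂ (proj₂ g)) pg hp hq e e′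
        across (inj₁ e) (inj₂ e′) = exchange₁₂ q p g (loops₂-across q p u v (proj₂ (proj₁ g)) (proj₂ (proj₂ g)) pg hq hp e e′)
        go : Dec (l (W u) ≡ 0) → Dec (l (W v) ≡ 0) → S p q g
        go (yes h) _       = free-end (false , h)
        go (no _)  (yes h) = free-end (true , h)
        go (no h)  (no k)  = across (at u h) (at v k)

      merge₃ : ∀ s t t′ t″ → vx t ≡ vx t′ → vx t ≡ vx t″ → vx s ≢ vx t → S (s , t) (s , t′) (s , t″)
      merge₃ s t t′ t″ e e′ s≢t = tri-graph (s , t) (s , t′) (s , t″) c d
        (merge-graph ⌜ s ⌝ ⌜ t ⌝ ⌜ t′ ⌝ (⌜ s , t″ ⌝₂ ∷ []) V e
        (merge-graph ⌜ s ⌝ (merge ⌜ t ⌝ ⌜ t′ ⌝) ⌜ t″ ⌝ [] V e′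
        (edge-solvable (⌜ s ⌝ , merge (merge ⌜ t ⌝ ⌜ t′ ⌝) ⌜ t″ ⌝) V V-fine s≢t (false , refl))))

      -- If `g` uses the other element at the vertex of `s`, then, clashing with neither edge, it
      -- must agree with both at the vertex of `t`; so in any case the three edges have a half-edge
      -- in common.
      merge₂-aligned : ∀ s t t′ g → vx t ≡ vx t′ → vx s ≢ vx t → vx s ≡ vx (proj₁ g) → vx t ≡ vx (proj₂ g) → ¬ Clashing (s , t) g → ¬ Clashing (s , t′) g → S (s , t) (s , t′) g
      merge₂-aligned (u , μ) (v , ν) (.v , ν′) ((.u , κ) , (.v , λ′)) refl s≢t refl refl ¬cl ¬cl′ with μ Bool.≟ κ | ν Bool.≟ λ′ | ν′ Bool.≟ λ′
      ... | yes refl | _        | _        = merge₃ (u , μ) (v , ν) (v , ν′) (v , λ′) refl refl s≢t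
      ... | no μ≢κ   | no ν≢λ   | _        = contradiction (inj₁ ((refl , refl) , (¬same μ≢κ , ¬same ν≢λ))) ¬cl
      ... | no μ≢κ   | _        | no ν′≢λ  = contradiction (inj₁ ((refl , refl) , (¬same μ≢κ , ¬same ν′≢λ))) ¬cl′
      ... | no μ≢κ   | yes refl | yes refl = reverse₁ ((u , μ) , (v , ν)) ((u , μ) , (v , ν)) ((u , κ) , (v , ν))
        (reverse₂ ((v , ν) , (u , μ)) ((u , μ) , (v , ν)) ((u , κ) , (v , ν)) (reverse₃ ((v , ν) , (u , μ)) ((v , ν) , (u , μ)) ((u , κ) , (v , ν))
          (merge₃ (v , ν) (u , μ) (u , μ) (u , κ) refl refl (≢-sym s≢t))))

      merge₂ : ∀ s t t′ g → vx t ≡ vx t′ → vx s ≢ vx t → (ProperP g → ¬ Clashing (s , t) g × ¬ Clashing (s , t′) g) → S (s , t) (s , t′) g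
      merge₂ s t t′ g e s≢t ¬cl with vx (proj₁ g) Fin.≟ vx (proj₂ g)
      ... | yes g-loop = rotate g (s , t) (s , t′) (tri-graph g (s , t) (s , t′) c d
        (absorb-graph ⌜ proj₁ g ⌝ ⌜ proj₂ g ⌝ (⌜ s , t ⌝₂ ∷ ⌜ s , t′ ⌝₂ ∷ []) V g-loop
        (merge-graph ⌜ s ⌝ ⌜ t ⌝ ⌜ t′ ⌝ [] (looped g V) e
        (edge-solvable (⌜ s ⌝ , merge ⌜ t ⌝ ⌜ t′ ⌝) (looped g V) (looped-fine g V-fine) s≢t (unlooped (avoid₁ (⌜ s ⌝ , merge ⌜ t ⌝ ⌜ t′ ⌝) s≢t (vx (proj₁ g))))))))
        where
        unlooped : (Σ Bool λ b → end-at b (⌜ s ⌝ , merge ⌜ t ⌝ ⌜ t′ ⌝) ≢ vx (proj₁ g)) → Σ Bool λ b → l (looped g V (end-at b (⌜ s ⌝ , merge ⌜ t ⌝ ⌜ t′ ⌝))) ≡ 0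
        unlooped (b , off) with l (looped g V (end-at b (⌜ s ⌝ , merge ⌜ t ⌝ ⌜ t′ ⌝))) ℕ.≟ 0
        ... | yes l≡0 = b , l≡0
        ... | no l≢0  = contradiction (sym (only-loop g _ l≢0)) off
      ... | no pg = go (Ends? ⌜ g ⌝₂ (vx s) (vx t))
        where
        go : Dec (Ends ⌜ g ⌝₂ (vx s) (vx t)) → S (s , t) (s , t′) g
        go (yes par) with aligned g par
        ... | inj₁ (h , k) = merge₂-aligned s t t′ g e s≢t (sym h) (sym k) (proj₁ (¬cl pg)) (proj₂ (¬cl pg))
        ... | inj₂ (h , k) = reverse₃ (s , t) (s , t′) g (merge₂-aligned s t t′ (swap g) e s≢t (sym k) (sym h)
          (λ cl → proj₁ (¬cl pg) (Clashing-swap′ (s , t) g cl)) (λ cl → proj₂ (¬cl pg) (Clashing-swap′ (s , t′) g cl)))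
        go (no ¬par) = tri-graph (s , t) (s , t′) g c d (merge-graph ⌜ s ⌝ ⌜ t ⌝ ⌜ t′ ⌝ (⌜ g ⌝₂ ∷ []) V e
          (twoEdges-graph (⌜ s ⌝ , merge ⌜ t ⌝ ⌜ t′ ⌝) ⌜ g ⌝₂ V V-fine s≢t pg ¬par (vx s) (λ v l≢0 → contradiction refl l≢0)))

      parallel-aligned : ∀ e f g → ProperP e → vx (proj₁ e) ≡ vx (proj₁ f) → vx (proj₂ e) ≡ vx (proj₂ f) → ¬ Clashing e f → (ProperP g → ¬ Clashing e g × ¬ Clashing f g) → S e f g
      parallel-aligned ((u , μ) , (v , ν)) ((.u , κ) , (.v , λ′)) g pe refl refl ¬ef ¬cl with μ Bool.≟ κ | ν Bool.≟ λ′
      ... | yes refl | _        = merge₂ (u , μ) (v , ν) (v , λ′) g refl pe ¬cl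
      ... | no μ≢κ   | no ν≢λ   = contradiction (inj₁ ((refl , refl) , (¬same μ≢κ , ¬same ν≢λ))) ¬ef
      ... | no _     | yes refl = reverse₁ ((u , μ) , (v , ν)) ((u , κ) , (v , ν)) g (reverse₂ ((v , ν) , (u , μ)) ((u , κ) , (v , ν)) g
        (merge₂ (v , ν) (u , μ) (u , κ) g refl (≢-sym pe) (λ pg → (λ cl → proj₁ (¬cl pg) (Clashing-swap _ g cl)) , (λ cl → proj₂ (¬cl pg) (Clashing-swap _ g cl)))))

      parallel-pair : ∀ e f g → ProperP e → Parallel ⌜ e ⌝₂ ⌜ f ⌝₂ → ¬ Clashing e f → (ProperP g → ¬ Clashing e g × ¬ Clashing f g) → S e f g
      parallel-pair e f g pe par ¬ef ¬cl with aligned f par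
      ... | inj₁ (h , k) = parallel-aligned e f g pe (sym h) (sym k) ¬ef ¬cl
      ... | inj₂ (h , k) = reverse₂ e f g (parallel-aligned e (swap f) g pe (sym k) (sym h) (λ cl → ¬ef (Clashing-swap′ e f cl))
        (λ pg → proj₁ (¬cl pg) , λ cl → proj₂ (¬cl pg) (Clashing-swap f g cl)))

      clashing-pair : ∀ e f g → ProperP e → Clashing e f → S e f g
      clashing-pair ((u , μ) , (v , ν)) ((.u , _) , (.v , _)) g pe (inj₁ ((refl , refl) , (refl , refl))) = opposite pe μ ν g
      clashing-pair ((u , μ) , (v , ν)) ((.v , _) , (.u , _)) g pe (inj₂ ((refl , refl) , (refl , refl))) =
        reverse₂ ((u , μ) , (v , ν)) ((v , not ν) , (u , not μ)) g (opposite pe μ ν g)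

      loops₁ : ∀ p f g → vx (proj₁ p) ≡ vx (proj₂ p) → ProperP f → ProperP g → S p f g
      loops₁ p f g hp pf pg with Clashing? f g | Ends? ⌜ g ⌝₂ (vx (proj₁ f)) (vx (proj₂ f))
      ... | yes cl | _       = rotate g p f (rotate f g p (clashing-pair f g p pf cl))
      ... | no ¬cl | yes par = rotate g p f (rotate f g p (parallel-pair f g p pf par ¬cl (λ pp → contradiction hp pp)))
      ... | no _   | no ¬par = tri-graph p f g c d (absorb-graph ⌜ proj₁ p ⌝ ⌜ proj₂ p ⌝ (⌜ f ⌝₂ ∷ ⌜ g ⌝₂ ∷ []) V hp
        (twoEdges-graph ⌜ f ⌝₂ ⌜ g ⌝₂ (looped p V) (looped-fine p V-fine) pf pg ¬par (vx (proj₁ p)) (only-loop p)))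

      cyclic : ∀ {a b w} → a ≢ b → a ≢ w → b ≢ w → ∀ α β γ → S ((a , α) , (b , β)) ((b , not β) , (w , γ)) ((w , not γ) , (a , not α))
      cyclic {a} {b} {w} ab aw bw α β γ = tri-embed ι φ (threeOf-inj ab aw bw) (0F ₀ , 1F ₀) (1F ₁ , 2F ₀) (2F ₁ , 0F ₁) c d d≤c
        (cycle-tri (lift-c ι φ c d) (lift-d ι φ c d))
        where ι = threeOf a b w
              φ = threeOf α β γ

      one-same : ∀ {a b w} → a ≢ b → a ≢ w → b ≢ w → ∀ α β γ → S ((a , α) , (b , β)) ((b , not β) , (w , not γ)) ((w , γ) , (a , α))
      one-same {a} {b} {w} ab aw bw α β γ = exchange₂₃ ((a , α) , (b , β)) ((w , γ) , (a , α)) ((b , not β) , (w , not γ))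
        (reverse₂ ((a , α) , (b , β)) ((w , γ) , (a , α)) ((b , not β) , (w , not γ))
          (tri-embed ι φ (threeOf-inj ab aw bw) (0F ₀ , 1F ₀) (0F ₀ , 2F ₀) (1F ₁ , 2F ₁) c d d≤c (triangle-tri (lift-c ι φ c d) (lift-d ι φ c d))))
        where ι = threeOf a b w
              φ = threeOf α β γ

      -- The vertices `a` and `b` can each be charged with both of their edges. Whichever vertex is
      -- to be free, one of the two remains and takes its two edges; the third edge goes to the last
      -- vertex.
      two-same : ∀ {a b w} → a ≢ b → a ≢ w → b ≢ w → ∀ α β γ γ′ → S ((a , α) , (b , β)) ((b , β) , (w , γ)) ((w , γ′) , (a , α))
      two-same {a} {b} {w} ab aw bw α β γ γ′ = tri-graph e f g c d (graph-solvable (⌜ e ⌝₂ ∷ ⌜ f ⌝₂ ∷ ⌜ g ⌝₂ ∷ []) V (proj₁ V-fine) (proj₂ V-fine)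
        (proj₁ (config a) , λ v l≢0 → contradiction refl l≢0) config)
        where
        e f g : Pair n
        e = (a , α) , (b , β)
        f = (b , β) , (w , γ)
        g = (w , γ′) , (a , α)
        config : ∀ v → Σ (Config (⌜ e ⌝₂ ∷ ⌜ f ⌝₂ ∷ ⌜ g ⌝₂ ∷ [])) λ χ → Free v (Config.os χ)
        config v with a Fin.≟ v | b Fin.≟ v
        ... | yes refl | _        = config₃ true false false ⌜ e ⌝₂ ⌜ f ⌝₂ ⌜ g ⌝₂ (λ _ → refl , refl) (λ b≡w → contradiction b≡w bw) (λ b≡w → contradiction b≡w bw)
          , ≢-sym ab ∷ ≢-sym ab ∷ ≢-sym aw ∷ []
        ... | no _     | yes refl = config₃ false true true ⌜ e ⌝₂ ⌜ f ⌝₂ ⌜ g ⌝₂ (λ a≡w → contradiction a≡w aw) (λ _ → refl , refl) (λ w≡a → contradiction (sym w≡a) aw)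
          , ab ∷ ≢-sym bw ∷ ab ∷ []
        ... | no a≢v   | no b≢v   = config₃ false false true ⌜ e ⌝₂ ⌜ f ⌝₂ ⌜ g ⌝₂ (λ a≡b → contradiction a≡b ab) (λ _ → refl , refl) (λ b≡a → contradiction (sym b≡a) ab)
          , a≢v ∷ b≢v ∷ a≢v ∷ []

      -- What counts is the number of vertices at which both edges use the same element: two or
      -- three allow charging, one is the triangle with special strategy, none is the cycle that
      -- becomes constant.
      triangle : ∀ {a b w} → a ≢ b → a ≢ w → b ≢ w → ∀ α α′ β β′ γ γ′ → S ((a , α) , (b , β)) ((b , β′) , (w , γ)) ((w , γ′) , (a , α′))
      triangle {a} {b} {w} ab aw bw α α′ β β′ γ γ′ = go (α Bool.≟ α′) (β Bool.≟ β′) (γ Bool.≟ γ′)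
        where
        back : ∀ e f g → S f g e → S e f g
        back e f g s = rotate g e f (rotate f g e s)
        go : Dec (α ≡ α′) → Dec (β ≡ β′) → Dec (γ ≡ γ′) → S ((a , α) , (b , β)) ((b , β′) , (w , γ)) ((w , γ′) , (a , α′))
        go (yes refl) (yes refl) _          = two-same ab aw bw α β γ γ′
        go (no _)     (yes refl) (yes refl) = back ((a , α) , (b , β)) ((b , β) , (w , γ)) ((w , γ) , (a , α′)) (two-same bw (≢-sym ab) (≢-sym aw) β γ α′ α)
        go (yes refl) (no _)     (yes refl) = rotate ((w , γ) , (a , α)) ((a , α) , (b , β)) ((b , β′) , (w , γ)) (two-same (≢-sym aw) (≢-sym bw) ab γ α β β′)
        go (yes refl) (no h)     (no k)     = subst₂ (λ y z → S ((a , α) , (b , β)) ((b , y) , (w , z)) ((w , γ′) , (a , α))) (sym (¬same h)) (sym (Bool.¬-not k))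
          (one-same ab aw bw α β γ′)
        go (no h)     (yes refl) (no k)     = back ((a , α) , (b , β)) ((b , β) , (w , γ)) ((w , γ′) , (a , α′))
          (subst₂ (λ y z → S ((b , β) , (w , γ)) ((w , y) , (a , z)) ((a , α) , (b , β))) (sym (¬same k)) (sym (¬same h)) (one-same bw (≢-sym ab) (≢-sym aw) β γ α))
        go (no h)     (no k)     (yes refl) = rotate ((w , γ) , (a , α′)) ((a , α) , (b , β)) ((b , β′) , (w , γ))
          (subst₂ (λ y z → S ((w , γ) , (a , y)) ((a , α) , (b , z)) ((b , β′) , (w , γ))) (sym (¬same h)) (sym (Bool.¬-not k)) (flipped h k))
          where flipped : α ≢ α′ → β ≢ β′ → S ((w , γ) , (a , not α)) ((a , α) , (b , not β′)) ((b , β′) , (w , γ))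
                flipped _ _ = subst (λ z → S ((w , γ) , (a , not α)) ((a , z) , (b , not β′)) ((b , β′) , (w , γ))) (not-involutive α) (one-same (≢-sym aw) (≢-sym bw) ab γ (not α) β′)
        go (no h)     (no k)     (no j)     = subst₂ (λ y z → S ((a , α) , (b , β)) ((b , y) , (w , γ)) ((w , z) , (a , α′))) (sym (¬same k)) (sym (¬same j))
          (subst (λ y → S ((a , α) , (b , β)) ((b , not β) , (w , γ)) ((w , not γ) , (a , y))) (sym (¬same h)) (cyclic ab aw bw α β γ))

      triangular : ∀ e f g → ProperP e → ProperP f → ProperP g → Triangular ⌜ e ⌝₂ ⌜ f ⌝₂ ⌜ g ⌝₂ → S e f g
      triangular e f g pe pf pg (a , b , w , eab , fbw , gwa) = go₁ e f g eab fbw gwa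
        where
        ab = Ends-≢ pe eab
        bw = Ends-≢ pf fbw
        aw = ≢-sym (Ends-≢ pg gwa)
        go₃ : ∀ α β β′ γ g → Ends ⌜ g ⌝₂ w a → S ((a , α) , (b , β)) ((b , β′) , (w , γ)) g
        go₃ α β β′ γ g@((_ , γ′) , (_ , α′)) h with aligned g h
        ... | inj₁ (refl , refl) = triangle ab aw bw α α′ β β′ γ γ′
        ... | inj₂ (refl , refl) = reverse₃ _ _ g (triangle ab aw bw α γ′ β β′ γ α′)
        go₂ : ∀ α β f g → Ends ⌜ f ⌝₂ b w → Ends ⌜ g ⌝₂ w a → S ((a , α) , (b , β)) f g
        go₂ α β f@((_ , β′) , (_ , γ)) g h k with aligned f h
        ... | inj₁ (refl , refl) = go₃ α β β′ γ g k
        ... | inj₂ (refl , refl) = reverse₂ _ f g (go₃ α β γ β′ g k)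
        go₁ : ∀ e f g → Ends ⌜ e ⌝₂ a b → Ends ⌜ f ⌝₂ b w → Ends ⌜ g ⌝₂ w a → S e f g
        go₁ e@((_ , α) , (_ , β)) f g h k j with aligned e h
        ... | inj₁ (refl , refl) = go₂ α β f g k j
        ... | inj₂ (refl , refl) = reverse₁ e f g (go₂ β α f g k j)

      loops₀ : ∀ e f g → ProperP e → ProperP f → ProperP g → S e f g
      loops₀ e f g pe pf pg with Clashing? e f | Clashing? e g | Clashing? f g
      ... | yes cl | _      | _      = clashing-pair e f g pe cl
      ... | no _   | yes cl | _      = exchange₂₃ e g f (clashing-pair e g f pe cl)
      ... | no _   | no _   | yes cl = rotate g e f (rotate f g e (clashing-pair f g e pf cl))
      ... | no ¬ef | no ¬eg | no ¬fg with Ends? ⌜ f ⌝₂ (vx (proj₁ e)) (vx (proj₂ e)) | Ends? ⌜ g ⌝₂ (vx (proj₁ e)) (vx (proj₂ e)) | Ends? ⌜ g ⌝₂ (vx (proj₁ f)) (vx (proj₂ f))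
      ...   | yes par | _       | _       = parallel-pair e f g pe par ¬ef (λ _ → ¬eg , ¬fg)
      ...   | no _    | yes par | _       = exchange₂₃ e g f (parallel-pair e g f pe par ¬eg (λ _ → ¬ef , λ cl → ¬fg (Clashing-sym g f cl)))
      ...   | no _    | no _    | yes par = rotate g e f (rotate f g e (parallel-pair f g e pf par ¬fg (λ _ → (λ cl → ¬ef (Clashing-sym f e cl)) , λ cl → ¬eg (Clashing-sym g e cl))))
      ...   | no ¬p₁  | no ¬p₂  | no ¬p₃  with ∀-⊎ (sdr₃ ⌜ e ⌝₂ ⌜ f ⌝₂ ⌜ g ⌝₂ pe pf pg ¬p₁ ¬p₂ ¬p₃)
      ...     | inj₂ t = triangular e f g pe pf pg t
      ...     | inj₁ h = tri-graph e f g c d (graph-solvable (⌜ e ⌝₂ ∷ ⌜ f ⌝₂ ∷ ⌜ g ⌝₂ ∷ []) V (proj₁ V-fine) (proj₂ V-fine)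
        (proj₁ (config-sdr₃ (h (vx (proj₁ e)))) , λ v l≢0 → contradiction refl l≢0) (λ v → config-sdr₃ (h v)))

    abstract
      three-edges : ∀ e f g → S e f g
      three-edges e f g with vx (proj₁ e) Fin.≟ vx (proj₂ e) | vx (proj₁ f) Fin.≟ vx (proj₂ f) | vx (proj₁ g) Fin.≟ vx (proj₂ g)
      ... | yes he | yes hf | yes hg = loops₃ e f g he hf hg
      ... | yes he | yes hf | no pg  = loops₂ e f g he hf pg
      ... | yes he | no pf  | yes hg = exchange₂₃ e g f (loops₂ e g f he hg pf)
      ... | no pe  | yes hf | yes hg = rotate g e f (rotate f g e (loops₂ f g e hf hg pe))
      ... | yes he | no pf  | no pg  = loops₁ e f g he pf pg
      ... | no pe  | yes hf | no pg  = exchange₁₂ f e g (loops₁ f e g hf pe pg)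
      ... | no pe  | no pf  | yes hg = rotate g e f (loops₁ g e f hg pe pf)
      ... | no pe  | no pf  | no pg  = loops₀ e f g pe pf pg

-- The construction of `f` in stages

module Assembly where

  open Congruence
  open Block
  open Transform
  open Exact
  open Graph using (∑-bump; total-≤)
  open Templates
  open ThreeEdgeForms using (three-edges)
  open import Data.Integer.Base using (_+_; _*_)

  private
    hit hit₁ : ∀ {n} → Slot n → Fin n → ℕ
    hit (u , _) v with u Fin.≟ v
    ... | yes _ = 1
    ... | no _  = 0
    hit₁ (u , b) v with u Fin.≟ v
    ... | yes _ = if b then 1 else 0
    ... | no _  = 0

    hit₁≤hit : ∀ {n} (s : Slot n) v → hit₁ s v ℕ.≤ hit s v
    hit₁≤hit (u , true)  v with u Fin.≟ v
    ... | yes _ = ℕ.≤-refl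
    ... | no _  = ℕ.≤-refl
    hit₁≤hit (u , false) v with u Fin.≟ v
    ... | yes _ = z≤n
    ... | no _  = z≤n

  count count₁ : ∀ {k n} → (Fin k → Slot n) → Fin n → ℕ
  count  s v = total (λ j → hit (s j) v)
  count₁ s v = total (λ j → hit₁ (s j) v)

  total-mono : ∀ {n} {f g : Fin n → ℕ} → (∀ v → f v ℕ.≤ g v) → total f ℕ.≤ total g
  total-mono {zero}  h = z≤n
  total-mono {suc n} h = ℕ.+-mono-≤ (h zero) (total-mono (h ∘ suc))

  total-strict : ∀ {n} {f g : Fin n → ℕ} → (∀ v → f v ℕ.≤ g v) → ∀ u → f u ℕ.< g u → total f ℕ.< total g
  total-strict h zero    lt = ℕ.+-mono-<-≤ lt (total-mono (h ∘ suc))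
  total-strict h (suc u) lt = ℕ.+-mono-≤-< (h zero) (total-strict (h ∘ suc) u lt)

  ∑-count : ∀ {k n} (s : Fin k → Slot n) a x → ⟦ linearPart (count s) (count₁ s) ⟧ a x ≡ ∑ (λ j → ⟦ sl (s j) ⟧ a x)
  ∑-count {zero}  s a x = ∑-0 (λ v → lem (a v) (x v))
    where lem : ∀ a x → 0ℤ * a + 0ℤ * x ≡ 0ℤ
          lem = solve-∀
  ∑-count {suc k} s a x = trans (∑-bump (proj₁ (s zero)) (⟦ sl (s zero) ⟧ a x) {λ v → + count s′ v * a v + + count₁ s′ v * x v} {λ v → + count s v * a v + + count₁ s v * x v}
      (at (s zero)) (off (s zero)))
    (cong (λ z → ⟦ sl (s zero) ⟧ a x + z) (∑-count s′ a x))
    where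
    s′ = s ∘ suc
    at : ∀ t → + (hit t (proj₁ t) ℕ.+ count s′ (proj₁ t)) * a (proj₁ t) + + (hit₁ t (proj₁ t) ℕ.+ count₁ s′ (proj₁ t)) * x (proj₁ t)
       ≡ ⟦ sl t ⟧ a x + (+ count s′ (proj₁ t) * a (proj₁ t) + + count₁ s′ (proj₁ t) * x (proj₁ t))
    at (u , b) with u Fin.≟ u
    ... | no ¬e = contradiction refl ¬e
    at (u , true)  | yes _ = lem (+ count s′ u) (+ count₁ s′ u) (a u) (x u)
      where lem : ∀ c d a x → (1ℤ + c) * a + (1ℤ + d) * x ≡ a + x + (c * a + d * x)
            lem = solve-∀
    at (u , false) | yes _ = lem (+ count s′ u) (+ count₁ s′ u) (a u) (x u)
      where lem : ∀ c d a x → (1ℤ + c) * a + d * x ≡ a + (c * a + d * x)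
            lem = solve-∀
    off : ∀ t v → proj₁ t ≢ v → + (hit t v ℕ.+ count s′ v) * a v + + (hit₁ t v ℕ.+ count₁ s′ v) * x v ≡ + count s′ v * a v + + count₁ s′ v * x v
    off (u , b) v u≢v with u Fin.≟ v
    ... | yes e = contradiction e u≢v
    ... | no _  = refl

  abstract
    slotsForm : ∀ {k n} → (Fin (6 ℕ.+ k) → Slot n) → Form n
    slotsForm {k} s = tri (s 0F , s 1F) (s 2F , s 3F) (s 4F , s 5F) (+_ ∘ count (λ j → s (6 ↑ʳ j))) (+_ ∘ count₁ (λ (j : Fin k) → s (6 ↑ʳ j)))

    value : ∀ {k} → (Fin (6 ℕ.+ k) → ℤ) → ℤ
    value e = e 0F * e 1F + e 2F * e 3F + e 4F * e 5F + ∑ (λ j → e (6 ↑ʳ j))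

    value-def : ∀ {k} (e : Fin (6 ℕ.+ k) → ℤ) → value e ≡ e 0F * e 1F + e 2F * e 3F + e 4F * e 5F + ∑ (λ j → e (6 ↑ʳ j))
    value-def e = refl

    Cong-value : ∀ {k m} {e e′ : Fin (6 ℕ.+ k) → ℤ} → (∀ i → Cong m (e i) (e′ i)) → Cong m (value e) (value e′)
    Cong-value {k} {m} {e} {e′} h = Cong-+ {b = e′ 0F * e′ 1F + e′ 2F * e′ 3F + e′ 4F * e′ 5F}
      (Cong-+ {b = e′ 0F * e′ 1F + e′ 2F * e′ 3F} (Cong-+ {b = e′ 0F * e′ 1F} (Cong-* {b = e′ 0F} (h 0F) (h 1F)) (Cong-* {b = e′ 2F} (h 2F) (h 3F))) (Cong-* {b = e′ 4F} (h 4F) (h 5F)))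
      (Cong-∑ (λ j → h (6 ↑ʳ j)))

    ⟦slotsForm⟧ : ∀ {k n} (s : Fin (6 ℕ.+ k) → Slot n) a x → ⟦ slotsForm s ⟧ a x ≡ value (λ i → ⟦ sl (s i) ⟧ a x)
    ⟦slotsForm⟧ s a x = cong (λ z → ⟦ ed (s 0F , s 1F) ⊕ ed (s 2F , s 3F) ⊕ ed (s 4F , s 5F) ⟧ a x + z) (∑-count (λ j → s (6 ↑ʳ j)) a x)

    slotsForm-solvable : ∀ {k n} (s : Fin (6 ℕ.+ k) → Slot n) → Solvable (slotsForm s)
    slotsForm-solvable {k} s = three-edges (count (λ j → s (6 ↑ʳ j))) (count₁ (λ (j : Fin k) → s (6 ↑ʳ j))) (λ v → total-mono (λ j → hit₁≤hit (s (6 ↑ʳ j)) v))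
      (s 0F , s 1F) (s 2F , s 3F) (s 4F , s 5F)

  Cong? : ∀ m .{{_ : NonZero m}} a b → Dec (Cong m a b)
  Cong? m a b = map′ (%-≡⇒Cong m) (Cong-%⇒≡ m) (a %ℕ m ℕ.≟ b %ℕ m)

  abstract
    element : (ℤ → ℤ) → Bool → ℤ → ℤ
    element f b x = flip-el b (f x) x

    element-def : ∀ f b x → element f b x ≡ flip-el b (f x) x
    element-def f b x = refl

    Cong-element : ∀ {m} f g b x → Cong m (f x) (g x) → Cong m (element f b x) (element g b x)
    Cong-element f g true  x h = Cong-+ h (Cong-refl {a = x})
    Cong-element f g false x h = h

    Cong-element-sl : ∀ {m n} f b x (v : Fin n) (a y : Fin n → ℤ) → Cong m (f x) (a v) → Cong m x (y v) → Cong m (element f b x) (⟦ sl (v , b) ⟧ a y)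
    Cong-element-sl f true  x v a y h k = Cong-+ h k
    Cong-element-sl f false x v a y h k = h

  module Stages (M D k : ℕ) where

    m : ℕ
    m = 6 ℕ.+ k

    -- Since `sparse` is a strict inequality of integers, the density of the bad classes stays below
    -- 1 / D by at least 1 / (q D), and the next cover is chosen to fit into this gap.
    record State : Set₁ where
      field
        P      : PrimeList M
        f      : ℤ → ℤ
        Bad    : ℤ → Set
        resp   : ∀ {z z′} → Cong (modulus P) z z′ → Bad z → Bad z′
        B      : ℕ
        size   : Size (modulus P) Bad B
        sparse : B ℕ.* D ℕ.< modulus P

      q : ℕ
      q = modulus P

      q≢0 : NonZero q
      q≢0 = PrimeList.modulus≢0 P

      Caught : (Fin m → ℤ) → (Fin m → Bool) → Set
      Caught x b = Bad (value (λ i → element f (b i) (x i)))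

    open State public using (Caught)

    infix 4 _≼_
    record _≼_ (s s′ : State) : Set where
      constructor mk
      field
        refines  : ∀ {a b} → Cong (State.q s′) a b → Cong (State.q s) a b
        persists : ∀ x b → Caught s x b → Caught s′ x b

    ≼-refl : ∀ {s} → s ≼ s
    ≼-refl = mk id (λ _ _ → id)

    ≼-trans : ∀ {s t u} → s ≼ t → t ≼ u → s ≼ u
    ≼-trans (mk r p) (mk r′ p′) = mk (r ∘ r′) (λ x b → p′ x b ∘ p x b)

    start : State
    start = record
      { P = record { list = [] ; primes = [] ; unique = [] ; above = [] }
      ; f = λ _ → 0ℤ ; Bad = λ _ → ⊥ ; resp = λ _ () ; B = 0
      ; size = record { code = λ () ; code< = λ { () } ; inj = λ { () } }
      ; sparse = s≤s z≤n }

    -- Positions with the same label in y share a variable.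
    module _ (Q : ℕ) .{{Q≢0 : NonZero Q}} (y : Fin m → ℕ) (b : Fin m → Bool) where

      Labelled : ℕ → Set
      Labelled l = Σ (Fin m) λ j → y j ≡ l

      labelled? : ∀ l → Dec (Labelled l)
      labelled? l = Fin.any? (λ j → y j ℕ.≟ l)

      private
        default : ∀ {l} → Fin m → Dec (Labelled l) → Fin m
        default i (yes (j , _)) = j
        default i (no _)        = i

      rep : Fin m → Fin m
      rep i = default i (labelled? (y i))

      rep-label : ∀ i → y (rep i) ≡ y i
      rep-label i with labelled? (y i)
      ... | yes (j , e) = e
      ... | no _        = refl

      play : ∀ {l} → Strategy m → Dec (Labelled l) → ℤ → ℤ
      play σ (yes (j , _)) = σ j
      play σ (no _)        = λ _ → 0ℤ

      play-rep : ∀ σ i l → l ≡ y i → ∀ z → play σ (labelled? l) z ≡ σ (rep i) z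
      play-rep σ i _ refl z with labelled? (y i)
      ... | yes _ = refl
      ... | no ¬e = contradiction (i , refl) ¬e

      -- The second hypothesis leaves out the tuples with a coincidence modulo `Q` that is destroyed
      -- modulo the current modulus. For the others, one variable per label describes all positions.
      Settled : State → Set
      Settled s = ∀ x → (∀ i → x i %ℕ Q ≡ y i) → (∀ i j → y i ≡ y j → Cong (State.q s) (x i) (x j)) → Caught s x b

      Settled-≼ : ∀ {s s′} → s ≼ s′ → Settled s → Settled s′
      Settled-≼ (mk r p) h x hx hy = p x b (h x hx (λ i j e → r (hy i j e)))

      -- The residue of a difference modulo `Q` tells which variable of the form it stands for. Thus
      -- different variables can follow different strategies although all elements come from the
      -- single function `f′`.
      settle : ∀ s → Σ State λ s′ → s ≼ s′ × Settled s′
      settle s = s′ , mk (λ e → Cong-divˡ (to e)) (λ x b c → inj₁ (s.resp (Cong-value (λ i → old b x i)) c))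
                    , λ x hx hy → inj₂ (C.resp (Cong-sym (new x hx hy)) (subst C.Bad (⟦slotsForm⟧ slots (C.σ ⟨ reduce x ⟩) (reduce x)) (C.catch (reduce x))))
        where
        module s = State s
        slots : Fin m → Slot m
        slots i = rep i , b i
        -- Chosen so that a cover with B E ≤ r satisfies q B D < r, that is, has density below 1 /
        -- (q D).
        E = s.q ℕ.* D ℕ.+ 1
        solution : Σ (Cover (slotsForm slots) (M ℕ.⊔ s.q)) λ C → Cover.B C ℕ.* E ℕ.≤ ∣ C ∣ₘ
        solution = slotsForm-solvable slots (M ℕ.⊔ s.q) E
        module C = Cover (proj₁ solution)
        r : ℕ
        r = modulus C.P
        instance
          r≢0 : NonZero r
          r≢0 = PrimeList.modulus≢0 C.P
          q≢0 : NonZero s.q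
          q≢0 = s.q≢0
        cop = coprime-⊹ s.P C.P
        q≡ : modulus (s.P ⊹ C.P) ≡ s.q ℕ.* r
        q≡ = modulus-⊹ s.P C.P
        to : ∀ {a b} → Cong (modulus (s.P ⊹ C.P)) a b → Cong (s.q ℕ.* r) a b
        to = subst (λ m → Cong m _ _) q≡
        -- Positions with the same label are congruent modulo `r`, but need not be equal integers;
        -- passing to residues makes the strategy treat them alike.
        reduce : (Fin m → ℤ) → Fin m → ℤ
        reduce x v = + (x v %ℕ r)
        g : ℤ → ℤ
        g x = play C.σ (labelled? (x %ℕ Q)) (+ (x %ℕ r))
        joint : ∀ x → Σ ℤ λ z → Cong s.q z (s.f x) × Cong r z (g x)
        joint x = crt₂ cop (s.f x) (g x)
        f′ : ℤ → ℤ
        f′ x = proj₁ (joint x)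
        old : ∀ b x i → Cong s.q (element s.f (b i) (x i)) (element f′ (b i) (x i))
        old b x i = Cong-element s.f f′ (b i) (x i) (Cong-sym (proj₁ (proj₂ (joint (x i)))))
        bad = λ z → s.Bad z ⊎ C.Bad z
        bound = s.B ℕ.* r ℕ.+ s.q ℕ.* C.B
        combined : Size (s.q ℕ.* r) bad bound
        combined = Size-⊎ (Size-map (λ h → h , _) (Size-× cop s.size (Size-all r {λ _ → ⊤}))) (Size-map (λ h → _ , h) (Size-× cop (Size-all s.q {λ _ → ⊤}) C.size))
        small : s.q ℕ.* C.B ℕ.* D ℕ.< r
        small with C.B in eq
        ... | zero  = ℕ.≤-<-trans (ℕ.≤-reflexive (cong (ℕ._* D) (ℕ.*-zeroʳ s.q))) (ℕ.>-nonZero⁻¹ r)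
        ... | suc β = ℕ.<-≤-trans (ℕ.m<m+n (s.q ℕ.* suc β ℕ.* D) (s≤s z≤n)) (ℕ.≤-trans (ℕ.≤-reflexive (lem s.q (suc β) D)) (subst (λ β → β ℕ.* E ℕ.≤ r) eq (proj₂ solution)))
          where lem : ∀ q β D → q ℕ.* β ℕ.* D ℕ.+ β ≡ β ℕ.* (q ℕ.* D ℕ.+ 1)
                lem = ℕ-solve-∀
        still-sparse : bound ℕ.* D ℕ.< s.q ℕ.* r
        still-sparse = begin-strict
          (s.B ℕ.* r ℕ.+ s.q ℕ.* C.B) ℕ.* D             ≡⟨ lem s.B r (s.q ℕ.* C.B) D ⟩
          s.B ℕ.* D ℕ.* r ℕ.+ s.q ℕ.* C.B ℕ.* D         <⟨ ℕ.+-monoʳ-< (s.B ℕ.* D ℕ.* r) small ⟩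
          s.B ℕ.* D ℕ.* r ℕ.+ r                         ≡⟨ ℕ.+-comm (s.B ℕ.* D ℕ.* r) r ⟩
          suc (s.B ℕ.* D) ℕ.* r                         ≤⟨ ℕ.*-monoˡ-≤ r s.sparse ⟩
          s.q ℕ.* r                                     ∎
          where
          open ℕ.≤-Reasoning
          lem : ∀ b r c d → (b ℕ.* r ℕ.+ c) ℕ.* d ≡ b ℕ.* d ℕ.* r ℕ.+ c ℕ.* d
          lem = ℕ-solve-∀
        s′ : State
        s′ = record
          { P = s.P ⊹ C.P ; f = f′ ; Bad = bad
          ; resp   = λ { e (inj₁ h) → inj₁ (s.resp (Cong-divˡ (to e)) h) ; e (inj₂ h) → inj₂ (C.resp (Cong-divʳ {s.q} (to e)) h) }
          ; B      = bound
          ; size   = subst (λ m → Size m bad bound) (sym q≡) combined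
          ; sparse = subst (bound ℕ.* D ℕ.<_) (sym q≡) still-sparse
          }
        new : ∀ x → (∀ i → x i %ℕ Q ≡ y i) → (∀ i j → y i ≡ y j → Cong (modulus (s.P ⊹ C.P)) (x i) (x j)) →
          Cong r (value (λ i → element f′ (b i) (x i))) (value (λ i → ⟦ sl (slots i) ⟧ (C.σ ⟨ reduce x ⟩) (reduce x)))
        new x hx hy = Cong-value λ i → Cong-element-sl f′ (b i) (x i) (rep i) (C.σ ⟨ reduce x ⟩) (reduce x) (at i) (near i)
          where
          same : ∀ i → x i %ℕ r ≡ x (rep i) %ℕ r
          same i = Cong-%⇒≡ r (Cong-divʳ {s.q} (to (hy i (rep i) (sym (rep-label i)))))
          near : ∀ i → Cong r (x i) (+ (x (rep i) %ℕ r))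
          near i = Cong-trans (Cong-% (x i) r) (≡⇒Cong (cong +_ (same i)))
          at : ∀ i → Cong r (f′ (x i)) (C.σ (rep i) (+ (x (rep i) %ℕ r)))
          at i = Cong-trans (proj₂ (proj₂ (joint (x i)))) (≡⇒Cong (trans (play-rep C.σ i (x i %ℕ Q) (hx i) (+ (x i %ℕ r))) (cong (λ z → C.σ (rep i) (+ z)) (same i))))

    all-settle : ∀ {N} (Done : Fin N → State → Set) → (∀ i {s s′} → s ≼ s′ → Done i s → Done i s′) →
      (∀ i s → Σ State λ s′ → s ≼ s′ × Done i s′) → ∀ s → Σ State λ s′ → s ≼ s′ × (∀ i → Done i s′)
    all-settle {zero}  Done mono step s = s , ≼-refl , λ ()
    all-settle {suc N} Done mono step s =
      let (s₁ , s≼s₁ , h) = step zero s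
          (s₂ , s₁≼s₂ , hs) = all-settle (Done ∘ suc) (mono ∘ suc) (step ∘ suc) s₁
      in s₂ , ≼-trans s≼s₁ s₁≼s₂ , λ { zero → mono zero s₁≼s₂ h ; (suc i) → hs i }

    Stable : State → State → (Fin m → ℤ) → Set
    Stable s s′ x = ∀ i j → Cong (State.q s) (x i) (x j) → Cong (State.q s′) (x i) (x j)

    private
      bits : Fin (2 ℕ.^ m) → Fin m → Bool
      bits i j with finToFun i j
      ... | 0F = false
      ... | 1F = true

      encode : Bool → Fin 2
      encode false = 0F
      encode true  = 1F

      bits-encode : ∀ b j → bits (funToFin (encode ∘ b)) j ≡ b j
      bits-encode b j with finToFun (funToFin (encode ∘ b)) j | Fin.finToFun-funToFin (encode ∘ b) j
      ... | _ | refl with b j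
      ...   | false = refl
      ...   | true  = refl

    stage : ∀ s → Σ State λ s′ → s ≼ s′ × (∀ x b → Stable s s′ x → Caught s′ x b)
    stage s = proj₁ result , proj₁ (proj₂ result) , caught
      where
      -- Labels refer to the modulus at the beginning of the stage throughout, although the modulus
      -- grows each time a pattern of labels and bits is settled.
      Q = State.q s
      instance
        Q≢0 : NonZero Q
        Q≢0 = State.q≢0 s
      labels : Fin (Q ℕ.^ m) → Fin m → ℕ
      labels i j = toℕ (finToFun {Q} {m} i j)
      result : Σ State λ s′ → s ≼ s′ × (∀ i j → Settled Q (labels i) (bits j) s′)
      result = all-settle (λ i s → ∀ j → Settled Q (labels i) (bits j) s) (λ i s≼s′ h j → Settled-≼ Q (labels i) (bits j) s≼s′ (h j))
        (λ i → all-settle (λ j → Settled Q (labels i) (bits j)) (λ j → Settled-≼ Q (labels i) (bits j)) (λ j → settle Q (labels i) (bits j))) s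
      s′ = proj₁ result
      caught : ∀ x b → Stable s s′ x → Caught s′ x b
      caught x b stable = State.resp s′ (Cong-value (λ i → ≡⇒Cong (cong (λ c → element (State.f s′) c (x i)) (bits-encode b i))))
        (proj₂ (proj₂ result) i₀ j₀ x (λ i → sym (label i)) (λ i j e → stable i j (%-≡⇒Cong Q (trans (sym (label i)) (trans e (label j))))))
        where
        residues : Fin m → Fin Q
        residues i = fromℕ< (n%ℕd<d (x i) Q)
        i₀ = funToFin residues
        j₀ = funToFin (encode ∘ b)
        label : ∀ i → labels i₀ i ≡ x i %ℕ Q
        label i = trans (cong toℕ (Fin.finToFun-funToFin residues i)) (Fin.toℕ-fromℕ< (n%ℕd<d (x i) Q))

    private
      indicator : ∀ {A : Set} → Dec A → ℕ
      indicator (yes _) = 1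
      indicator (no _)  = 0

      indicator-mono : ∀ {A B : Set} (a? : Dec A) (b? : Dec B) → (A → B) → indicator a? ℕ.≤ indicator b?
      indicator-mono (yes a) (yes b) h = ℕ.≤-refl
      indicator-mono (yes a) (no ¬b) h = contradiction (h a) ¬b
      indicator-mono (no _)  b?      h = z≤n

      indicator-strict : ∀ {A B : Set} (a? : Dec A) (b? : Dec B) → ¬ A → B → indicator a? ℕ.< indicator b?
      indicator-strict (yes a) b?      ¬a b = contradiction a ¬a
      indicator-strict (no _)  (yes _) ¬a b = s≤s z≤n
      indicator-strict (no _)  (no ¬b) ¬a b = contradiction b ¬b

      indicator≤1 : ∀ {A : Set} (a? : Dec A) → indicator a? ℕ.≤ 1
      indicator≤1 (yes _) = ℕ.≤-refl
      indicator≤1 (no _)  = z≤n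

      cong? : ∀ s a b → Dec (Cong (State.q s) a b)
      cong? s a b = Cong? (State.q s) {{State.q≢0 s}} a b

    coincidences : State → (Fin m → ℤ) → ℕ
    coincidences s x = total (λ i → total (λ j → indicator (cong? s (x i) (x j))))

    coincidences≤ : ∀ s x → coincidences s x ℕ.≤ m ℕ.* (m ℕ.* 1)
    coincidences≤ s x = total-≤ _ (m ℕ.* 1) (λ i → total-≤ _ 1 (λ j → indicator≤1 (cong? s (x i) (x j))))

    stable-or-fewer : ∀ {s s′} → s ≼ s′ → ∀ x → Stable s s′ x ⊎ coincidences s′ x ℕ.< coincidences s x
    stable-or-fewer {s} {s′} (mk r _) x = go stable?
      where
      row? : ∀ i → Dec (∀ j → Cong (State.q s) (x i) (x j) → Cong (State.q s′) (x i) (x j))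
      row? i = Fin.all? (λ j → cong? s (x i) (x j) →-dec cong? s′ (x i) (x j))
      stable? : Dec (Stable s s′ x)
      stable? = Fin.all? row?
      separated : ∀ {A B : Set} → Dec A → Dec B → ¬ (A → B) → A × ¬ B
      separated _       (yes b) ¬h = contradiction (λ _ → b) ¬h
      separated (yes a) (no ¬b) ¬h = a , ¬b
      separated (no ¬a) (no _)  ¬h = contradiction (λ a → contradiction a ¬a) ¬h
      pointwise : ∀ i j → indicator (cong? s′ (x i) (x j)) ℕ.≤ indicator (cong? s (x i) (x j))
      pointwise i j = indicator-mono (cong? s′ (x i) (x j)) (cong? s (x i) (x j)) r
      fewer : ∀ i j → Cong (State.q s) (x i) (x j) × ¬ Cong (State.q s′) (x i) (x j) → coincidences s′ x ℕ.< coincidences s x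
      fewer i j (c , ¬c′) = total-strict (λ i → total-mono (pointwise i)) i (total-strict (pointwise i) j (indicator-strict (cong? s′ (x i) (x j)) (cong? s (x i) (x j)) ¬c′ c))
      go : Dec (Stable s s′ x) → Stable s s′ x ⊎ coincidences s′ x ℕ.< coincidences s x
      go (yes h) = inj₁ h
      go (no ¬h) = let (i , ¬hi) = Fin.¬∀⟶∃¬ m _ row? ¬h
                       (j , ¬hij) = Fin.¬∀⟶∃¬ m _ (λ j → cong? s (x i) (x j) →-dec cong? s′ (x i) (x j)) ¬hi
                   in inj₂ (fewer i j (separated (cong? s (x i) (x j)) (cong? s′ (x i) (x j)) ¬hij))

    stages : ∀ N s → Σ State λ s′ → s ≼ s′ × (∀ x b → coincidences s x ℕ.< N → Caught s′ x b)
    stages zero    s = s , ≼-refl , λ _ _ ()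
    stages (suc N) s =
      let (s₁ , s≼s₁ , h) = stage s
          (s₂ , s₁≼s₂ , hs) = stages N s₁
      in s₂ , ≼-trans s≼s₁ s₁≼s₂ , λ x b lt → finish s₁ s₂ s₁≼s₂ x b lt (h x b) (hs x b) (stable-or-fewer s≼s₁ x)
      where
      finish : ∀ s₁ s₂ → s₁ ≼ s₂ → ∀ x b → coincidences s x ℕ.< suc N → (Stable s s₁ x → Caught s₁ x b) → (coincidences s₁ x ℕ.< N → Caught s₂ x b) →
        Stable s s₁ x ⊎ coincidences s₁ x ℕ.< coincidences s x → Caught s₂ x b
      finish s₁ s₂ s₁≼s₂ x b lt h hs (inj₁ stable) = _≼_.persists s₁≼s₂ x b (h stable)
      finish s₁ s₂ s₁≼s₂ x b (s≤s lt) h hs (inj₂ fewer) = hs (ℕ.<-≤-trans fewer lt)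

    abstract
      everything-caught : Σ State λ s → ∀ x b → Caught s x b
      -- At most m² ordered pairs of positions coincide, so m² + 1 stages contain one at which no
      -- coincidence of the given tuple is lost.
      everything-caught = let (s , _ , h) = stages (suc (m ℕ.* (m ℕ.* 1))) start in s , λ x b → h x b (s≤s (coincidences≤ start x))

-- The set `A` and its sum sets

module SumSets where

  open Congruence
  open Block
  open Assembly
  open import Defs
  open import Data.Integer.Base using (_+_; _*_)
  open import Data.Rational.Base as ℚ using (ℚ; mkℚ; 0ℚ; ↧ₙ_)
  open import Data.Rational.Unnormalised.Base as ℚᵘ using (mkℚᵘ; *<*)
  import Data.Rational.Unnormalised.Properties as ℚᵘ
  import Data.Rational.Properties as ℚ
  open import Data.Fin.Subset using (Subset; _∈_; ∣_∣; inside; outside)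
  open import Data.Vec.Base using (tabulate; _∷_)
  open import Data.Vec.Base using (here; there)
  open import Data.Vec.Properties using (lookup∘tabulate; lookup⇒[]=; []=⇒lookup)

  ∈-tabulate⁺ : ∀ {n} {P : Fin n → Set} (P? : Decidable P) {u} → P u → u ∈ tabulate (λ v → ⌊ P? v ⌋)
  ∈-tabulate⁺ P? {u} p = lookup⇒[]= u _ (trans (lookup∘tabulate (λ v → ⌊ P? v ⌋) u) (trans (isYes≗does (P? u)) (dec-true (P? u) p)))

  ∈-tabulate⁻ : ∀ {n} {P : Fin n → Set} (P? : Decidable P) {u} → u ∈ tabulate (λ v → ⌊ P? v ⌋) → P u
  ∈-tabulate⁻ P? {u} u∈ with P? u | trans (sym (lookup∘tabulate (λ v → ⌊ P? v ⌋) u)) ([]=⇒lookup u∈)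
  ... | yes p | _ = p
  ... | no _  | ()

  members : ∀ {n} (S : Subset n) → Fin ∣ S ∣ → Σ (Fin n) (_∈ S)
  members (inside ∷ S)  zero    = zero , here
  members (inside ∷ S)  (suc i) = let (u , u∈) = members S i in suc u , there u∈
  members (outside ∷ S) i       = let (u , u∈) = members S i in suc u , there u∈

  members-injective : ∀ {n} (S : Subset n) {i j} → proj₁ (members S i) ≡ proj₁ (members S j) → i ≡ j
  members-injective (inside ∷ S)  {zero}  {zero}  e = refl
  members-injective (inside ∷ S)  {suc i} {suc j} e = cong suc (members-injective S (Fin.suc-injective e))
  members-injective (outside ∷ S) e = members-injective S (Fin.suc-injective e)

  ∣∣≤Size : ∀ {n Bad B} (S : Subset n) → Size n Bad B → (∀ {u} → u ∈ S → Bad (+ toℕ u)) → ∣ S ∣ ℕ.≤ B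
  ∣∣≤Size {n} {Bad} {B} S size bad = Fin.injective⇒≤ {f = λ i → fromℕ< (code< (witness i))} λ {i} {j} e →
    members-injective S (Fin.toℕ-injective (Cong⇒≡ (Fin.toℕ<n _) (Fin.toℕ<n _) (inj (witness i) (witness j) (Fin.fromℕ<-injective _ _ (code< (witness i)) (code< (witness j)) e))))
    where
    open Size size
    witness : ∀ i → Bad (+ toℕ (proj₁ (members S i)))
    witness i = bad (proj₂ (members S i))

  -- A positive ε has numerator at least 1, so it is at least 1 over its denominator.
  below-ε : ∀ (ε : ℚ) → 0ℚ ℚ.< ε → ∀ b q → b ℕ.* ↧ₙ ε ℕ.< q → (+ b) ℚ./ 1 ℚ.< ε ℚ.* ((+ q) ℚ./ 1)
  below-ε ε@(mkℚ (+ zero) _ _)       0<ε b q lt = contradiction (ℚ.drop-*<* 0<ε) λ { (ℤ.+<+ ()) }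
  below-ε ε@(mkℚ (ℤ.-[1+ n ]) _ _)   0<ε b q lt = contradiction (ℚ.drop-*<* 0<ε) λ ()
  below-ε ε@(mkℚ (+ suc n) d-1 _)    0<ε b q lt = ℚ.toℚᵘ-cancel-< (begin-strict
    ℚ.toℚᵘ ((+ b) ℚ./ 1)                  ≃⟨ ℚ.toℚᵘ-fromℚᵘ (mkℚᵘ (+ b) 0) ⟩
    mkℚᵘ (+ b) 0                          <⟨ *<* (subst₂ ℤ._<_ (lem₁ (+ b) (+ suc d-1)) (lem₂ (+ suc n) (+ q)) (subst₂ ℤ._<_ (ℤ.pos-* b (suc d-1)) (ℤ.pos-* (suc n) q) (ℤ.+<+ (ℕ.<-≤-trans lt (ℕ.m≤m+n q (n ℕ.* q)))))) ⟩
    mkℚᵘ (+ suc n) d-1 ℚᵘ.* mkℚᵘ (+ q) 0  ≃⟨ ℚᵘ.*-congˡ {mkℚᵘ (+ suc n) d-1} (ℚᵘ.≃-sym (ℚ.toℚᵘ-fromℚᵘ (mkℚᵘ (+ q) 0))) ⟩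
    ℚ.toℚᵘ ε ℚᵘ.* ℚ.toℚᵘ ((+ q) ℚ./ 1)    ≃⟨ ℚᵘ.≃-sym (ℚ.toℚᵘ-homo-* ε ((+ q) ℚ./ 1)) ⟩
    ℚ.toℚᵘ (ε ℚ.* ((+ q) ℚ./ 1))          ∎)
    where
    open ℚᵘ.≤-Reasoning
    lem₁ : ∀ b d → b * d ≡ b * (d * 1ℤ)
    lem₁ = solve-∀
    lem₂ : ∀ n q → n * q ≡ n * q * 1ℤ
    lem₂ = solve-∀

  module _ (q : ℕ) {{q≢0 : NonZero q}} (f : ℤ → ℤ) where

    private
      OfPair : Fin q → Set
      OfPair u = Σ (Fin q) λ x → toℕ u ≡ f (+ toℕ x) %ℕ q ⊎ toℕ u ≡ (f (+ toℕ x) + + toℕ x) %ℕ q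

      ofPair? : ∀ u → Dec (OfPair u)
      ofPair? u = Fin.any? (λ x → (toℕ u ℕ.≟ f (+ toℕ x) %ℕ q) ⊎-dec (toℕ u ℕ.≟ (f (+ toℕ x) + + toℕ x) %ℕ q))

    pairs : Subset q
    pairs = tabulate λ u → ⌊ ofPair? u ⌋

    pairs-diff : DiffSetIsAll pairs
    pairs-diff x = a , b , ∈-tabulate⁺ ofPair? (x , inj₂ a≡) , ∈-tabulate⁺ ofPair? (x , inj₁ b≡) ,
      trans a≡ (Cong-%⇒≡ q (Cong-+ {b = + toℕ b} (Cong-trans (Cong-% (f (+ toℕ x)) q) (≡⇒Cong (cong +_ (sym b≡)))) (Cong-refl {a = + toℕ x})))
      where
      a = fromℕ< (n%ℕd<d (f (+ toℕ x) + + toℕ x) q)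
      b = fromℕ< (n%ℕd<d (f (+ toℕ x)) q)
      a≡ : toℕ a ≡ (f (+ toℕ x) + + toℕ x) %ℕ q
      a≡ = Fin.toℕ-fromℕ< _
      b≡ : toℕ b ≡ f (+ toℕ x) %ℕ q
      b≡ = Fin.toℕ-fromℕ< _

    Point : Set
    Point = ℤ × Bool

    at : Point → ℤ
    at (x , b) = element f b x

    private
      _≡ₘ_ : Fin q → ℤ → Set
      u ≡ₘ z = Cong q (+ toℕ u) z

    pairs⁻ : ∀ {u} → u ∈ pairs → Σ Point λ p → u ≡ₘ at p
    pairs⁻ u∈ with ∈-tabulate⁻ ofPair? u∈
    ... | x , inj₁ e = (+ toℕ x , false) , Cong-trans (≡⇒Cong (cong +_ e)) (Cong-trans (Cong-sym (Cong-% (f (+ toℕ x)) q)) (≡⇒Cong (sym (element-def f false (+ toℕ x)))))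
    ... | x , inj₂ e = (+ toℕ x , true) , Cong-trans (≡⇒Cong (cong +_ e)) (Cong-trans (Cong-sym (Cong-% (f (+ toℕ x) + + toℕ x) q)) (≡⇒Cong (sym (element-def f true (+ toℕ x)))))

    prodSet⁻ : ∀ {u} → u ∈ prodSet pairs → Σ Point λ p → Σ Point λ p′ → u ≡ₘ (at p * at p′)
    prodSet⁻ u∈ = let (a , b , a∈ , b∈ , e) = ∈-tabulate⁻ _ u∈
                      (p , ha) = pairs⁻ a∈ ; (p′ , hb) = pairs⁻ b∈
      in p , p′ , Cong-trans (≡⇒Cong (cong +_ (sym e))) (Cong-trans (Cong-sym (Cong-% (+ (toℕ a ℕ.* toℕ b)) q)) (Cong-trans (≡⇒Cong (ℤ.pos-* (toℕ a) (toℕ b))) (Cong-* {b = at p} ha hb)))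

    sumSet⁻ : ∀ {S T : Subset q} {u} → u ∈ sumSet S T → Σ (Fin q) λ a → Σ (Fin q) λ b → a ∈ S × b ∈ T × u ≡ₘ (+ toℕ a + + toℕ b)
    sumSet⁻ u∈ = let (a , b , a∈ , b∈ , e) = ∈-tabulate⁻ _ u∈ in
      a , b , a∈ , b∈ , Cong-trans (≡⇒Cong (cong +_ (sym e))) (Cong-sym (Cong-% (+ (toℕ a ℕ.+ toℕ b)) q))

    addCopies⁻ : ∀ k S {u} → u ∈ addCopies k pairs S → Σ (Fin q) λ w → w ∈ S × Σ (Fin k → Point) λ ps → u ≡ₘ (+ toℕ w + ∑ (at ∘ ps))
    addCopies⁻ zero    S {u} u∈ = u , u∈ , (λ ()) , ≡⇒Cong (sym (ℤ.+-identityʳ (+ toℕ u)))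
    addCopies⁻ (suc k) S {u} u∈ =
      let (w′ , w′∈ , ps , h) = addCopies⁻ k (sumSet S pairs) u∈
          (w , v , w∈ , v∈ , h′) = sumSet⁻ w′∈
          (p , hv) = pairs⁻ v∈
      in w , w∈ , (λ { zero → p ; (suc i) → ps i }) , Cong-trans h (Cong-trans (Cong-+ {b = + toℕ w + + toℕ v} h′ (Cong-refl {a = ∑ (at ∘ ps)}))
        (Cong-trans (≡⇒Cong (ℤ.+-assoc (+ toℕ w) (+ toℕ v) (∑ (at ∘ ps)))) (Cong-+ˡ (+ toℕ w) (Cong-+ {b = at p} hv (Cong-refl {a = ∑ (at ∘ ps)})))))

    origin : Point
    origin = 0ℤ , false

    -- The products missing when l < 3 are replaced by the square of a fixed element.
    padding : ℕ → ℤ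
    padding 0 = at origin * at origin + at origin * at origin
    padding 1 = at origin * at origin
    padding _ = 0ℤ

    products : (Fin 6 → Point) → ℤ
    products p = at (p 0F) * at (p 1F) + at (p 2F) * at (p 3F) + at (p 4F) * at (p 5F)

    private
      six : Point → Point → Point → Point → Point → Point → Fin 6 → Point
      six a b c d e g 0F = a
      six a b c d e g 1F = b
      six a b c d e g 2F = c
      six a b c d e g 3F = d
      six a b c d e g 4F = e
      six a b c d e g 5F = g

    sucCopies⁻ : ∀ l → l ℕ.≤ 2 → ∀ {u} → u ∈ sucCopiesA² l pairs → Σ (Fin 6 → Point) λ ps → Cong q (+ toℕ u + padding l) (products ps)
    sucCopies⁻ 0 _ {u} u∈ = let (p , p′ , h) = prodSet⁻ u∈ in six p p′ origin origin origin origin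
      , Cong-trans (Cong-+ {b = at p * at p′} h (Cong-refl {a = padding 0})) (≡⇒Cong (sym (ℤ.+-assoc (at p * at p′) (at origin * at origin) (at origin * at origin))))
    sucCopies⁻ 1 _ {u} u∈ =
      let (a , b , a∈ , b∈ , h) = sumSet⁻ u∈
          (p , p′ , ha) = prodSet⁻ a∈ ; (r , r′ , hb) = prodSet⁻ b∈
      in six p p′ r r′ origin origin , Cong-+ {b = at p * at p′ + at r * at r′} (Cong-trans h (Cong-+ {b = at p * at p′} ha hb)) (Cong-refl {a = padding 1})
    sucCopies⁻ 2 _ {u} u∈ =
      let (a , b , a∈ , b∈ , h) = sumSet⁻ u∈
          (a₁ , a₂ , a₁∈ , a₂∈ , h′) = sumSet⁻ a∈
          (p , p′ , ha₁) = prodSet⁻ a₁∈ ; (r , r′ , ha₂) = prodSet⁻ a₂∈ ; (s , s′ , hb) = prodSet⁻ b∈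
      in six p p′ r r′ s s′ , Cong-trans (≡⇒Cong (ℤ.+-identityʳ (+ toℕ u))) (Cong-trans h (Cong-+ {b = at p * at p′ + at r * at r′}
        (Cong-trans h′ (Cong-+ {b = at p * at p′} ha₁ ha₂)) hb))
    sucCopies⁻ (suc (suc (suc l))) (s≤s (s≤s ()))

    private
      append : ∀ {k} → (Fin 6 → Point) → (Fin k → Point) → Fin (6 ℕ.+ k) → Point
      append p r 0F = p 0F
      append p r 1F = p 1F
      append p r 2F = p 2F
      append p r 3F = p 3F
      append p r 4F = p 4F
      append p r 5F = p 5F
      append p r (suc (suc (suc (suc (suc (suc i)))))) = r i

    lA²+kA⁻ : ∀ l k → l ℕ.≤ 2 → ∀ {u} → u ∈ lA²+kA (suc l) k pairs →
      Σ (Fin (6 ℕ.+ k) → Point) λ ps → Cong q (value (at ∘ ps)) (+ toℕ u + padding l)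
    lA²+kA⁻ l k l≤2 {u} u∈ =
      let (w , w∈ , rs , h) = addCopies⁻ k (sucCopiesA² l pairs) u∈
          (ps , h′) = sucCopies⁻ l l≤2 w∈
      in append ps rs , Cong-trans (≡⇒Cong (value-def (at ∘ append ps rs))) (Cong-sym (Cong-trans (Cong-+ {b = + toℕ w + ∑ (at ∘ rs)} h (Cong-refl {a = padding l}))
        (Cong-trans (≡⇒Cong (lem (+ toℕ w) (∑ (at ∘ rs)) (padding l))) (Cong-+ {b = products ps} h′ (Cong-refl {a = ∑ (at ∘ rs)})))))
      where
      lem : ∀ w s p → w + s + p ≡ w + p + s
      lem = solve-∀

-- Parameters for a given ε

open import Defs
open import Data.Nat using (ℕ; _≤_; NonZero)
open import Data.Fin.Subset using (∣_∣)
open import Data.Integer using (+_)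
open import Data.Rational using (ℚ; _/_; _<_; _*_; 0ℚ)
open import Data.Product using (Σ; _×_)

open import Data.Fin.Subset using (_∈_)
open import Data.Rational.Base using (↧ₙ_)
open Congruence
open Block using (module PrimeList; Size)
open Assembly using (module Stages)
open SumSets

theorem5 : (l k : ℕ) → 1 ≤ l → l ≤ 3 → (ε : ℚ) → 0ℚ < ε → (M : ℕ) →
    Σ ℕ λ q → Σ (NonZero q) λ nz → Σ _ λ A →
    ProductOfDistinctPrimesAbove M q ×
    DiffSetIsAll {q} {{nz}} A ×
    ((+ ∣ lA²+kA {q} {{nz}} l k A ∣) / 1 < ε * ((+ q) / 1))
theorem5 (suc l) k _ (s≤s l≤2) ε 0<ε M = q , q≢0 , A
  , (PrimeList.list P , PrimeList.primes P , PrimeList.unique P , PrimeList.above P , refl)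
  , pairs-diff q f
  , below-ε ε 0<ε ∣ lA²+kA (suc l) k A ∣ q (ℕ.≤-<-trans (ℕ.*-monoˡ-≤ (↧ₙ ε) (∣∣≤Size (lA²+kA (suc l) k A) shifted bad)) sparse)
  where
  -- With the denominator of ε as `D`, sparseness of the final state is the inequality that
  -- `below-ε` asks for.
  open Stages M (↧ₙ ε) k
  open State (proj₁ everything-caught)
  instance
    q-nonZero : NonZero q
    q-nonZero = q≢0
  A = pairs q f
  pad = padding q f l
  cancel : ∀ z p → z ≡ z ℤ.+ p ℤ.- p
  cancel = solve-∀
  -- The values known to be bad are those with the padding products included; translating by the
  -- constant `pad` does not change the number of classes.
  shifted : Size q (λ z → Bad (z ℤ.+ pad)) B
  shifted = record
    { code  = Size.code size
    ; code< = Size.code< size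
    ; inj   = λ {z} {z′} s s′ e → Cong-trans (≡⇒Cong (cancel z pad)) (Cong-trans (Cong-- (Size.inj size s s′ e) (Cong-refl {a = pad})) (≡⇒Cong (sym (cancel z′ pad))))
    }
  bad : ∀ {u} → u ∈ lA²+kA (suc l) k A → Bad (+ toℕ u ℤ.+ pad)
  bad u∈ = let (ps , h) = lA²+kA⁻ q f l k l≤2 u∈ in resp h (proj₂ everything-caught (proj₁ ∘ ps) (proj₂ ∘ ps))
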